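{- Let $m\ge 3$ and $r\ge 0$ be integers and $n=3m+r$. The number of permutations $\pi\in\mathfrak{S}_n$ that avoid $132$ and whose disjoint cycle decomposition consists of exactly $r$ fixed points and $m$ $3$-cycles is \[ \sum_{k=1}^m\sum_{\ell=2}^{k+1}2^{\ell-1}\binom{r+\ell-1}{r} M_{k-1,\ell-2}\sum_{(x_1,\dots,x_k) \in\mathcal{P}_{m,k}} C_{x_1}\cdots C_{x_k}, \] where $\mathcal{P}_{m,k}$ is the set of compositions of $m$ into exactly $k$ positive parts, $C_j=\frac{1}{j+1}\binom{2j}{j}$ is the $j$-th Catalan number, and $M_{k-1,\ell-2}$ is the number of Motzkin paths of length $k-1$ having exactly $\ell-2$ flat steps at height zero.
   Context: A permutation contains a pattern $\sigma$ if some subsequence of its one-line notation is in the same relative order as $\sigma$; otherwise it avoids $\sigma$. A Motzkin path of length $k$ is a lattice path from $(0,0)$ to $(k,0)$ with steps $(1,1)$, $(1,-1)$, $(1,0)$ (the last called flat steps) that never goes below the $x$-axis; a flat step is at height zero if it lies on the $x$-axis. -}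

module Defs where

open import Data.Fin.Base as Fin using (Fin)
open import Data.Fin.Patterns using (1F; 2F)
open import Data.Fin.Permutation using (Permutation′; _⟨$⟩ʳ_; transpose)
open import Data.Integer.Base as ℤ using (ℤ; 0ℤ; 1ℤ; -1ℤ)
import Data.Integer.Properties as ℤ
open import Data.List.Base using (List; []; _∷_; [_]; _∷ʳ_; allFin;
  cartesianProductWith; concat; filter; length; map; upTo; zip)
open import Data.List.Relation.Binary.Permutation.Propositional using (_↭_)
open import Data.List.Relation.Unary.All using (All; all?)
open import Data.Nat.Base using (ℕ; zero; suc; _+_; _*_; _∸_; _/_; _<_)
open import Data.Nat.ListAction using (sum)
import Data.Nat.Properties as ℕ
open import Data.Nat.Combinatorics using (_C_)
open import Data.Product.Base using (Σ; Σ-syntax; ∃-syntax; _×_; _,_; proj₁)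
open import Function.Base using (_∘_)
open import Function.Bundles using (Bijection; _⇔_)
open import Level using (0ℓ)
open import Relation.Binary.Bundles using (Setoid)
import Relation.Binary.Construct.On as On
open import Relation.Binary.PropositionalEquality
  using (_≡_; refl; setoid; _→-setoid_)
open import Relation.Nullary using (¬_; yes; no)
open import Relation.Nullary.Decidable using (_×-dec_)
open import Relation.Unary using (Pred; Decidable)

-- π has one-line notation π 0, π 1, …, π (n ∸ 1): positions and values are
-- both counted from 0.  The strictly increasing ι picks the subsequence.
Contains : ∀ {k n} → Permutation′ k → Permutation′ n → Set
Contains {k} {n} σ π =
  Σ[ ι ∈ (Fin k → Fin n) ]
         (∀ {a b} → a Fin.< b → ι a Fin.< ι b)
       × (∀ (a b : Fin k) →
            ((σ ⟨$⟩ʳ a) Fin.< (σ ⟨$⟩ʳ b)) ⇔ ((π ⟨$⟩ʳ ι a) Fin.< (π ⟨$⟩ʳ ι b)))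

Avoids : ∀ {k n} → Permutation′ k → Permutation′ n → Set
Avoids σ π = ¬ Contains σ π

-- One-line notation 0, 2, 1.
⟨132⟩ : Permutation′ 3
⟨132⟩ = transpose 1F 2F

-- The list c₁ , … , cⱼ stands for the cycle (c₁ … cⱼ): π sends each cᵢ to
-- cᵢ₊₁ and cⱼ back to c₁.
data IsCycle {n} (π : Permutation′ n) : List (Fin n) → Set where
  cycle : ∀ {c cs} → map (π ⟨$⟩ʳ_) (c ∷ cs) ≡ cs ∷ʳ c → IsCycle π (c ∷ cs)

-- Disjointness and exhaustiveness: concatenating the cycles lists each element
-- of Fin n exactly once.
IsCycleDecomposition : ∀ {n} → Permutation′ n → List (List (Fin n)) → Set
IsCycleDecomposition {n} π cs = All (IsCycle π) cs × concat cs ↭ allFin n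

-- The cycle lengths, with multiplicity, are the given ones in some order.
HasCycleType : ∀ {n} → List ℕ → Permutation′ n → Set
HasCycleType λs π = ∃[ cs ] IsCycleDecomposition π cs × map length cs ↭ λs

-- Permutations are compared as functions, irrespective of inverses and of the
-- proofs that they satisfy P.
permutationsWith : ∀ {n} → Pred (Permutation′ n) 0ℓ → Setoid 0ℓ 0ℓ
permutationsWith {n} P = On.setoid {B = Σ (Permutation′ n) P}
  (Fin n →-setoid Fin n) ((_⟨$⟩ʳ_) ∘ proj₁)

HasCardinality : Setoid 0ℓ 0ℓ → ℕ → Set
HasCardinality S N = Bijection (setoid (Fin N)) S

∑[_⋯_] : ℕ → ℕ → (ℕ → ℕ) → ℕ
∑[ a ⋯ b ] f = sum (map (λ i → f (a + i)) (upTo (suc b ∸ a)))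

-- All lists of length k with entries from as; no repetitions if as has none.
words : ∀ {A : Set} → List A → ℕ → List (List A)
words as zero    = [ [] ]
words as (suc k) = cartesianProductWith _∷_ as (words as k)

-- The division is exact.
Catalan : ℕ → ℕ
Catalan j = ((2 * j) C j) / suc j

IsComposition : ℕ → Pred (List ℕ) 0ℓ
IsComposition m xs = All (0 <_) xs × sum xs ≡ m

isComposition? : ∀ m → Decidable (IsComposition m)
isComposition? m xs = all? (0 ℕ.<?_) xs ×-dec (sum xs ℕ.≟ m)

-- The parts of a composition of m are at most m, so searching the words over
-- 0 , … , m misses none.
compositions : ℕ → ℕ → List (List ℕ)
compositions m k = filter (isComposition? m) (words (upTo (suc m)) k)

data Step : Set where
  up down flat : Step

flat? : Decidable (_≡ flat)
flat? up   = no λ ()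
flat? down = no λ ()
flat? flat = yes refl

rise : Step → ℤ
rise up   = 1ℤ
rise down = -1ℤ
rise flat = 0ℤ

-- The height after all the steps, and the list of heights before each step,
-- for a path starting at height h.
endHeight : ℤ → List Step → ℤ
endHeight h []       = h
endHeight h (s ∷ ss) = endHeight (h ℤ.+ rise s) ss

startHeights : ℤ → List Step → List ℤ
startHeights h []       = []
startHeights h (s ∷ ss) = h ∷ startHeights (h ℤ.+ rise s) ss

IsMotzkin : Pred (List Step) 0ℓ
IsMotzkin ss = All (0ℤ ℤ.≤_) (startHeights 0ℤ ss) × endHeight 0ℤ ss ≡ 0ℤ

isMotzkin? : Decidable IsMotzkin
isMotzkin? ss = all? (0ℤ ℤ.≤?_) (startHeights 0ℤ ss) ×-dec (endHeight 0ℤ ss ℤ.≟ 0ℤ)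

flatsAtZero : List Step → ℕ
flatsAtZero ss =
  length (filter (λ (s , h) → flat? s ×-dec (h ℤ.≟ 0ℤ)) (zip ss (startHeights 0ℤ ss)))

-- The number of Motzkin paths of length k with exactly j flat steps at height
-- zero.
Motzkin : ℕ → ℕ → ℕ
Motzkin k j = length (filter (λ ss → isMotzkin? ss ×-dec (flatsAtZero ss ℕ.≟ j))
                             (words (up ∷ down ∷ flat ∷ []) k))

{-# OPTIONS --safe #-}
module Submission where

open import Defs
open import Data.List.Base using (map; replicate; _++_)
open import Data.Nat.ListAction using (product; sum)
open import Data.Nat.Base using (ℕ; _+_; _*_; _∸_; _^_; _≤_)
open import Data.Nat.Combinatorics using (_C_)
open import Data.Product.Base using (_×_)
open import Relation.Binary.PropositionalEquality using (_≡_)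

open import Data.Bool.Base using (Bool; true; false; not)
open import Data.Bool.Properties as Bool using (not-¬)
open import Data.Empty using (⊥; ⊥-elim)
open import Data.Fin.Base as Fin
  using (Fin; zero; suc; toℕ; fromℕ; fromℕ<; inject₁; opposite; punchOut)
open import Data.Fin.Patterns using (0F; 1F; 2F)
open import Data.Fin.Permutation using (Permutation′; _⟨$⟩ʳ_; permutation)
import Data.Fin.Properties as Fin
open import Data.Integer.Base as ℤ using (ℤ; 0ℤ; -[1+_])
import Data.Integer.Properties as ℤ
open import Data.List.Base using (List; []; _∷_; _∷ʳ_; allFin; applyUpTo;
  cartesianProductWith; concat; concatMap; filter; length; lookup; upTo; zip)
open import Data.List.Membership.Propositional using (_∈_; find; lose)
open import Data.List.Membership.Propositional.Properties using (∈-++⁺ˡ; ∈-++⁺ʳ; ∈-++⁻;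
  ∈-concat⁻′; ∈-concatMap⁺; ∈-concatMap⁻; ∈-upTo⁺; ∈-upTo⁻; ∈-allFin; ∈-map⁺; ∈-lookup)
open import Data.List.Membership.Propositional.Properties.WithK using (unique∧set⇒bag)
open import Data.List.Properties as List using (++-assoc; ++-cancelʳ; ∷ʳ-injectiveʳ;
  concat-map; filter-++; filter-reject; length-++; map-++; map-∘; map-cong; map-tabulate; map-upTo)
open import Data.List.Relation.Binary.BagAndSetEquality using (∼bag⇒↭)
open import Data.List.Relation.Binary.Disjoint.Propositional using (Disjoint)
open import Data.List.Relation.Binary.Permutation.Propositional
  using (_↭_; prep; swap; ↭-refl; ↭-sym; ↭-trans; ↭-reflexive; ↭⇒↭ₛ)
open import Data.List.Relation.Binary.Permutation.Propositional.Properties as ↭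
  using (All-resp-↭; ∈-resp-↭; ↭-length; filter-↭)
import Data.List.Relation.Binary.Permutation.Setoid.Properties as ↭ₛ
open import Data.List.Relation.Unary.All as All using (All; []; _∷_)
import Data.List.Relation.Unary.All.Properties as All
open import Data.List.Relation.Unary.AllPairs as AllPairs using ([]; _∷_)
import Data.List.Relation.Unary.AllPairs.Properties as AllPairs
open import Data.List.Relation.Unary.Any as Any using (here; there)
import Data.List.Relation.Unary.Any.Properties as Any
open import Data.List.Relation.Unary.Unique.Propositional using (Unique)
import Data.List.Relation.Unary.Unique.Propositional.Properties as Unique
open import Data.Nat.Base
  using (zero; suc; _/_; _<_; z≤n; s≤s; z<s; s<s; s≤s⁻¹; pred; >-nonZero)
open import Data.Nat.Combinatorics
  using (nCn≡1; nCk≡nC[n∸k]; k>n⇒nCk≡0; nCk+nC[k+1]≡[n+1]C[k+1])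
open import Data.Nat.DivMod using (m*n/n≡m)
open import Data.Nat.ListAction.Properties using (sum-++)
open import Data.Nat.Properties as ℕ using (≤-refl; ≤-trans; <-trans; <-≤-trans; ≤-<-trans;
  <-irrefl; <⇒≤; ≮⇒≥; ≤⇒≯; <⇒≱; n<1+n; m≤n⇒m≤1+n; m<n⇒m<1+n; _<?_;
  +-identityʳ; +-comm; +-assoc; *-comm; *-assoc; *-zeroʳ; *-distribˡ-+; *-distribʳ-+)
open import Algebra.Properties.CommutativeSemigroup ℕ.+-commutativeSemigroup
  using (interchange; x∙yz≈y∙xz)
open import Data.Nat.Solver using (module +-*-Solver)
open import Data.Product.Base using (∃; ∃-syntax; _,_; proj₁; proj₂)
open import Data.Sum.Base using (_⊎_; inj₁; inj₂; [_,_]′)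
open import Function.Base using (_∘_; id)
open import Function.Bundles using (_⇔_; mk⇔; Equivalence)
open import Level using (0ℓ)
open import Relation.Binary.Definitions using (tri<; tri≈; tri>)
open import Relation.Binary.PropositionalEquality
  using (_≢_; _≗_; refl; sym; trans; cong; cong₂; subst; subst₂; setoid; module ≡-Reasoning)
open import Relation.Nullary using (¬_; yes; no; contradiction)
open import Relation.Nullary.Decidable using (_×-dec_)
open import Relation.Unary using (Pred; Decidable)

-- Reversing positions and values turns 132 into 213.  If a 213-avoiding f with
-- f³ = id moves its first element, then the cycle of its last element l, read
-- off f or off its inverse, is l ↦ t ↦ m ↦ l with t < m < l.  Deleting it, and
-- deleting the first element if that is fixed, reduces f to the empty
-- permutation.  Conversely a cycle (l t m) can be inserted with k old elements
-- before t and q before m iff Valid f k q, and after the insertion the valid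
-- pairs are again explicit: they are described by two numbers s and t.  So the
-- permutations correspond to paths in a generating tree with nodes (s , t).
--
-- Let z mark 3-cycles and u fixed points, C = 1 + z C², X = z C, and let T s be
-- the generating function of the paths that start in (s , 0).  Those that start
-- in (s , t) have Cᵗ T s, so T (s + 1) = T s + X T (s + 2).  Eliminating every
-- other T turns X into D = X / (1 - X) = C - 1 and gives the recurrence of the
-- Motzkin paths with weight D on each step, X ^ (h + 1) T (2 h + 1) belonging
-- to height h.

-- If a 213-avoiding `f` with `f³ = id` moves its first element, it also moves its last element `l`,
-- and exactly one orientation of the cycle of `l` reads `l ↦ t ↦ m ↦ l` with `t < m`. Forbidding
-- the occurrences of 213 that use `l`, `t` or `m`, together with the first element being moved,
-- amounts to the conditions `Valid` on the rest (`valid-delete`), and these suffice for putting the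
-- cycle back (`avoiding-insert`).
--
-- The insertion points evolve by simple rules. In the orientation of the last cycle there are
-- `s + 1` points with `k = 0`, while for `k = 1 , … , t` the value of `q` is forced
-- (`valid-determined`). In the other orientation only `k = q = 0` remains (`valid-reversed⇒00`). A
-- fixed point leads to the node `(0 , 0)`, a reversal of orientation to `(1 , 1)`, the block point
-- `c` to `(c + 1 , 1)`, and `k = j + 1` to `(s , j + 2)` (`spec-block`, `spec-extend`). Recording
-- these choices as a word is a bijection (`encode`, `decode`, `enc-injective`, `enc-unique`).
--
-- To count the words, note that `(s , t + 1)` has just one child more than `(s , t)`, which makes
-- each unit of `t` a factor `C` (`continuations-conv`), and that `(s + 1 , 0)` has one child more
-- than `(s , 0)`. Eliminating the even indices yields the first-step recurrence of Motzkin paths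
-- with weight `D` on each step (`K-suc`, `K-zero`). The root equation
-- `T 0 = (1 + 2 X T 1) / (1 - u)` puts an additional weight `2 / (1 - u)` on flat steps at height
-- 0: their number produces the power of 2 and the binomial coefficient. As `D = C - 1`, the `k`-th
-- power of `D` has the sums of Catalan products over compositions into `k` parts as its
-- coefficients (`compositionSum≡`).

Endo : ℕ → Set
Endo n = Fin n → Fin n

private variable
  n k q j p : ℕ
  f g h : Endo n

-- Insertion points of 213-avoiding maps of order dividing 3

Cubic : Endo n → Set
Cubic f = ∀ x → f (f (f x)) ≡ x

cubic⇒injective : Cubic f → ∀ {x y} → f x ≡ f y → x ≡ y
cubic⇒injective {f = f} f³ {x} {y} eq =
  trans (sym (f³ x)) (trans (cong (f ∘ f) eq) (f³ y))

-- The pattern 213, i.e. 132 read with positions and values both reversed.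
Avoiding : Endo n → Set
Avoiding f = ∀ {x y z} → x Fin.< y → y Fin.< z → f y Fin.< f x → f x Fin.< f z → ⊥

-- Exactly the condition under which a 3-cycle (l t m) can be inserted into a
-- 213-avoiding f with l in the last place, k old elements before t, and q old
-- elements before m; see avoiding-insert and valid-delete.
record Valid {n} (f : Endo n) (k q : ℕ) : Set where
  field
    k≤q    : k ≤ q
    inc    : ∀ {x y} → x Fin.< y → toℕ y < q → f x Fin.< f y
    leave  : ∀ {x} → k ≤ toℕ x → toℕ x < q → q ≤ toℕ (f x)
    enter  : ∀ {x} → toℕ x < k → toℕ (f x) < q
    escape : ∀ {x} → toℕ x < k → k ≤ toℕ (f x)
    inc⁻¹   : ∀ {x y} → x Fin.< y → toℕ (f x) < k → toℕ (f y) < k → f x Fin.< f y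
    upward : ∀ {x y} → k ≤ toℕ x → x Fin.< y → toℕ (f x) < q → toℕ (f y) < q

valid-cong : f ≗ g → Valid f k q → Valid g k q
valid-cong {f = f} {g = g} {k} {q} eq v = record
  { k≤q = k≤q
  ; inc = λ {x} {y} → subst₂ (λ a b → x Fin.< y → toℕ y < q → a Fin.< b) (eq x) (eq y) inc
  ; leave = λ {x} → subst (λ a → k ≤ toℕ x → toℕ x < q → q ≤ toℕ a) (eq x) leave
  ; enter = λ {x} → subst (λ a → toℕ x < k → toℕ a < q) (eq x) enter
  ; escape = λ {x} → subst (λ a → toℕ x < k → k ≤ toℕ a) (eq x) escape
  ; inc⁻¹ = λ {x} {y} → subst₂ (λ a b → x Fin.< y → toℕ a < k → toℕ b < k → a Fin.< b) (eq x) (eq y) inc⁻¹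
  ; upward = λ {x} {y} → subst₂ (λ a b → k ≤ toℕ x → x Fin.< y → toℕ a < q → toℕ b < q) (eq x) (eq y) upward
  } where open Valid v

valid-00 : Valid f 0 0
valid-00 = record
  { k≤q = z≤n ; inc = λ _ () ; leave = λ _ () ; enter = λ () ; escape = λ ()
  ; inc⁻¹ = λ _ () ; upward = λ _ _ () }

-- For positive `k` the condition `escape`, and for `k = 0 < q` the condition `leave`, moves the
-- element 0. This is why a fixed point leads to the node `(0 , 0)`.
valid-fixed⇒00 : ∀ {f : Endo (suc n)} → f zero ≡ zero → Valid f k q → k ≡ 0 × q ≡ 0
valid-fixed⇒00 {k = zero} {zero} _ _ = refl , refl
valid-fixed⇒00 {k = zero} {suc q} {f} f0 v =
  contradiction (subst (λ z → suc q ≤ toℕ z) f0 (leave z≤n z<s)) λ ()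
  where open Valid v
valid-fixed⇒00 {k = suc k} {q} {f} f0 v =
  contradiction (subst (λ z → suc k ≤ toℕ z) f0 (escape z<s)) λ ()
  where open Valid v

-- Since {x < q} is mapped increasingly, q is read off the image of the last
-- element of {x < k}.
valid-determined : Cubic f → Valid f (suc j) q → q ≤ n →
  ∀ (v : Fin n) → toℕ v ≡ j → q ≡ suc (toℕ (f v))
valid-determined {n = n} {f = f} {j} {suc q} f³ valid q≤n v v≡j with ℕ.<-cmp (toℕ (f v)) q
... | tri≈ _ eq _ = cong suc (sym eq)
... | tri> _ _ q<fv = contradiction (Valid.enter valid (subst (_< suc j) (sym v≡j) (n<1+n j)))
                        (≤⇒≯ q<fv)
... | tri< fv<q _ _ = ⊥-elim (contra (toℕ y <? suc j))
  where
  open Valid valid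
  μ : Fin n
  μ = fromℕ< q≤n
  toℕ-μ : toℕ μ ≡ q
  toℕ-μ = Fin.toℕ-fromℕ< q≤n
  μ<1+q : toℕ μ < suc q
  μ<1+q = subst (_< suc q) (sym toℕ-μ) (n<1+n q)
  v<1+j : toℕ v < suc j
  v<1+j = subst (_< suc j) (sym v≡j) (n<1+n j)
  fv<μ : f v Fin.< μ
  fv<μ = subst (toℕ (f v) <_) (sym toℕ-μ) fv<q
  -- `y` is the preimage of `μ`, the last element below `suc q`. By `upward` it lies below `suc q`,
  -- hence by `leave` below `suc j`; there `v` comes last, so `inc` gives `μ ≤ f v`.
  y : Fin n
  y = f (f μ)
  ffv≥ : suc q ≤ toℕ (f (f v))
  ffv≥ = leave (escape v<1+j) (enter v<1+j)
  y<1+q : toℕ y < suc q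
  y<1+q = upward (≤-trans k≤q ffv≥) (inc fv<μ μ<1+q)
    (subst (λ z → toℕ z < suc q) (sym (f³ v)) (<-≤-trans v<1+j k≤q))
  contra : _ → ⊥
  contra (no y≮) = <⇒≱ μ<1+q (subst (λ z → suc q ≤ toℕ z) (f³ μ) (leave (≮⇒≥ y≮) y<1+q))
  contra (yes y<) with ℕ.<-cmp (toℕ y) (toℕ v)
  ... | tri< y<v _ _ = ℕ.<-asym fv<μ (subst (Fin._< f v) (f³ μ) (inc y<v (<-≤-trans v<1+j k≤q)))
  ... | tri≈ _ y≡v _ = <-irrefl (cong toℕ (trans (cong f (sym (Fin.toℕ-injective y≡v))) (f³ μ))) fv<μ
  ... | tri> _ _ v<y = <⇒≱ v<y (s≤s⁻¹ (subst (λ i → toℕ y < suc i) (sym v≡j) y<))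

-- Makes the possible values of `k` an initial segment: cutting `{x < k}` off after `v` leaves an
-- insertion point, with the `q` that `valid-determined` dictates.
valid-downward : Cubic f → Valid f k q → ∀ (v : Fin n) → toℕ v < k →
  Valid f (suc (toℕ v)) (suc (toℕ (f v)))
valid-downward {f = f} {k} {q} f³ valid v v<k = record
  { k≤q    = s≤s (≤-trans (<⇒≤ v<k) (escape v<k))
  ; inc    = λ x<y y≤fv → inc x<y (below y≤fv)
  ; leave  = λ {x} v<x x≤fv → leave′ v<x (below x≤fv) (toℕ x <? k)
  ; enter  = λ {x} x≤v → s≤s (enter′ x≤v)
  ; escape = λ x≤v → ≤-trans v<k (escape (≤-<-trans (s≤s⁻¹ x≤v) v<k))
  ; inc⁻¹   = λ x<y fx≤v fy≤v → inc⁻¹ x<y (≤-<-trans (s≤s⁻¹ fx≤v) v<k) (≤-<-trans (s≤s⁻¹ fy≤v) v<k)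
  ; upward = λ {x} {y} v<x x<y fx≤fv → s≤s (upward′ v<x x<y fx≤fv)
  }
  where
  open Valid valid
  below : ∀ {i} → i < suc (toℕ (f v)) → i < q
  below i≤fv = ≤-<-trans (s≤s⁻¹ i≤fv) (enter v<k)
  leave′ : ∀ {x} → toℕ v < toℕ x → toℕ x < q → _ → toℕ (f v) < toℕ (f x)
  leave′ v<x x<q (yes x<k) = inc v<x x<q
  leave′ v<x x<q (no x≮k)  = <-≤-trans (enter v<k) (leave (≮⇒≥ x≮k) x<q)
  enter′ : ∀ {x} → toℕ x < suc (toℕ v) → toℕ (f x) ≤ toℕ (f v)
  enter′ {x} x≤v with ℕ.<-cmp (toℕ x) (toℕ v)
  ... | tri< x<v _ _ = <⇒≤ (inc x<v (<-≤-trans v<k k≤q))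
  ... | tri≈ _ x≡v _ = ℕ.≤-reflexive (cong (toℕ ∘ f) (Fin.toℕ-injective x≡v))
  ... | tri> _ _ v<x = contradiction v<x (≤⇒≯ (s≤s⁻¹ x≤v))
  upward′ : ∀ {x y} → toℕ v < toℕ x → x Fin.< y → toℕ (f x) < suc (toℕ (f v)) → toℕ (f y) ≤ toℕ (f v)
  upward′ {x} {y} v<x x<y fx≤fv with toℕ x <? k | toℕ (f v) <? toℕ (f y)
  ... | _ | no fv≮fy = ≮⇒≥ fv≮fy
  ... | yes x<k | _  = contradiction (inc v<x (<-≤-trans x<k k≤q)) (≤⇒≯ (s≤s⁻¹ fx≤fv))
  -- `f y` would still be below `q`. Since `f (f v)` is at least `q` and is sent to `v`, `upward`
  -- would also put `y` below `q`, against `leave`.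
  ... | no x≮k | yes fv<fy = contradiction fy<q (≤⇒≯ (leave (<⇒≤ (≤-<-trans (≮⇒≥ x≮k) x<y)) y<q))
    where
    fy<q : toℕ (f y) < q
    fy<q = upward (≮⇒≥ x≮k) x<y (below fx≤fv)
    y<q : toℕ y < q
    y<q = subst (λ z → toℕ z < q) (f³ y)
      (upward (≤-trans k≤q (leave (escape v<k) (enter v<k))) (inc fv<fy fy<q)
        (subst (λ z → toℕ z < q) (sym (f³ v)) (<-≤-trans v<k k≤q)))

-- Inserting a 3-cycle

lastOf : ∀ N → Fin (3 + N)
lastOf N = fromℕ (2 + N)

toℕ-lastOf : ∀ N → toℕ (lastOf N) ≡ 2 + N
toℕ-lastOf N = Fin.toℕ-fromℕ (2 + N)

-- The graph of the position shift on natural numbers: order facts about `shift` become case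
-- distinctions, free of `Fin` coercions.
data Shift (k q x : ℕ) : ℕ → Set where
  low  : x < k → Shift k q x x
  mid  : k ≤ x → x < q → Shift k q x (1 + x)
  high : k ≤ x → q ≤ x → Shift k q x (2 + x)

abstract
  -- The position of an old element after the new ones have taken the positions
  -- k, suc q and the last one.
  shift : ∀ {N} (k q : ℕ) → Fin N → Fin (3 + N)
  shift k q x with toℕ x <? k | toℕ x <? q
  ... | yes _ | _     = inject₁ (inject₁ (inject₁ x))
  ... | no _  | yes _ = inject₁ (inject₁ (suc x))
  ... | no _  | no _  = inject₁ (suc (suc x))

  shift-view : ∀ {N} k q (x : Fin N) → Shift k q (toℕ x) (toℕ (shift k q x))
  shift-view k q x with toℕ x <? k | toℕ x <? q
  ... | yes x<k | _
    rewrite Fin.toℕ-inject₁ (inject₁ (inject₁ x)) | Fin.toℕ-inject₁ (inject₁ x) | Fin.toℕ-inject₁ x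
    = low x<k
  ... | no x≮k  | yes x<q
    rewrite Fin.toℕ-inject₁ (inject₁ x) | Fin.toℕ-inject₁ x
    = mid (≮⇒≥ x≮k) x<q
  ... | no x≮k  | no x≮q
    rewrite Fin.toℕ-inject₁ x
    = high (≮⇒≥ x≮k) (≮⇒≥ x≮q)

Shift-mono-< : ∀ {x y x′ y′} → Shift k q x x′ → Shift k q y y′ → x < y → x′ < y′
Shift-mono-< (low _)      (low _)      x<y = x<y
Shift-mono-< (low _)      (mid _ _)    x<y = m<n⇒m<1+n x<y
Shift-mono-< (low _)      (high _ _)   x<y = m<n⇒m<1+n (m<n⇒m<1+n x<y)
Shift-mono-< (mid k≤x _)  (low y<k)    x<y = contradiction (<-trans x<y y<k) (≤⇒≯ k≤x)
Shift-mono-< (mid _ _)    (mid _ _)    x<y = s<s x<y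
Shift-mono-< (mid _ _)    (high _ _)   x<y = s<s (m<n⇒m<1+n x<y)
Shift-mono-< (high k≤x _) (low y<k)    x<y = contradiction (<-trans x<y y<k) (≤⇒≯ k≤x)
Shift-mono-< (high _ q≤x) (mid _ y<q)  x<y = contradiction (<-trans x<y y<q) (≤⇒≯ q≤x)
Shift-mono-< (high _ _)   (high _ _)   x<y = s<s (s<s x<y)

Shift-<k : ∀ {x x′} → Shift k q x x′ → x < k → x′ < k
Shift-<k (low _)      x<k = x<k
Shift-<k (mid k≤x _)  x<k = contradiction x<k (≤⇒≯ k≤x)
Shift-<k (high k≤x _) x<k = contradiction x<k (≤⇒≯ k≤x)

Shift-≥k : ∀ {x x′} → Shift k q x x′ → k ≤ x → k < x′
Shift-≥k (low x<k)    k≤x = contradiction x<k (≤⇒≯ k≤x)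
Shift-≥k (mid k≤x _)  _   = s≤s k≤x
Shift-≥k (high k≤x _) _   = m≤n⇒m≤1+n (s≤s k≤x)

-- The threshold p separates the old elements in the same way as suc p
-- separates the shifted ones, provided that k ≤ p ≤ q.
Shift-<p : ∀ {x x′} → k ≤ p → p ≤ q → Shift k q x x′ → x < p → x′ < suc p
Shift-<p _ _ (low _)      x<p = m<n⇒m<1+n x<p
Shift-<p _ _ (mid _ _)    x<p = s<s x<p
Shift-<p _ p≤q (high _ q≤x) x<p = contradiction (<-≤-trans x<p p≤q) (≤⇒≯ q≤x)

Shift-≥p : ∀ {x x′} → k ≤ p → p ≤ q → Shift k q x x′ → p ≤ x → suc p ≤ x′
Shift-≥p k≤p _ (low x<k)  p≤x = contradiction (<-≤-trans x<k k≤p) (≤⇒≯ p≤x)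
Shift-≥p _ _ (mid _ _)    p≤x = s≤s p≤x
Shift-≥p _ _ (high _ _)   p≤x = m≤n⇒m≤1+n (s≤s p≤x)

Shift-≥q : ∀ {x x′} → k ≤ q → Shift k q x x′ → q ≤ x → 2 + q ≤ x′
Shift-≥q k≤q (low x<k)   q≤x = contradiction (<-≤-trans x<k k≤q) (≤⇒≯ q≤x)
Shift-≥q _   (mid _ x<q) q≤x = contradiction x<q (≤⇒≯ q≤x)
Shift-≥q _   (high _ _)  q≤x = s≤s (s≤s q≤x)

Shift-≤ : ∀ {x x′} → Shift k q x x′ → x′ ≤ 2 + x
Shift-≤ (low _)    = m≤n⇒m≤1+n (m≤n⇒m≤1+n ≤-refl)
Shift-≤ (mid _ _)  = m≤n⇒m≤1+n ≤-refl
Shift-≤ (high _ _) = ≤-refl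

Shift-functional : ∀ {x y z} → Shift k q x y → Shift k q x z → y ≡ z
Shift-functional (low _)      (low _)      = refl
Shift-functional (low x<k)    (mid k≤x _)  = contradiction x<k (≤⇒≯ k≤x)
Shift-functional (low x<k)    (high k≤x _) = contradiction x<k (≤⇒≯ k≤x)
Shift-functional (mid k≤x _)  (low x<k)    = contradiction x<k (≤⇒≯ k≤x)
Shift-functional (mid _ _)    (mid _ _)    = refl
Shift-functional (mid _ x<q)  (high _ q≤x) = contradiction x<q (≤⇒≯ q≤x)
Shift-functional (high k≤x _) (low x<k)    = contradiction x<k (≤⇒≯ k≤x)
Shift-functional (high _ q≤x) (mid _ x<q)  = contradiction x<q (≤⇒≯ q≤x)
Shift-functional (high _ _)   (high _ _)   = refl

-- `t` and `m` are fields with prescribed values, not computed from `k` and `q`, so that a deletion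
-- can take the actual images of `l`.
record Positions (N k q : ℕ) : Set where
  field
    t m   : Fin (3 + N)
    k≤q   : k ≤ q
    q≤N   : q ≤ N
    toℕ-t : toℕ t ≡ k
    toℕ-m : toℕ m ≡ suc q

  l : Fin (3 + N)
  l = lastOf N

  e : Fin N → Fin (3 + N)
  e = shift k q

  e-mono : ∀ {x y} → x Fin.< y → e x Fin.< e y
  e-mono {x} {y} = Shift-mono-< (shift-view k q x) (shift-view k q y)

  e-cancel : ∀ {x y} → e x Fin.< e y → x Fin.< y
  e-cancel {x} {y} ex<ey with ℕ.<-cmp (toℕ x) (toℕ y)
  ... | tri< x<y _ _ = x<y
  ... | tri≈ _ x≡y _ = contradiction ex<ey (<-irrefl (cong (toℕ ∘ e) (Fin.toℕ-injective x≡y)))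
  ... | tri> _ _ y<x = contradiction ex<ey (ℕ.<-asym (e-mono y<x))

  e-injective : ∀ {x y} → e x ≡ e y → x ≡ y
  e-injective {x} {y} eq with ℕ.<-cmp (toℕ x) (toℕ y)
  ... | tri< x<y _ _ = contradiction (e-mono x<y) (<-irrefl (cong toℕ eq))
  ... | tri≈ _ x≡y _ = Fin.toℕ-injective x≡y
  ... | tri> _ _ y<x = contradiction (e-mono y<x) (<-irrefl (cong toℕ (sym eq)))

  e<t : ∀ {x} → toℕ x < k → e x Fin.< t
  e<t {x} x<k = subst (toℕ (e x) <_) (sym toℕ-t) (Shift-<k (shift-view k q x) x<k)

  t<e : ∀ {x} → k ≤ toℕ x → t Fin.< e x
  t<e {x} k≤x = subst (_< toℕ (e x)) (sym toℕ-t) (Shift-≥k (shift-view k q x) k≤x)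

  e<m : ∀ {x} → toℕ x < q → e x Fin.< m
  e<m {x} x<q = subst (toℕ (e x) <_) (sym toℕ-m) (Shift-<p k≤q ≤-refl (shift-view k q x) x<q)

  m<e : ∀ {x} → q ≤ toℕ x → m Fin.< e x
  m<e {x} q≤x = subst (_< toℕ (e x)) (sym toℕ-m) (Shift-≥q k≤q (shift-view k q x) q≤x)

  e<t⁻¹ : ∀ {x} → e x Fin.< t → toℕ x < k
  e<t⁻¹ ex<t = ℕ.≰⇒> λ k≤x → ℕ.<-asym ex<t (t<e k≤x)

  t<e⁻¹ : ∀ {x} → t Fin.< e x → k ≤ toℕ x
  t<e⁻¹ t<ex = ≮⇒≥ λ x<k → ℕ.<-asym t<ex (e<t x<k)

  e<m⁻¹ : ∀ {x} → e x Fin.< m → toℕ x < q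
  e<m⁻¹ ex<m = ℕ.≰⇒> λ q≤x → ℕ.<-asym ex<m (m<e q≤x)

  m<e⁻¹ : ∀ {x} → m Fin.< e x → q ≤ toℕ x
  m<e⁻¹ m<ex = ≮⇒≥ λ x<q → ℕ.<-asym m<ex (e<m x<q)

  e≢t : ∀ {x} → e x ≢ t
  e≢t ex≡t = Fin.<⇒≢ (e<t (ℕ.≰⇒> λ k≤x → Fin.<⇒≢ (t<e k≤x) (sym ex≡t))) ex≡t

  e≢m : ∀ {x} → e x ≢ m
  e≢m ex≡m = Fin.<⇒≢ (e<m (ℕ.≰⇒> λ q≤x → Fin.<⇒≢ (m<e q≤x) (sym ex≡m))) ex≡m

  t<m : t Fin.< m
  t<m = subst₂ _<_ (sym toℕ-t) (sym toℕ-m) (s≤s k≤q)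

  m<l : m Fin.< l
  m<l = subst₂ _<_ (sym toℕ-m) (sym (toℕ-lastOf N)) (s<s (s≤s q≤N))

  t<l : t Fin.< l
  t<l = <-trans t<m m<l

  e<l : ∀ {x} → e x Fin.< l
  e<l {x} = subst (toℕ (e x) <_) (sym (toℕ-lastOf N))
    (≤-<-trans (Shift-≤ (shift-view k q x)) (s<s (s<s (Fin.toℕ<n x))))

  ≤l : ∀ b → toℕ b ≤ toℕ l
  ≤l b = subst (toℕ b ≤_) (sym (toℕ-lastOf N)) (s≤s⁻¹ (Fin.toℕ<n b))

  data Slot : Fin (3 + N) → Set where
    isL : Slot l
    isT : Slot t
    isM : Slot m
    old : ∀ x → Slot (e x)

  slot : ∀ b → Slot b
  slot b = go (ℕ.<-cmp (toℕ b) k) (ℕ.<-cmp (toℕ b) (suc q)) (toℕ b <? 2 + N)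
    where
    from : ∀ {x} (x<N : x < N) → Shift k q x (toℕ b) → Slot b
    from {x} x<N sh = subst Slot (Fin.toℕ-injective (Shift-functional (shift-view k q (fromℕ< x<N))
      (subst (λ i → Shift k q i (toℕ b)) (sym (Fin.toℕ-fromℕ< x<N)) sh))) (old (fromℕ< x<N))
    go : _ → _ → _ → Slot b
    go (tri≈ _ b≡k _) _ _ = subst Slot (Fin.toℕ-injective (trans toℕ-t (sym b≡k))) isT
    go _ (tri≈ _ b≡1+q _) _ = subst Slot (Fin.toℕ-injective (trans toℕ-m (sym b≡1+q))) isM
    go (tri< b<k _ _) _ _ = from (<-≤-trans b<k (≤-trans k≤q q≤N)) (low b<k)
    go (tri> _ _ k<b) (tri< b<1+q _ _) _ with toℕ b in eq
    ... | suc x = from (≤-trans (s≤s⁻¹ b<1+q) q≤N)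
                    (subst (Shift k q x) (sym eq) (mid (s≤s⁻¹ k<b) (s≤s⁻¹ b<1+q)))
    go (tri> _ _ _) (tri> _ _ 1+q<b) (yes b<2+N) with toℕ b in eq
    ... | suc (suc x) = from (s≤s⁻¹ (s≤s⁻¹ b<2+N)) (subst (Shift k q x) (sym eq)
                          (high (≤-trans k≤q (s≤s⁻¹ (s≤s⁻¹ 1+q<b))) (s≤s⁻¹ (s≤s⁻¹ 1+q<b))))
    ... | suc zero = contradiction (s≤s⁻¹ 1+q<b) λ ()
    go (tri> _ _ _) (tri> _ _ _) (no b≮) = subst Slot (Fin.toℕ-injective
      (trans (toℕ-lastOf N) (ℕ.≤-antisym (≮⇒≥ b≮) (s≤s⁻¹ (Fin.toℕ<n b))))) isL

record Insertion {N} (k q : ℕ) (g : Endo (3 + N)) (g′ : Endo N) : Set where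
  field
    positions : Positions N k q
  open Positions positions public
  field
    g-l : g l ≡ t
    g-t : g t ≡ m
    g-m : g m ≡ l
    g-e : ∀ x → g (e x) ≡ e (g′ x)

module _ {N} {k q} {g : Endo (3 + N)} {g′ : Endo N} (ins : Insertion k q g g′) where
  open Insertion ins

  private
    transport⁻¹ : ∀ {a b c d : Fin (3 + N)} → a ≡ b → c ≡ d → b Fin.< d → a Fin.< c
    transport⁻¹ a≡b c≡d b<d = subst₂ Fin._<_ (sym a≡b) (sym c≡d) b<d

    transport : ∀ {a b c d : Fin (3 + N)} → a ≡ b → c ≡ d → a Fin.< c → b Fin.< d
    transport = subst₂ Fin._<_

    compare : ∀ {x y : Fin n} → x ≢ y → ¬ (y Fin.< x) → x Fin.< y
    compare {x = x} {y} x≢y y≮x with ℕ.<-cmp (toℕ x) (toℕ y)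
    ... | tri< x<y _ _ = x<y
    ... | tri≈ _ x≡y _ = contradiction (Fin.toℕ-injective x≡y) x≢y
    ... | tri> _ _ y<x = contradiction y<x y≮x

  insertion-cubic : Cubic g′ → Cubic g
  insertion-cubic g′³ b with slot b
  ... | isL   = trans (cong (g ∘ g) g-l) (trans (cong g g-t) g-m)
  ... | isT   = trans (cong (g ∘ g) g-t) (trans (cong g g-m) g-l)
  ... | isM   = trans (cong (g ∘ g) g-m) (trans (cong g g-l) g-t)
  ... | old x = trans (cong (g ∘ g) (g-e x)) (trans (cong g (g-e (g′ x)))
                  (trans (g-e (g′ (g′ x))) (cong e (g′³ x))))

  deletion-cubic : Cubic g → Cubic g′
  deletion-cubic g³ x = e-injective (trans (sym (trans (cong (g ∘ g) (g-e x))
    (trans (cong g (g-e (g′ x))) (g-e (g′ (g′ x)))))) (g³ (e x)))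

  avoiding-delete : Avoiding g → Avoiding g′
  avoiding-delete av x<y y<z gy<gx gx<gz = av (e-mono x<y) (e-mono y<z)
    (transport⁻¹ (g-e _) (g-e _) (e-mono gy<gx)) (transport⁻¹ (g-e _) (g-e _) (e-mono gx<gz))

  -- Each condition excludes one kind of occurrence of 213 that involves a new
  -- element.
  valid-delete : Cubic g → Avoiding g → g zero ≢ zero → Valid g′ k q
  valid-delete g³ av g0≢0 = record
    { k≤q = k≤q ; inc = inc ; leave = leave ; enter = enter
    ; escape = λ x<k → ≮⇒≥ (escape x<k) ; inc⁻¹ = inc⁻¹ ; upward = upward }
    where
    g′³ : Cubic g′
    g′³ = deletion-cubic g³
    g′-inj : ∀ {x y} → g′ x ≡ g′ y → x ≡ y
    g′-inj = cubic⇒injective g′³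
    inc : ∀ {x y} → x Fin.< y → toℕ y < q → g′ x Fin.< g′ y
    inc x<y y<q = compare (Fin.<⇒≢ x<y ∘ g′-inj) λ gy<gx →
      av (e-mono x<y) (e<m y<q) (transport⁻¹ (g-e _) (g-e _) (e-mono gy<gx)) (transport⁻¹ (g-e _) g-m e<l)
    leave : ∀ {x} → k ≤ toℕ x → toℕ x < q → q ≤ toℕ (g′ x)
    leave k≤x x<q = ≮⇒≥ λ gx<q →
      av (t<e k≤x) (e<m x<q) (transport⁻¹ (g-e _) g-t (e<m gx<q)) (transport⁻¹ g-t g-m m<l)
    enter : ∀ {x} → toℕ x < k → toℕ (g′ x) < q
    enter x<k = ℕ.≰⇒> λ q≤gx →
      av (e<t x<k) t<m (transport⁻¹ g-t (g-e _) (m<e q≤gx)) (transport⁻¹ (g-e _) g-m e<l)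
    inc⁻¹ : ∀ {x y} → x Fin.< y → toℕ (g′ x) < k → toℕ (g′ y) < k → g′ x Fin.< g′ y
    inc⁻¹ x<y gx<k gy<k = compare (Fin.<⇒≢ x<y ∘ g′-inj) λ gy<gx →
      av (e-mono x<y) e<l (transport⁻¹ (g-e _) (g-e _) (e-mono gy<gx)) (transport⁻¹ (g-e _) g-l (e<t gx<k))
    upward : ∀ {x y} → k ≤ toℕ x → x Fin.< y → toℕ (g′ x) < q → toℕ (g′ y) < q
    upward k≤x x<y gx<q = ℕ.≰⇒> λ q≤gy →
      av (t<e k≤x) (e-mono x<y) (transport⁻¹ (g-e _) g-t (e<m gx<q)) (transport⁻¹ g-t (g-e _) (m<e q≤gy))
    -- An orbit inside {x < q} is increasing, hence constant.
    orbit : ∀ x → toℕ x < q → toℕ (g′ x) < q → toℕ (g′ (g′ x)) < q → g′ x ≡ x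
    orbit x x<q gx<q ggx<q with ℕ.<-cmp (toℕ x) (toℕ (g′ x))
    ... | tri< x<gx _ _ = contradiction (subst (g′ (g′ x) Fin.<_) (g′³ x) (inc (inc x<gx gx<q) ggx<q))
                            (ℕ.<-asym (<-trans x<gx (inc x<gx gx<q)))
    ... | tri≈ _ x≡gx _ = sym (Fin.toℕ-injective x≡gx)
    ... | tri> _ _ gx<x = contradiction (subst (Fin._< g′ (g′ x)) (g′³ x) (inc (inc gx<x x<q) gx<q))
                            (ℕ.<-asym (<-trans (inc gx<x x<q) gx<x))
    -- If `x` and its image were below `k`, monotonicity would give the same for 0; the orbit of 0
    -- would then stay below `q`, and 0 would be fixed.
    escape : ∀ {x} → toℕ x < k → ¬ toℕ (g′ x) < k
    escape {x} x<k gx<k = g0≢0 g0≡0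
      where
      0<N : 0 < N
      0<N = <-≤-trans (≤-<-trans z≤n x<k) (≤-trans k≤q q≤N)
      z : Fin N
      z = fromℕ< 0<N
      toℕ-z : toℕ z ≡ 0
      toℕ-z = Fin.toℕ-fromℕ< 0<N
      z≤x : toℕ z ≤ toℕ x
      z≤x = subst (_≤ toℕ x) (sym toℕ-z) z≤n
      z<k : toℕ z < k
      z<k = ≤-<-trans z≤x x<k
      gz≤gx : toℕ (g′ z) ≤ toℕ (g′ x)
      gz≤gx with ℕ.m≤n⇒m<n∨m≡n z≤x
      ... | inj₁ z<x = <⇒≤ (inc z<x (<-≤-trans x<k k≤q))
      ... | inj₂ z≡x = ℕ.≤-reflexive (cong (toℕ ∘ g′) (Fin.toℕ-injective z≡x))
      gz<k : toℕ (g′ z) < k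
      gz<k = ≤-<-trans gz≤gx gx<k
      z-fixed : g′ z ≡ z
      z-fixed = orbit z (<-≤-trans z<k k≤q) (<-≤-trans gz<k k≤q) (enter gz<k)
      ez≡0 : e z ≡ zero
      ez≡0 = Fin.toℕ-injective (trans (Shift-functional (shift-view k q z) (low z<k)) toℕ-z)
      g0≡0 : g zero ≡ zero
      g0≡0 = trans (cong g (sym ez≡0)) (trans (g-e z) (trans (cong e z-fixed) ez≡0))

  -- `l` has the last position and `m` the largest value, so among the new elements only `t` could
  -- be the first or second entry of an occurrence. Each remaining case contradicts the order of the
  -- elements, one condition of `Valid`, or the avoidance of `g′`.
  avoiding-insert : Valid g′ k q → Avoiding g′ → Avoiding g
  avoiding-insert v av′ {a} {b} {c} a<b b<c gb<ga ga<gc = go (slot a) (slot b) (slot c) a<b b<c gb<ga ga<gc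
    where
    open Valid v using (inc; leave; enter; inc⁻¹; upward)
    go : ∀ {a b c} → Slot a → Slot b → Slot c →
      a Fin.< b → b Fin.< c → g b Fin.< g a → g a Fin.< g c → ⊥
    go isL _ _ a<b _ _ _ = <⇒≱ a<b (≤l _)
    go _ isL _ _ b<c _ _ = <⇒≱ b<c (≤l _)
    go isM _ _ _ _ _ ga<gc = <⇒≱ (transport g-m refl ga<gc) (≤l _)
    go _ isM _ _ _ gb<ga _ = <⇒≱ (transport g-m refl gb<ga) (≤l _)
    go isT isT _ a<b _ _ _ = <-irrefl refl a<b
    go isT (old y) isL _ _ _ ga<gc = <-irrefl refl (<-trans (transport g-t g-l ga<gc) t<m)
    go isT (old y) isT a<b b<c _ _ = <-irrefl refl (<-trans a<b b<c)
    go isT (old y) isM a<b b<c gb<ga _ =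
      <⇒≱ (e<m⁻¹ (transport (g-e y) g-t gb<ga)) (leave (t<e⁻¹ a<b) (e<m⁻¹ b<c))
    go isT (old y) (old z) a<b b<c gb<ga ga<gc =
      <⇒≱ (upward (t<e⁻¹ a<b) (e-cancel b<c) (e<m⁻¹ (transport (g-e y) g-t gb<ga)))
          (m<e⁻¹ (transport g-t (g-e z) ga<gc))
    go (old x) isT _ a<b _ gb<ga _ =
      <⇒≱ (enter (e<t⁻¹ a<b)) (m<e⁻¹ (transport g-t (g-e x) gb<ga))
    go (old x) (old y) isL a<b _ gb<ga ga<gc =
      ℕ.<-asym gy<gx (inc⁻¹ (e-cancel a<b) (e<t⁻¹ gx<t) (e<t⁻¹ (<-trans (e-mono gy<gx) gx<t)))
      where
      gy<gx = e-cancel (transport (g-e y) (g-e x) gb<ga)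
      gx<t  = transport (g-e x) g-l ga<gc
    go (old x) (old y) isT a<b b<c gb<ga _ =
      ℕ.<-asym (e-cancel (transport (g-e y) (g-e x) gb<ga)) (inc (e-cancel a<b) (<-≤-trans (e<t⁻¹ b<c) k≤q))
    go (old x) (old y) isM a<b b<c gb<ga _ =
      ℕ.<-asym (e-cancel (transport (g-e y) (g-e x) gb<ga)) (inc (e-cancel a<b) (e<m⁻¹ b<c))
    go (old x) (old y) (old z) a<b b<c gb<ga ga<gc =
      av′ (e-cancel a<b) (e-cancel b<c) (e-cancel (transport (g-e y) (g-e x) gb<ga))
        (e-cancel (transport (g-e x) (g-e z) ga<gc))

  -- The reversed cycle l ↦ m ↦ t ↦ l admits no further insertions around it.
  valid-reversed⇒00 : Cubic g → Valid (g ∘ g) p j → p ≡ 0 × j ≡ 0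
  valid-reversed⇒00 {p = p} {zero} _ v = ℕ.n≤0⇒n≡0 (Valid.k≤q v) , refl
  valid-reversed⇒00 {p = p} {suc j} g³ v = ⊥-elim (impossible p v)
    where
    r : Endo (3 + N)
    r = g ∘ g
    r-l : r l ≡ m
    r-l = trans (cong g g-l) g-t
    r-m : r m ≡ t
    r-m = trans (cong g g-m) g-l
    module _ {p} (v : Valid r p (suc j)) where
      open Valid v using (leave; upward)
      -- Here `r` reads `l ↦ m ↦ t`. The preimage of 0 lies from `p` on, so `upward` forces
      -- `m = r l` below `suc j`; for positive `p`, `escape` keeps `m` from lying below `p`. Then
      -- `leave` sends `m` to `t` beyond `j`, against `t < m`.
      m≰j : p ≤ toℕ m → ¬ toℕ m < suc j
      m≰j p≤m m≤j = <⇒≱ t<m (≤-trans (s≤s⁻¹ m≤j)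
        (<⇒≤ (subst (λ z → suc j ≤ toℕ z) r-m (leave p≤m m≤j))))
      m≤j : ∀ {u} → p ≤ toℕ u → toℕ (r u) < suc j → toℕ m < suc j
      m≤j {u} p≤u ru≤j with ℕ.m≤n⇒m<n∨m≡n (≤l u)
      ... | inj₁ u<l = subst (λ z → toℕ z < suc j) r-l (upward p≤u u<l ru≤j)
      ... | inj₂ u≡l = subst (λ z → toℕ z < suc j)
                         (trans (cong r (Fin.toℕ-injective u≡l)) r-l) ru≤j
    impossible : ∀ p → Valid r p (suc j) → ⊥
    impossible zero v = m≰j v z≤n
      (m≤j v {g zero} z≤n (subst (λ z → toℕ z < suc j) (sym (g³ zero)) z<s))
    impossible (suc p) v = m≰j v (≮⇒≥ m≮p) m≤j′
      where
      open Valid v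
      m≤j′ : toℕ m < suc j
      m≤j′ = m≤j v {r (r zero)} (≤-trans (Valid.k≤q v) (leave (escape z<s) (enter z<s)))
        (subst (λ z → toℕ z < suc j) (sym (trans (cong (g ∘ g ∘ g) (g³ zero)) (g³ zero))) z<s)
      m≮p : ¬ toℕ m < suc p
      m≮p m<p = <⇒≱ (<-trans t<m m<p) (subst (λ z → suc p ≤ toℕ z) r-m (escape m<p))

  -- A block point must lie after `t` and not after `m`: `upward`, started at the preimage of 0,
  -- puts `t = g l` before it, and `leave` for `t` keeps `m = g t` from lying before it.
  valid-0-delete : Cubic g → Valid g 0 (suc p) → suc p ≤ 3 + N → Valid g′ 0 p × k ≤ p × p ≤ q
  valid-0-delete {p = p} g³ v p<N = v′ , k≤p , p≤q
    where
    open Valid v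
    p≤q : p ≤ q
    p≤q = s≤s⁻¹ (subst (suc p ≤_) toℕ-m (≮⇒≥ λ m≤p →
      <-irrefl refl (≤-<-trans (subst (λ z → suc p ≤ toℕ z) g-t (leave z≤n (<-trans t<m m≤p))) m≤p)))
    k≤p : k ≤ p
    k≤p = ≮⇒≥ λ p<k → <⇒≱ (subst (λ z → toℕ z < suc p) g-l (image-of-l p<k)) (subst (suc p ≤_) (sym toℕ-t) p<k)
      where
      image-of-l : p < k → toℕ (g l) < suc p
      image-of-l p<k with ℕ.m≤n⇒m<n∨m≡n (≤l (g (g zero)))
      ... | inj₁ u<l = upward z≤n u<l (subst (λ z → toℕ z < suc p) (sym (g³ zero)) z<s)
      ... | inj₂ u≡l = subst (λ z → toℕ z < suc p)
                         (trans (sym (g³ zero)) (cong g (Fin.toℕ-injective u≡l))) z<s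
    e< : ∀ {x} → toℕ x < p → toℕ (e x) < suc p
    e< {x} = Shift-<p k≤p p≤q (shift-view k q x)
    ≥e : ∀ {x} → suc p ≤ toℕ (e x) → p ≤ toℕ x
    ≥e le = ≮⇒≥ λ x<p → <⇒≱ (e< x<p) le
    <e : ∀ {x} → toℕ (e x) < suc p → toℕ x < p
    <e {x} lt = ℕ.≰⇒> λ p≤x → <⇒≱ lt (Shift-≥p k≤p p≤q (shift-view k q x) p≤x)
    v′ : Valid g′ 0 p
    v′ = record
      { k≤q = z≤n
      ; inc = λ x<y y<p → e-cancel (transport (g-e _) (g-e _) (inc (e-mono x<y) (e< y<p)))
      ; leave = λ _ x<p → ≥e (subst (λ z → suc p ≤ toℕ z) (g-e _) (leave z≤n (e< x<p)))
      ; enter = λ ()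
      ; escape = λ ()
      ; inc⁻¹ = λ _ ()
      ; upward = λ _ x<y gx<p → <e (subst (λ z → toℕ z < suc p) (g-e _)
          (upward z≤n (e-mono x<y) (subst (λ z → toℕ z < suc p) (sym (g-e _)) (e< gx<p))))
      }

  valid-0-insert : Valid g′ k q → Valid g′ 0 p → k ≤ p → p ≤ q → Valid g 0 (suc p)
  valid-0-insert {p = p} v w k≤p p≤q = record
    { k≤q = z≤n
    ; inc = λ {a} {b} → inc (slot a) (slot b)
    ; leave = λ {a} _ → leave (slot a)
    ; enter = λ ()
    ; escape = λ ()
    ; inc⁻¹ = λ _ ()
    ; upward = λ {a} {b} _ → upward (slot a) (slot b)
    }
    where
    module V = Valid v
    module W = Valid w
    e< : ∀ {x} → toℕ x < p → toℕ (e x) < suc p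
    e< {x} = Shift-<p k≤p p≤q (shift-view k q x)
    e≥ : ∀ {x} → p ≤ toℕ x → suc p ≤ toℕ (e x)
    e≥ {x} = Shift-≥p k≤p p≤q (shift-view k q x)
    <e : ∀ {x} → toℕ (e x) < suc p → toℕ x < p
    <e {x} lt = ℕ.≰⇒> λ p≤x → <⇒≱ lt (e≥ p≤x)
    m≰p : suc p ≤ toℕ m
    m≰p = subst (suc p ≤_) (sym toℕ-m) (s≤s p≤q)
    l≰p : suc p ≤ toℕ l
    l≰p = ≤-trans m≰p (<⇒≤ m<l)
    t≤p : toℕ t < suc p
    t≤p = subst (_< suc p) (sym toℕ-t) (s≤s k≤p)
    inc : ∀ {a b} → Slot a → Slot b → a Fin.< b → toℕ b < suc p → g a Fin.< g b
    inc isL _ a<b b≤p = contradiction (≤l _) (<⇒≱ a<b)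
    inc isM _ a<b b≤p = contradiction (≤-trans m≰p (<⇒≤ a<b)) (<⇒≱ b≤p)
    inc isT isT a<b _ = contradiction a<b (<-irrefl refl)
    inc isT (old y) a<b b≤p = transport⁻¹ g-t (g-e y) (m<e (V.leave (t<e⁻¹ a<b) (<-≤-trans (<e b≤p) p≤q)))
    inc (old x) isT a<b _ = transport⁻¹ (g-e x) g-t (e<m (V.enter (e<t⁻¹ a<b)))
    inc (old x) (old y) a<b b≤p = transport⁻¹ (g-e x) (g-e y) (e-mono (W.inc (e-cancel a<b) (<e b≤p)))
    inc _ isL _ b≤p = contradiction l≰p (<⇒≱ b≤p)
    inc _ isM _ b≤p = contradiction m≰p (<⇒≱ b≤p)
    leave : ∀ {a} → Slot a → toℕ a < suc p → suc p ≤ toℕ (g a)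
    leave isL a≤p = contradiction l≰p (<⇒≱ a≤p)
    leave isM a≤p = contradiction m≰p (<⇒≱ a≤p)
    leave isT _ = subst (λ z → suc p ≤ toℕ z) (sym g-t) m≰p
    leave (old x) a≤p = subst (λ z → suc p ≤ toℕ z) (sym (g-e x)) (e≥ (W.leave z≤n (<e a≤p)))
    upward : ∀ {a b} → Slot a → Slot b → a Fin.< b → toℕ (g a) < suc p → toℕ (g b) < suc p
    upward isL _ a<b _ = contradiction (≤l _) (<⇒≱ a<b)
    upward isM _ _ ga≤p = contradiction (subst (λ z → suc p ≤ toℕ z) (sym g-m) l≰p) (<⇒≱ ga≤p)
    upward isT _ _ ga≤p = contradiction (subst (λ z → suc p ≤ toℕ z) (sym g-t) m≰p) (<⇒≱ ga≤p)
    upward (old x) isL _ _ = subst (λ z → toℕ z < suc p) (sym g-l) t≤p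
    upward (old x) (old y) a<b ga≤p = subst (λ z → toℕ z < suc p) (sym (g-e y))
      (e< (W.upward z≤n (e-cancel a<b) (<e (subst (λ z → toℕ z < suc p) (g-e x) ga≤p))))
    upward (old x) isT a<b ga≤p = contradiction (W.leave z≤n (<-≤-trans (e<t⁻¹ a<b) k≤p))
      (<⇒≱ (<e (subst (λ z → toℕ z < suc p) (g-e x) ga≤p)))
    upward (old x) isM a<b ga≤p = contradiction gx<p (≤⇒≯ (p≤gx (toℕ x <? k)))
      where
      gx<p : toℕ (g′ x) < p
      gx<p = <e (subst (λ z → toℕ z < suc p) (g-e x) ga≤p)
      p≤gx : _ → p ≤ toℕ (g′ x)
      p≤gx (yes x<k) = W.leave z≤n (<-≤-trans x<k k≤p)
      p≤gx (no x≮k)  = ≤-trans p≤q (V.leave (≮⇒≥ x≮k) (e<m⁻¹ a<b))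

  -- If `k < j`, then `t` and its successor `b` are both below `suc j`, so `inc⁻¹` would place the
  -- preimage of `b` after that of `t`, which is the last element `l`.
  valid-suc-delete : Cubic g → Valid g (suc j) p → p ≤ 3 + N → j ≤ k
  valid-suc-delete {j = j} {p} g³ v p≤N = ≮⇒≥ contra
    where
    open Valid v using (inc⁻¹) renaming (k≤q to j<p)
    contra : k < j → ⊥
    contra k<j = ℕ.<-asym t<b (subst₂ Fin._<_ b-image g-l (inc⁻¹ y<l
        (subst (λ z → toℕ z < suc j) (sym b-image) b≤j) (subst (λ z → toℕ z < suc j) (sym g-l) t≤j)))
      where
      b<3+N : suc k < 3 + N
      b<3+N = ≤-trans (s<s k<j) (≤-trans j<p p≤N)
      b : Fin (3 + N)
      b = fromℕ< b<3+N
      toℕ-b : toℕ b ≡ suc k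
      toℕ-b = Fin.toℕ-fromℕ< b<3+N
      t<b : t Fin.< b
      t<b = subst₂ _<_ (sym toℕ-t) (sym toℕ-b) (n<1+n k)
      b≤j : toℕ b < suc j
      b≤j = subst (_< suc j) (sym toℕ-b) (s<s k<j)
      t≤j : toℕ t < suc j
      t≤j = subst (_< suc j) (sym toℕ-t) (m<n⇒m<1+n k<j)
      y : Fin (3 + N)
      y = g (g b)
      b-image : g y ≡ b
      b-image = g³ b
      y<l : y Fin.< l
      y<l with ℕ.m≤n⇒m<n∨m≡n (≤l y)
      ... | inj₁ y<l = y<l
      ... | inj₂ y≡l = contradiction t<b (<-irrefl (cong toℕ
              (trans (sym g-l) (trans (cong g (sym (Fin.toℕ-injective y≡l))) b-image))))

  -- The next cycle can always follow the last one closely, its `t` and `m` coming right after the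
  -- present `t` and `m`.
  valid-suc-insert : Valid g′ k q → Valid g (suc k) (2 + q)
  valid-suc-insert v = record
    { k≤q = s≤s (m≤n⇒m≤1+n k≤q)
    ; inc = λ {a} {b} → inc (slot a) (slot b)
    ; leave = λ {a} → leave (slot a)
    ; enter = λ {a} → enter (slot a)
    ; escape = λ {a} → escape (slot a)
    ; inc⁻¹ = λ {a} {b} → inc⁻¹ (slot a) (slot b)
    ; upward = λ {a} {b} → upward (slot a) (slot b)
    }
    where
    module V = Valid v
    l≥ : 2 + q ≤ toℕ l
    l≥ = subst (2 + q ≤_) (sym (toℕ-lastOf N)) (s≤s (s≤s q≤N))
    m<2+q : toℕ m < 2 + q
    m<2+q = subst (_< 2 + q) (sym toℕ-m) (n<1+n _)
    m≥ : suc k ≤ toℕ m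
    m≥ = subst (suc k ≤_) (sym toℕ-m) (s≤s k≤q)
    t<1+k : toℕ t < suc k
    t<1+k = subst (_< suc k) (sym toℕ-t) (n<1+n _)
    e<2+q : ∀ {x} → toℕ x < q → toℕ (e x) < 2 + q
    e<2+q x<q = <-trans (e<m x<q) m<2+q
    e≥2+q : ∀ {x} → q ≤ toℕ x → 2 + q ≤ toℕ (e x)
    e≥2+q {x} q≤x = Shift-≥q k≤q (shift-view k q x) q≤x
    <q : ∀ {x} → toℕ (e x) < 2 + q → toℕ x < q
    <q lt = ℕ.≰⇒> λ q≤x → <⇒≱ lt (e≥2+q q≤x)
    e<1+k : ∀ {x} → toℕ x < k → toℕ (e x) < suc k
    e<1+k x<k = <-trans (e<t x<k) t<1+k
    e≥1+k : ∀ {x} → k ≤ toℕ x → suc k ≤ toℕ (e x)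
    e≥1+k {x} = Shift-≥k (shift-view k q x)
    <k : ∀ {x} → toℕ (e x) < suc k → toℕ x < k
    <k lt = ℕ.≰⇒> λ k≤x → <⇒≱ lt (e≥1+k k≤x)
    k≤ : ∀ {x} → suc k ≤ toℕ (e x) → k ≤ toℕ x
    k≤ le = ≮⇒≥ λ x<k → <⇒≱ (e<1+k x<k) le

    inc : ∀ {a b} → Slot a → Slot b → a Fin.< b → toℕ b < 2 + q → g a Fin.< g b
    inc isL _ a<b _ = contradiction (≤l _) (<⇒≱ a<b)
    inc _ isL _ b< = contradiction l≥ (<⇒≱ b<)
    inc isM isT a<b _ = contradiction a<b (ℕ.<-asym t<m)
    inc isM isM a<b _ = contradiction a<b (<-irrefl refl)
    inc isM (old y) a<b b< = contradiction (m<e⁻¹ a<b) (<⇒≱ (<q b<))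
    inc isT isT a<b _ = contradiction a<b (<-irrefl refl)
    inc isT isM _ _ = transport⁻¹ g-t g-m m<l
    inc isT (old y) a<b b< = transport⁻¹ g-t (g-e y) (m<e (V.leave (t<e⁻¹ a<b) (<q b<)))
    inc (old x) isT a<b _ = transport⁻¹ (g-e x) g-t (e<m (V.enter (e<t⁻¹ a<b)))
    inc (old x) isM _ _ = transport⁻¹ (g-e x) g-m e<l
    inc (old x) (old y) a<b b< = transport⁻¹ (g-e x) (g-e y) (e-mono (V.inc (e-cancel a<b) (<q b<)))
    leave : ∀ {a} → Slot a → suc k ≤ toℕ a → toℕ a < 2 + q → 2 + q ≤ toℕ (g a)
    leave isL _ a< = contradiction l≥ (<⇒≱ a<)
    leave isT a≥ _ = contradiction a≥ (<⇒≱ t<1+k)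
    leave isM _ _ = subst (λ z → 2 + q ≤ toℕ z) (sym g-m) l≥
    leave (old x) a≥ a< = subst (λ z → 2 + q ≤ toℕ z) (sym (g-e x)) (e≥2+q (V.leave (k≤ a≥) (<q a<)))
    enter : ∀ {a} → Slot a → toℕ a < suc k → toℕ (g a) < 2 + q
    enter isL a< = contradiction (<-≤-trans (<-≤-trans a< m≥) (<⇒≤ m<l)) (<-irrefl refl)
    enter isM a< = contradiction m≥ (<⇒≱ a<)
    enter isT _ = subst (λ z → toℕ z < 2 + q) (sym g-t) m<2+q
    enter (old x) a< = subst (λ z → toℕ z < 2 + q) (sym (g-e x)) (e<2+q (V.enter (<k a<)))
    escape : ∀ {a} → Slot a → toℕ a < suc k → suc k ≤ toℕ (g a)
    escape isL a< = contradiction (<-≤-trans (<-≤-trans a< m≥) (<⇒≤ m<l)) (<-irrefl refl)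
    escape isM a< = contradiction m≥ (<⇒≱ a<)
    escape isT _ = subst (λ z → suc k ≤ toℕ z) (sym g-t) m≥
    escape (old x) a< = subst (λ z → suc k ≤ toℕ z) (sym (g-e x)) (e≥1+k (V.escape (<k a<)))
    inc⁻¹ : ∀ {a b} → Slot a → Slot b → a Fin.< b → toℕ (g a) < suc k → toℕ (g b) < suc k → g a Fin.< g b
    inc⁻¹ isL _ a<b _ _ = contradiction (≤l _) (<⇒≱ a<b)
    inc⁻¹ isM _ _ ga< _ = contradiction (≤-trans m≥ (<⇒≤ m<l)) (<⇒≱ (subst (λ z → toℕ z < suc k) g-m ga<))
    inc⁻¹ isT _ _ ga< _ = contradiction m≥ (<⇒≱ (subst (λ z → toℕ z < suc k) g-t ga<))
    inc⁻¹ _ isM _ _ gb< = contradiction (≤-trans m≥ (<⇒≤ m<l)) (<⇒≱ (subst (λ z → toℕ z < suc k) g-m gb<))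
    inc⁻¹ _ isT _ _ gb< = contradiction m≥ (<⇒≱ (subst (λ z → toℕ z < suc k) g-t gb<))
    inc⁻¹ (old x) isL _ ga< _ = transport⁻¹ (g-e x) g-l (e<t (<k (subst (λ z → toℕ z < suc k) (g-e x) ga<)))
    inc⁻¹ (old x) (old y) a<b ga< gb< = transport⁻¹ (g-e x) (g-e y) (e-mono (V.inc⁻¹ (e-cancel a<b)
      (<k (subst (λ z → toℕ z < suc k) (g-e x) ga<)) (<k (subst (λ z → toℕ z < suc k) (g-e y) gb<))))
    upward : ∀ {a b} → Slot a → Slot b → suc k ≤ toℕ a → a Fin.< b → toℕ (g a) < 2 + q → toℕ (g b) < 2 + q
    upward isL _ _ a<b _ = contradiction (≤l _) (<⇒≱ a<b)
    upward isM _ _ _ ga< = contradiction (subst (λ z → 2 + q ≤ toℕ z) (sym g-m) l≥) (<⇒≱ ga<)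
    upward isT _ a≥ _ _ = contradiction a≥ (<⇒≱ t<1+k)
    upward (old x) isL _ _ _ = subst (λ z → toℕ z < 2 + q) (sym g-l) (ℕ.<-trans {toℕ t} {toℕ m} t<m m<2+q)
    upward (old x) isT _ _ _ = subst (λ z → toℕ z < 2 + q) (sym g-t) m<2+q
    upward (old x) isM a≥ a<b ga< = contradiction (V.leave (k≤ a≥) (e<m⁻¹ a<b))
      (<⇒≱ (<q (subst (λ z → toℕ z < 2 + q) (g-e x) ga<)))
    upward (old x) (old y) a≥ a<b ga< = subst (λ z → toℕ z < 2 + q) (sym (g-e y))
      (e<2+q (V.upward (k≤ a≥) (e-cancel a<b) (<q (subst (λ z → toℕ z < 2 + q) (g-e x) ga<))))

-- With old elements before t, every other insertion point for a new block lies
-- between t and m.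
valid-0-range : Cubic f → Valid f (suc k) q → q ≤ n → Valid {n} f 0 (suc p) → suc p ≤ n →
  suc k ≤ suc p × suc p ≤ q
valid-0-range {n = suc n} {f = f} {k} {q} {p} f³ v q≤n w p≤n = k≤p , p<q
  where
  module V = Valid v
  module W = Valid w
  p<q : suc p ≤ q
  p<q = <⇒≤ (≤-<-trans (W.leave {zero} z≤n z<s) (V.enter {zero} z<s))
  k≤p : suc k ≤ suc p
  k≤p = ≮⇒≥ contra
    where
    contra : ¬ suc p < suc k
    -- `x` and `y` are the preimages of `suc p` and of 0. By `inc⁻¹` for the extension, `y` comes
    -- before `x`; then `upward` for the block point puts `suc p` below itself.
    contra p<k = go (ℕ.<-cmp (toℕ x) (toℕ y))
      where
      b<1+n : suc p < suc n
      b<1+n = <-≤-trans p<k (≤-trans V.k≤q q≤n)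
      b x y : Fin (suc n)
      b = fromℕ< b<1+n
      x = f (f b)
      y = f (f zero)
      toℕ-b : toℕ b ≡ suc p
      toℕ-b = Fin.toℕ-fromℕ< b<1+n
      fx : toℕ (f x) ≡ suc p
      fx = trans (cong toℕ (f³ b)) toℕ-b
      fy : toℕ (f y) ≡ 0
      fy = cong toℕ (f³ zero)
      go : _ → ⊥
      go (tri< x<y _ _) = contradiction (subst₂ _<_ fx fy
        (V.inc⁻¹ x<y (subst (_< suc k) (sym fx) p<k) (subst (_< suc k) (sym fy) z<s))) λ ()
      go (tri≈ _ x≡y _) = contradiction
        (trans (sym fx) (trans (cong (toℕ ∘ f) (Fin.toℕ-injective x≡y)) fy)) λ ()
      go (tri> _ _ y<x) = contradiction (subst (_< suc p) fx
        (W.upward z≤n y<x (subst (_< suc p) (sym fy) z<s))) (<-irrefl refl)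

-- Words

cubic-square : Cubic f → Cubic (f ∘ f)
cubic-square {f = f} f³ x = trans (cong (f ∘ f ∘ f) (f³ x)) (f³ x)

avoiding-square : Cubic f → Avoiding f → Avoiding (f ∘ f)
avoiding-square {f = f} f³ av {x} {y} {z} x<y y<z p q =
  av p q (subst₂ Fin._<_ (sym (f³ x)) (sym (f³ y)) x<y) (subst₂ Fin._<_ (sym (f³ y)) (sym (f³ z)) y<z)

avoiding-cong : f ≗ g → Avoiding f → Avoiding g
avoiding-cong eq av {x} {y} {z} x<y y<z p q = av x<y y<z
  (subst₂ Fin._<_ (sym (eq y)) (sym (eq x)) p) (subst₂ Fin._<_ (sym (eq x)) (sym (eq z)) q)

orient : Bool → Endo n → Endo n
orient true  f = f
orient false f = f ∘ f

orient-cong : ∀ o → f ≗ g → orient o f ≗ orient o g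
orient-cong true  eq = eq
orient-cong {f = f} {g} false eq x = trans (eq (f x)) (cong g (eq x))

orient-cubic : ∀ o → Cubic f → Cubic (orient o f)
orient-cubic true  f³ = f³
orient-cubic {f = f} false f³ = cubic-square {f = f} f³

orient-avoiding : ∀ o → Cubic f → Avoiding f → Avoiding (orient o f)
orient-avoiding true  f³ av = av
orient-avoiding {f = f} false f³ av = avoiding-square {f = f} f³ av

orient-involutive : ∀ o → Cubic f → orient o (orient o f) ≗ f
orient-involutive true  f³ x = refl
orient-involutive {f = f} false f³ x = f³ (f x)

orient-not : ∀ o → Cubic f → orient o f ∘ orient o f ≗ orient (not o) f
orient-not true  f³ x = refl
orient-not {f = f} false f³ x = f³ (f x)

-- The insertions that g admits: with k = 0 they are the s + 1 values α 0 < … < α s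
-- of q, and otherwise k ranges over 1 , … , t.
record Spec {N} (g : Endo N) (s t : ℕ) (α : ℕ → ℕ) : Set where
  field
    α-zero         : α 0 ≡ 0
    α-mono         : ∀ {c d} → c < d → d ≤ s → α c < α d
    α-bounded      : ∀ {c} → c ≤ s → α c ≤ N
    block-sound    : ∀ {c} → c ≤ s → Valid g 0 (α c)
    block-complete : ∀ {q} → q ≤ N → Valid g 0 q → ∃[ c ] c ≤ s × q ≡ α c
    extend-sound   : ∀ {j} → j < t → ∃[ q ] q ≤ N × Valid g (suc j) q
    extend-complete : ∀ {j q} → q ≤ N → Valid g (suc j) q → j < t

  α-cancel-≤ : ∀ {c d} → c ≤ s → α c ≤ α d → c ≤ d
  α-cancel-≤ c≤s αc≤αd = ≮⇒≥ λ d<c → <⇒≱ (α-mono d<c c≤s) αc≤αd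

  α-injective : ∀ {c d} → c ≤ s → d ≤ s → α c ≡ α d → c ≡ d
  α-injective c≤s d≤s eq = ℕ.≤-antisym (α-cancel-≤ c≤s (ℕ.≤-reflexive eq)) (α-cancel-≤ d≤s (ℕ.≤-reflexive (sym eq)))

Rigid : Endo n → Set
Rigid {n} g = ∀ {k q} → q ≤ n → Valid g k q → k ≡ 0 × q ≡ 0

rigid-cong : f ≗ g → Rigid f → Rigid g
rigid-cong eq rigid q≤n v = rigid q≤n (valid-cong (λ x → sym (eq x)) v)

rigid⇒spec : Rigid g → Spec g 0 0 id
rigid⇒spec rigid = record
  { α-zero = refl
  ; α-mono = λ c<d d≤0 → c<d
  ; α-bounded = λ { z≤n → z≤n }
  ; block-sound = λ { z≤n → valid-00 }
  ; block-complete = λ q≤N v → 0 , z≤n , proj₂ (rigid q≤N v)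
  ; extend-sound = λ ()
  ; extend-complete = λ q≤N v → contradiction (proj₁ (rigid q≤N v)) λ ()
  }

α-block : (ℕ → ℕ) → ℕ → ℕ
α-block α zero    = 0
α-block α (suc c) = suc (α c)

-- The nonzero block points survive and move past the new `t`. The old point 0 would now have to lie
-- after `t` and is lost, but `q = 0` is always valid, so the index 0 stays in use.
α-extend : (ℕ → ℕ) → ℕ → ℕ
α-extend α zero    = 0
α-extend α (suc c) = suc (α (suc c))

module _ {N} {g : Endo (3 + N)} {g′ : Endo N} (g³ : Cubic g) where

  -- Since `t` is now the first element, the nonzero block points are exactly the old ones up to the
  -- chosen `c₀`, moved by one place (`valid-0-delete`, `valid-0-insert`). As `k = 0`, a single
  -- extension is left.
  spec-block : ∀ {s t α c₀} → c₀ ≤ s → Spec g′ s t α → Insertion 0 (α c₀) g g′ →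
    Spec g (suc c₀) 1 (α-block α)
  spec-block {s} {t} {α} {c₀} c₀≤s S ins = record
    { α-zero = refl
    ; α-mono = mono
    ; α-bounded = bounded
    ; block-sound = sound
    ; block-complete = complete
    ; extend-sound = λ { z<s → _ , bound₂ , valid-suc-insert ins (block-sound c₀≤s) }
    ; extend-complete = λ q≤N v → s≤s (valid-suc-delete ins g³ v q≤N)
    }
    where
    open Spec S
    bound₂ : 2 + α c₀ ≤ 3 + N
    bound₂ = s≤s (s≤s (m≤n⇒m≤1+n (α-bounded c₀≤s)))
    mono : ∀ {c d} → c < d → d ≤ suc c₀ → α-block α c < α-block α d
    mono {zero}  {suc d} _ _ = z<s
    mono {suc c} {suc d} (s<s c<d) (s≤s d≤c₀) = s<s (α-mono c<d (≤-trans d≤c₀ c₀≤s))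
    bounded : ∀ {c} → c ≤ suc c₀ → α-block α c ≤ 3 + N
    bounded {zero} _ = z≤n
    bounded {suc c} (s≤s c≤c₀) = s≤s (m≤n⇒m≤1+n (m≤n⇒m≤1+n (α-bounded (≤-trans c≤c₀ c₀≤s))))
    sound : ∀ {c} → c ≤ suc c₀ → Valid g 0 (α-block α c)
    sound {zero} _ = valid-00
    sound {suc c} (s≤s c≤c₀) = valid-0-insert ins (block-sound c₀≤s) (block-sound (≤-trans c≤c₀ c₀≤s)) z≤n
      (αc≤αc₀ (ℕ.m≤n⇒m<n∨m≡n c≤c₀))
      where
      αc≤αc₀ : _ → α c ≤ α c₀
      αc≤αc₀ (inj₁ c<c₀) = <⇒≤ (α-mono c<c₀ c₀≤s)
      αc≤αc₀ (inj₂ refl) = ≤-refl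
    complete : ∀ {q} → q ≤ 3 + N → Valid g 0 q → ∃[ c ] c ≤ suc c₀ × q ≡ α-block α c
    complete {zero} _ _ = 0 , z≤n , refl
    complete {suc q} q<N v with valid-0-delete ins g³ v q<N
    ... | v′ , _ , q≤αc₀ with block-complete (≤-trans q≤αc₀ (α-bounded c₀≤s)) v′
    ... | c , c≤s , refl = suc c , s≤s (α-cancel-≤ c≤s q≤αc₀) , refl

  -- By `valid-0-range` all nonzero block points lie between `t` and `m`, so `s` is preserved. The
  -- largest extension is the one of `valid-suc-insert`, those below come from `valid-downward`, and
  -- `valid-suc-delete` excludes any above.
  spec-extend : ∀ {s t α j q} → Spec g′ s t α → Valid g′ (suc j) q → Insertion (suc j) q g g′ →
    Spec g s (2 + j) (α-extend α)
  spec-extend {s} {t} {α} {j} {q₀} S v₀ ins = record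
    { α-zero = refl
    ; α-mono = mono
    ; α-bounded = bounded
    ; block-sound = sound
    ; block-complete = complete
    ; extend-sound = ext-sound
    ; extend-complete = λ q≤N v → s≤s (valid-suc-delete ins g³ v q≤N)
    }
    where
    open Spec S
    open Insertion ins using (q≤N)
    g′³ : Cubic g′
    g′³ = deletion-cubic ins g³
    mono : ∀ {c d} → c < d → d ≤ s → α-extend α c < α-extend α d
    mono {zero}  {suc d} _ _ = z<s
    mono {suc c} {suc d} c<d d≤s = s<s (α-mono c<d d≤s)
    bounded : ∀ {c} → c ≤ s → α-extend α c ≤ 3 + N
    bounded {zero} _ = z≤n
    bounded {suc c} c≤s = s≤s (m≤n⇒m≤1+n (m≤n⇒m≤1+n (α-bounded c≤s)))
    sound : ∀ {c} → c ≤ s → Valid g 0 (α-extend α c)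
    sound {zero} _ = valid-00
    sound {suc c} c≤s with α (suc c) in eq | block-sound c≤s | α-bounded c≤s | α-mono {0} {suc c} z<s c≤s
    ... | suc a | v | a≤N | _ with valid-0-range g′³ v₀ q≤N v a≤N
    ... | j≤a , a≤q = valid-0-insert ins v₀ v j≤a a≤q
    sound {suc c} c≤s | zero | _ | _ | ()
    complete : ∀ {q} → q ≤ 3 + N → Valid g 0 q → ∃[ c ] c ≤ s × q ≡ α-extend α c
    complete {zero} _ _ = 0 , z≤n , refl
    complete {suc q} q<N v with valid-0-delete ins g³ v q<N
    ... | v′ , j<q , q≤q₀ with block-complete (≤-trans q≤q₀ q≤N) v′
    ... | suc c , c≤s , refl = suc c , c≤s , refl
    ... | zero , _ , eq = contradiction (subst (suc j ≤_) (trans eq α-zero) j<q) λ ()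
    ext-sound : ∀ {i} → i < 2 + j → ∃[ q ] q ≤ 3 + N × Valid g (suc i) q
    ext-sound {i} (s<s i≤1+j) with ℕ.m≤n⇒m<n∨m≡n i≤1+j
    ... | inj₂ refl = 2 + q₀ , s≤s (s≤s (m≤n⇒m≤1+n q≤N)) , valid-suc-insert ins v₀
    ... | inj₁ i<1+j = _ , Fin.toℕ<n (g v) , subst (λ z → Valid g (suc z) (suc (toℕ (g v)))) toℕ-v
          (valid-downward g³ (valid-suc-insert ins v₀) v (subst (_< 2 + j) (sym toℕ-v) (m<n⇒m<1+n i<1+j)))
      where
      i<3+N : i < 3 + N
      i<3+N = ≤-trans i<1+j (≤-trans (Valid.k≤q v₀) (≤-trans q≤N (m≤n⇒m≤1+n (m≤n⇒m≤1+n (m≤n⇒m≤1+n ≤-refl)))))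
      v : Fin (3 + N)
      v = fromℕ< i<3+N
      toℕ-v : toℕ v ≡ i
      toℕ-v = Fin.toℕ-fromℕ< i<3+N

-- A word, read from its last letter, builds a permutation from the empty one.
-- The letter fixed adds a fixed point.  The others add a 3-cycle: turn reverses
-- the orientation of the previous 3-cycle and allows only k = q = 0, block c
-- takes k = 0 and the c-th possible q, and extend j takes k = suc j, which
-- determines q.
data Letter : Set where
  fixed turn   : Letter
  block extend : ℕ → Letter

Word : Set
Word = List Letter

-- The coordinates `s` and `t` of the node that a word reaches.
blocks extensions : Word → ℕ
blocks []             = 0
blocks (fixed    ∷ _) = 0
blocks (turn     ∷ _) = 1
blocks (block c  ∷ _) = suc c
blocks (extend _ ∷ w) = blocks w

extensions []             = 0
extensions (fixed    ∷ _) = 0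
extensions (turn     ∷ _) = 1
extensions (block _  ∷ _) = 1
extensions (extend j ∷ _) = 2 + j

α : Word → ℕ → ℕ
α []             = id
α (fixed    ∷ _) = id
α (turn     ∷ _) = α-block id
α (block _  ∷ w) = α-block (α w)
α (extend _ ∷ w) = α-extend (α w)

-- Encoding permutations by words

record FixedInsertion {N} (f : Endo (suc N)) (f′ : Endo N) : Set where
  field
    at-zero : f zero ≡ zero
    at-suc  : ∀ x → f (suc x) ≡ suc (f′ x)

-- The last inserted 3-cycle reads l ↦ t ↦ m ↦ l in orient o f, not necessarily
-- in f itself.
data Enc : ∀ {n} → Word → Bool → Endo n → Set where
  empty  : {f : Endo 0} → Enc [] true f
  fixed  : ∀ {N w o} {f : Endo (suc N)} {f′} →
    Enc w o f′ → FixedInsertion f f′ → Enc (fixed ∷ w) o f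
  turn   : ∀ {N w o} {f : Endo (3 + N)} {f′} → Cubic f → Enc w o f′ →
    Insertion 0 0 (orient (not o) f) (orient (not o) f′) → Enc (turn ∷ w) (not o) f
  block  : ∀ {N w o c} {f : Endo (3 + N)} {f′} → Cubic f → Enc w o f′ → c ≤ blocks w →
    Insertion 0 (α w c) (orient o f) (orient o f′) → Enc (block c ∷ w) o f
  extend : ∀ {N w o j q} {f : Endo (3 + N)} {f′} → Cubic f → Enc w o f′ → j < extensions w →
    Valid (orient o f′) (suc j) q →
    Insertion (suc j) q (orient o f) (orient o f′) → Enc (extend j ∷ w) o f

-- `spec` describes the insertions that keep the orientation of the last cycle; `rigid` says that
-- against this orientation only `k = q = 0`, the letter `turn`, is possible.
record Invariant {n} (w : Word) (o : Bool) (f : Endo n) : Set where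
  field
    cubic    : Cubic f
    avoiding : Avoiding f
    spec     : Spec (orient o f) (blocks w) (extensions w) (α w)
    rigid    : Rigid (orient (not o) f)

fixed-rigid : ∀ {f : Endo (suc n)} → f zero ≡ zero → Rigid f
fixed-rigid f0≡0 _ = valid-fixed⇒00 f0≡0

empty-rigid : ∀ {f : Endo 0} → Rigid f
empty-rigid z≤n v = ℕ.n≤0⇒n≡0 (Valid.k≤q v) , refl

orient-fixed : ∀ o {f : Endo (suc n)} → f zero ≡ zero → orient o f zero ≡ zero
orient-fixed true  eq = eq
orient-fixed false {f} eq = trans (cong f eq) eq

insertion-invariant : ∀ {N} o {f : Endo (3 + N)} {f′} → Cubic f → Cubic f′ → Avoiding f′ →
  Valid (orient o f′) k q → Insertion k q (orient o f) (orient o f′) →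
  Avoiding f × Rigid (orient (not o) f)
insertion-invariant o f³ f′³ av v ins =
  avoiding-cong (orient-involutive o f³) (orient-avoiding o (orient-cubic o f³)
    (avoiding-insert ins v (orient-avoiding o f′³ av))) ,
  rigid-cong (orient-not o f³) λ _ → valid-reversed⇒00 ins (orient-cubic o f³)

fixed-cubic : ∀ {N} {f : Endo (suc N)} {f′} → FixedInsertion f f′ → Cubic f′ → Cubic f
fixed-cubic {f = f} fix f′³ zero = trans (cong (f ∘ f) at-zero) (trans (cong f at-zero) at-zero)
  where open FixedInsertion fix
fixed-cubic {f = f} {f′} fix f′³ (suc x) = trans (cong (f ∘ f) (at-suc x))
  (trans (cong f (at-suc (f′ x))) (trans (at-suc _) (cong suc (f′³ x))))
  where open FixedInsertion fix

fixed-avoiding : ∀ {N} {f : Endo (suc N)} {f′} → FixedInsertion f f′ → Avoiding f′ → Avoiding f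
fixed-avoiding {f = f} {f′} fix av {zero} {y} _ _ fy<f0 _ =
  contradiction (subst (λ z → toℕ (f y) < toℕ z) at-zero fy<f0) λ ()
  where open FixedInsertion fix
fixed-avoiding fix av {suc x} {suc y} {suc z} (s<s x<y) (s<s y<z) p q = av x<y y<z
  (s≤s⁻¹ (subst₂ Fin._<_ (at-suc y) (at-suc x) p)) (s≤s⁻¹ (subst₂ Fin._<_ (at-suc x) (at-suc z) q))
  where open FixedInsertion fix

enc⇒invariant : ∀ {w o} {f : Endo n} → Enc w o f → Invariant w o f
enc⇒invariant empty = record
  { cubic = λ () ; avoiding = λ { {()} } ; spec = rigid⇒spec empty-rigid ; rigid = empty-rigid }
enc⇒invariant {o = o} (fixed {f = f} enc fix) = record
  { cubic = fixed-cubic fix cubic ; avoiding = fixed-avoiding fix avoiding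
  ; spec = rigid⇒spec (fixed-rigid (orient-fixed o {f} (FixedInsertion.at-zero fix)))
  ; rigid = fixed-rigid (orient-fixed (not o) {f} (FixedInsertion.at-zero fix)) }
  where open Invariant (enc⇒invariant enc)
-- Seen in the opposite orientation, the old permutation is rigid and so has node `(0 , 0)`: there a
-- turn is the block with `c₀ = 0`, which leads to `(1 , 1)`.
enc⇒invariant (turn {o = o} f³ enc ins) =
  let av , R = insertion-invariant (not o) f³ cubic avoiding valid-00 ins in record
    { cubic = f³ ; avoiding = av ; rigid = R
    ; spec = spec-block (orient-cubic (not o) f³) z≤n (rigid⇒spec rigid) ins }
  where open Invariant (enc⇒invariant enc)
enc⇒invariant (block {o = o} f³ enc c≤s ins) =
  let av , R = insertion-invariant o f³ cubic avoiding (Spec.block-sound spec c≤s) ins in record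
    { cubic = f³ ; avoiding = av ; rigid = R
    ; spec = spec-block (orient-cubic o f³) c≤s spec ins }
  where open Invariant (enc⇒invariant enc)
enc⇒invariant (extend {o = o} f³ enc j<t v ins) =
  let av , R = insertion-invariant o f³ cubic avoiding v ins in record
    { cubic = f³ ; avoiding = av ; rigid = R
    ; spec = spec-extend (orient-cubic o f³) spec v ins }
  where open Invariant (enc⇒invariant enc)

module _ {N k q} {g : Endo (3 + N)} (pos : Positions N k q) (g³ : Cubic g) where
  open Positions pos

  insertion-restrict : g l ≡ t → g t ≡ m → g m ≡ l → ∃[ g′ ] Insertion k q g g′
  insertion-restrict g-l g-t g-m = (λ x → proj₁ (image x)) , record
    { positions = pos ; g-l = g-l ; g-t = g-t ; g-m = g-m ; g-e = λ x → proj₂ (image x) }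
    where
    from-old : ∀ {b} → Slot b → b ≢ l → b ≢ t → b ≢ m → ∃[ y ] b ≡ e y
    from-old isL b≢l _ _ = contradiction refl b≢l
    from-old isT _ b≢t _ = contradiction refl b≢t
    from-old isM _ _ b≢m = contradiction refl b≢m
    from-old (old y) _ _ _ = y , refl
    preimage : ∀ {a b c} → g a ≡ b → g c ≡ b → c ≡ a
    preimage ga≡b gc≡b = cubic⇒injective g³ (trans gc≡b (sym ga≡b))
    image : ∀ x → ∃[ y ] g (e x) ≡ e y
    image x = from-old (slot (g (e x)))
      (λ gex≡l → e≢m (preimage g-m gex≡l))
      (λ gex≡t → Fin.<⇒≢ e<l (preimage g-l gex≡t))
      (λ gex≡m → e≢t (preimage g-t gex≡m))

module _ {N k q} (pos : Positions N k q) (g′ : Endo N) where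
  open Positions pos

  private
    value : ∀ {b} → Slot b → Fin (3 + N)
    value isL     = t
    value isT     = m
    value isM     = l
    value (old x) = e (g′ x)

    value-l : ∀ {b} (σ : Slot b) → b ≡ l → value σ ≡ t
    value-l isL     _  = refl
    value-l isT     eq = contradiction eq (Fin.<⇒≢ t<l)
    value-l isM     eq = contradiction eq (Fin.<⇒≢ m<l)
    value-l (old x) eq = contradiction eq (Fin.<⇒≢ e<l)

    value-t : ∀ {b} (σ : Slot b) → b ≡ t → value σ ≡ m
    value-t isL     eq = contradiction (sym eq) (Fin.<⇒≢ t<l)
    value-t isT     _  = refl
    value-t isM     eq = contradiction (sym eq) (Fin.<⇒≢ t<m)
    value-t (old x) eq = contradiction eq e≢t

    value-m : ∀ {b} (σ : Slot b) → b ≡ m → value σ ≡ l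
    value-m isL     eq = contradiction (sym eq) (Fin.<⇒≢ m<l)
    value-m isT     eq = contradiction eq (Fin.<⇒≢ t<m)
    value-m isM     _  = refl
    value-m (old x) eq = contradiction eq e≢m

    value-e : ∀ {b x} (σ : Slot b) → b ≡ e x → value σ ≡ e (g′ x)
    value-e isL     eq = contradiction (sym eq) (Fin.<⇒≢ e<l)
    value-e isT     eq = contradiction (sym eq) e≢t
    value-e isM     eq = contradiction (sym eq) e≢m
    value-e (old y) eq = cong (e ∘ g′) (e-injective eq)

  insert : ∃[ g ] Insertion k q g g′
  insert = (λ b → value (slot b)) , record
    { positions = pos
    ; g-l = value-l (slot l) refl
    ; g-t = value-t (slot t) refl
    ; g-m = value-m (slot m) refl
    ; g-e = λ x → value-e (slot (e x)) refl
    }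

insertion-cong : ∀ {N} {f g : Endo (3 + N)} {f′ g′ : Endo N} → f ≗ g → f′ ≗ g′ →
  Insertion k q f f′ → Insertion k q g g′
insertion-cong {k = k} {q} eq eq′ ins = record
  { positions = positions
  ; g-l = trans (sym (eq _)) g-l
  ; g-t = trans (sym (eq _)) g-t
  ; g-m = trans (sym (eq _)) g-m
  ; g-e = λ x → trans (sym (eq _)) (trans (g-e x) (cong (shift k q) (eq′ x)))
  } where open Insertion ins

module _ {N k q k′ q′} {g : Endo (3 + N)} {f f′ : Endo N}
  (ins : Insertion k q g f) (ins′ : Insertion k′ q′ g f′) where
  private
    module I = Insertion ins
    module J = Insertion ins′

    t≡ : I.t ≡ J.t
    t≡ = trans (sym I.g-l) J.g-l

    m≡ : I.m ≡ J.m
    m≡ = trans (sym I.g-t) (trans (cong g t≡) J.g-t)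

  insertion-determines-k : k ≡ k′
  insertion-determines-k = trans (sym I.toℕ-t) (trans (cong toℕ t≡) J.toℕ-t)

  insertion-determines-q : q ≡ q′
  insertion-determines-q = ℕ.suc-injective (trans (sym I.toℕ-m) (trans (cong toℕ m≡) J.toℕ-m))

  insertion-determines-rest : f ≗ f′
  insertion-determines-rest x = I.e-injective (trans (sym (I.g-e x)) (trans
    (cong g (cong₂ (λ k q → shift k q x) insertion-determines-k insertion-determines-q))
    (trans (J.g-e x) (sym (cong₂ (λ k q → shift k q (f′ x)) insertion-determines-k insertion-determines-q)))))

insertion-unique : ∀ {N} {f g : Endo (3 + N)} {h : Endo N} →
  Insertion k q f h → Insertion k q g h → f ≗ g
insertion-unique {f = f} {g} ins ins′ b = go (I.slot b)
  where
  module I = Insertion ins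
  module J = Insertion ins′
  t≡ : I.t ≡ J.t
  t≡ = Fin.toℕ-injective (trans I.toℕ-t (sym J.toℕ-t))
  m≡ : I.m ≡ J.m
  m≡ = Fin.toℕ-injective (trans I.toℕ-m (sym J.toℕ-m))
  go : ∀ {b} → I.Slot b → f b ≡ g b
  go I.isL     = trans I.g-l (trans t≡ (sym J.g-l))
  go I.isT     = trans I.g-t (trans m≡ (sym (trans (cong g t≡) J.g-t)))
  go I.isM     = trans I.g-m (sym (trans (cong g m≡) J.g-m))
  go (I.old x) = trans (I.g-e x) (sym (J.g-e x))

-- Squaring exchanges the roles of `t` and `m`, and `t < m` holds in one orientation only.
¬insertion-both : ∀ {N k′ q′} {g : Endo (3 + N)} {f f′ : Endo N} →
  Insertion k q g f → ¬ Insertion k′ q′ (g ∘ g) f′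
¬insertion-both {g = g} ins ins′ = ℕ.<-asym I.t<m (subst₂ Fin._<_ t′≡m m′≡t J.t<m)
  where
  module I = Insertion ins
  module J = Insertion ins′
  t′≡m : J.t ≡ I.m
  t′≡m = trans (sym J.g-l) (trans (cong g I.g-l) I.g-t)
  m′≡t : J.m ≡ I.t
  m′≡t = trans (sym J.g-t) (trans (cong (g ∘ g) t′≡m) (trans (cong g I.g-m) I.g-l))

insertion-orientation : ∀ {N k′ q′} o o′ {f : Endo (3 + N)} {h h′ : Endo N} → Cubic f →
  Insertion k q (orient o f) h → Insertion k′ q′ (orient o′ f) h′ → o ≡ o′
insertion-orientation true  true  _ _ _ = refl
insertion-orientation false false _ _ _ = refl
insertion-orientation true  false _ ins ins′ = contradiction ins′ (¬insertion-both ins)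
insertion-orientation false true  _ ins ins′ = contradiction ins (¬insertion-both ins′)

orient-injective : ∀ o → Cubic f → Cubic g → orient o f ≗ orient o g → f ≗ g
orient-injective o f³ g³ eq x =
  trans (sym (orient-involutive o f³ x)) (trans (orient-cong o eq x) (orient-involutive o g³ x))

insertion-injective : ∀ {N k′ q′} o o′ {f g : Endo (3 + N)} {f′ g′ : Endo N} → f ≗ g →
  Cubic f → Cubic f′ → Cubic g′ →
  Insertion k q (orient o f) (orient o f′) → Insertion k′ q′ (orient o′ g) (orient o′ g′) →
  o ≡ o′ × k ≡ k′ × q ≡ q′ × f′ ≗ g′
insertion-injective o o′ eq f³ f′³ g′³ ins ins′
  with insertion-cong (λ x → sym (orient-cong o′ eq x)) (λ _ → refl) ins′
... | ins″ with insertion-orientation o o′ f³ ins ins″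
... | refl = refl , insertion-determines-k ins ins″ , insertion-determines-q ins ins″ ,
             orient-injective o f′³ g′³ (insertion-determines-rest ins ins″)

-- For `k = 0` the first element is `t`, which goes to `m`; otherwise it is old, and `escape` moves
-- it. This tells the letters of 3-cycles from `fixed`.
insertion-moves-zero : ∀ {N} {g : Endo (3 + N)} {g′} → Valid g′ k q → Insertion k q g g′ → g zero ≢ zero
insertion-moves-zero {k = zero} {g = g} v ins g0≡0 =
  Fin.<⇒≢ t<m (trans t≡0 (trans (sym g0≡0) (trans (cong g (sym t≡0)) g-t)))
  where
  open Insertion ins
  t≡0 : t ≡ zero
  t≡0 = Fin.toℕ-injective toℕ-t
insertion-moves-zero {k = suc k} {q} {N} {g} {g′} v ins g0≡0 =
  contradiction (subst (suc k ≤_) (trans (cong toℕ z-fixed) toℕ-z) (escape z<1+k)) λ ()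
  where
  open Valid v using (escape)
  open Insertion ins
  0<N : 0 < N
  0<N = <-≤-trans z<s (≤-trans k≤q q≤N)
  z : Fin N
  z = fromℕ< 0<N
  toℕ-z : toℕ z ≡ 0
  toℕ-z = Fin.toℕ-fromℕ< 0<N
  z<1+k : toℕ z < suc k
  z<1+k = subst (_< suc k) (sym toℕ-z) z<s
  ez≡0 : e z ≡ zero
  ez≡0 = Fin.toℕ-injective (trans (Shift-functional (shift-view (suc k) q z) (low z<1+k)) toℕ-z)
  z-fixed : g′ z ≡ z
  z-fixed = e-injective (trans (sym (g-e z)) (trans (cong g ez≡0) (trans g0≡0 (sym ez≡0))))

insertion-unfixed : ∀ {N} o {f g : Endo (3 + N)} {f′ h} → f ≗ g → FixedInsertion f h →
  Valid f′ k q → ¬ Insertion k q (orient o g) f′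
insertion-unfixed o {f} eq fix v ins = insertion-moves-zero v ins
  (trans (sym (orient-cong o eq zero)) (orient-fixed o {f} (FixedInsertion.at-zero fix)))

enc-cubic : ∀ {w o} → Enc w o f → Cubic f
enc-cubic enc = Invariant.cubic (enc⇒invariant enc)

≗-sym : f ≗ g → g ≗ f
≗-sym eq x = sym (eq x)

-- The last letter can be read off `f`: whether 0 is fixed, otherwise the orientation of the cycle
-- of `l`, and then `k` and `q`. A turn differs from a block by the orientation of what remains
-- after the deletion.
enc-injective : ∀ {w w′ o o′} → f ≗ g → Enc w o f → Enc w′ o′ g → w ≡ w′ × o ≡ o′
enc-injective eq empty empty = refl , refl
enc-injective eq (fixed enc fix) (fixed enc′ fix′) with enc-injective eq′ enc enc′
  where
  eq′ : _ ≗ _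
  eq′ x = Fin.suc-injective (trans (sym (FixedInsertion.at-suc fix x))
            (trans (eq (suc x)) (FixedInsertion.at-suc fix′ x)))
... | refl , refl = refl , refl
enc-injective eq (fixed enc fix) (turn {o = o} _ enc′ ins) =
  contradiction ins (insertion-unfixed (not o) eq fix valid-00)
enc-injective eq (fixed enc fix) (block {o = o} _ enc′ c≤s ins) =
  contradiction ins (insertion-unfixed o eq fix (Spec.block-sound (Invariant.spec (enc⇒invariant enc′)) c≤s))
enc-injective eq (fixed enc fix) (extend {o = o} _ enc′ _ v ins) =
  contradiction ins (insertion-unfixed o eq fix v)
enc-injective eq (turn {o = o} _ enc′ ins) (fixed enc fix) =
  contradiction ins (insertion-unfixed (not o) (≗-sym eq) fix valid-00)
enc-injective eq (block {o = o} _ enc′ c≤s ins) (fixed enc fix) =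
  contradiction ins (insertion-unfixed o (≗-sym eq) fix (Spec.block-sound (Invariant.spec (enc⇒invariant enc′)) c≤s))
enc-injective eq (extend {o = o} _ enc′ _ v ins) (fixed enc fix) =
  contradiction ins (insertion-unfixed o (≗-sym eq) fix v)
enc-injective eq (turn {o = o} f³ enc ins) (turn {o = o′} _ enc′ ins′)
  with insertion-injective (not o) (not o′) eq f³ (enc-cubic enc) (enc-cubic enc′) ins ins′
... | o≡o′ , _ , _ , eq′ with enc-injective eq′ enc enc′
... | refl , _ = refl , o≡o′
enc-injective eq (turn {o = o} f³ enc ins) (block {o = o′} _ enc′ _ ins′)
  with insertion-injective (not o) o′ eq f³ (enc-cubic enc) (enc-cubic enc′) ins ins′
... | refl , _ , _ , eq′ = contradiction (proj₂ (enc-injective eq′ enc enc′)) (not-¬ refl)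
enc-injective eq (turn {o = o} f³ enc ins) (extend {o = o′} _ enc′ _ _ ins′)
  with insertion-injective (not o) o′ eq f³ (enc-cubic enc) (enc-cubic enc′) ins ins′
... | _ , () , _
enc-injective eq (block {o = o} f³ enc _ ins) (turn {o = o′} _ enc′ ins′)
  with insertion-injective o (not o′) eq f³ (enc-cubic enc) (enc-cubic enc′) ins ins′
... | refl , _ , _ , eq′ = contradiction (sym (proj₂ (enc-injective eq′ enc enc′))) (not-¬ refl)
enc-injective eq (block {o = o} f³ enc c≤s ins) (block {o = o′} _ enc′ c′≤s ins′)
  with insertion-injective o o′ eq f³ (enc-cubic enc) (enc-cubic enc′) ins ins′
... | o≡o′ , _ , αc≡αc′ , eq′ with enc-injective eq′ enc enc′
... | refl , _ = cong (λ c → block c ∷ _)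
      (Spec.α-injective (Invariant.spec (enc⇒invariant enc)) c≤s c′≤s αc≡αc′) , o≡o′
enc-injective eq (block {o = o} f³ enc _ ins) (extend {o = o′} _ enc′ _ _ ins′)
  with insertion-injective o o′ eq f³ (enc-cubic enc) (enc-cubic enc′) ins ins′
... | _ , () , _
enc-injective eq (extend {o = o} f³ enc _ _ ins) (turn {o = o′} _ enc′ ins′)
  with insertion-injective o (not o′) eq f³ (enc-cubic enc) (enc-cubic enc′) ins ins′
... | _ , () , _
enc-injective eq (extend {o = o} f³ enc _ _ ins) (block {o = o′} _ enc′ _ ins′)
  with insertion-injective o o′ eq f³ (enc-cubic enc) (enc-cubic enc′) ins ins′
... | _ , () , _
enc-injective eq (extend {o = o} f³ enc _ _ ins) (extend {o = o′} _ enc′ _ _ ins′)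
  with insertion-injective o o′ eq f³ (enc-cubic enc) (enc-cubic enc′) ins ins′
... | o≡o′ , refl , _ , eq′ with enc-injective eq′ enc enc′
... | refl , _ = refl , o≡o′

valid-suc-unique : ∀ {q′} → Cubic f → Valid f (suc j) q → q ≤ n → Valid {n} f (suc j) q′ → q′ ≤ n → q ≡ q′
valid-suc-unique {n = n} {f} {j} f³ v q≤n v′ q′≤n =
  trans (valid-determined f³ v q≤n i i≡j) (sym (valid-determined f³ v′ q′≤n i i≡j))
  where
  j<n : j < n
  j<n = ≤-trans (Valid.k≤q v) q≤n
  i : Fin n
  i = fromℕ< j<n
  i≡j : toℕ i ≡ j
  i≡j = Fin.toℕ-fromℕ< j<n

-- The letter `extend j` carries no `q`, but `valid-suc-unique` recovers it, so building from a word
-- leaves no choice.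
enc-unique : ∀ {w o o′} → Enc w o f → Enc w o′ g → f ≗ g × o ≡ o′
enc-unique empty empty = (λ ()) , refl
enc-unique (fixed enc fix) (fixed enc′ fix′) with enc-unique enc enc′
... | eq , refl = (λ { zero → trans (FixedInsertion.at-zero fix) (sym (FixedInsertion.at-zero fix′))
                     ; (suc x) → trans (FixedInsertion.at-suc fix x)
                         (trans (cong suc (eq x)) (sym (FixedInsertion.at-suc fix′ x))) }) , refl
enc-unique (turn {o = o} f³ enc ins) (turn g³ enc′ ins′) with enc-unique enc enc′
... | eq , refl = orient-injective (not o) f³ g³ (insertion-unique
      (insertion-cong (λ _ → refl) (orient-cong (not o) eq) ins) ins′) , refl
enc-unique (block {o = o} f³ enc _ ins) (block g³ enc′ _ ins′) with enc-unique enc enc′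
... | eq , refl = orient-injective o f³ g³ (insertion-unique
      (insertion-cong (λ _ → refl) (orient-cong o eq) ins) ins′) , refl
enc-unique (extend {o = o} f³ enc _ v ins) (extend g³ enc′ _ v′ ins′) with enc-unique enc enc′
... | eq , refl with valid-suc-unique (orient-cubic o (enc-cubic enc′)) (valid-cong (orient-cong o eq) v)
                       (Insertion.q≤N ins) v′ (Insertion.q≤N ins′)
... | refl = orient-injective o f³ g³ (insertion-unique
      (insertion-cong (λ _ → refl) (orient-cong o eq) ins) ins′) , refl

data Legal : Word → Set where
  empty  : Legal []
  fixed  : ∀ {w} → Legal w → Legal (fixed ∷ w)
  turn   : ∀ {w} → Legal w → Legal (turn ∷ w)
  block  : ∀ {w c} → c ≤ blocks w → Legal w → Legal (block c ∷ w)
  extend : ∀ {w j} → j < extensions w → Legal w → Legal (extend j ∷ w)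

enc⇒legal : ∀ {w o} → Enc w o f → Legal w
enc⇒legal empty                   = empty
enc⇒legal (fixed enc _)           = fixed (enc⇒legal enc)
enc⇒legal (turn _ enc _)          = turn (enc⇒legal enc)
enc⇒legal (block _ enc c≤s _)     = block c≤s (enc⇒legal enc)
enc⇒legal (extend _ enc j<t _ _)  = extend j<t (enc⇒legal enc)

size : Word → ℕ
size []          = 0
size (fixed ∷ w) = suc (size w)
size (_     ∷ w) = 3 + size w

mkPositions : ∀ {N} → k ≤ q → q ≤ N → Positions N k q
mkPositions {k} {q} {N} k≤q q≤N = record
  { t = fromℕ< k<3+N ; m = fromℕ< q<2+N ; k≤q = k≤q ; q≤N = q≤N
  ; toℕ-t = Fin.toℕ-fromℕ< k<3+N ; toℕ-m = Fin.toℕ-fromℕ< q<2+N }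
  where
  k<3+N : k < 3 + N
  k<3+N = s≤s (≤-trans (≤-trans k≤q q≤N) (m≤n⇒m≤1+n (m≤n⇒m≤1+n ≤-refl)))
  q<2+N : suc q < 3 + N
  q<2+N = s≤s (s≤s (m≤n⇒m≤1+n q≤N))

insert-oriented : ∀ {N} o {f′ : Endo N} → Cubic f′ → k ≤ q → q ≤ N →
  ∃[ f ] Cubic f × Insertion k q (orient o f) (orient o f′)
insert-oriented o {f′} f′³ k≤q q≤N with insert (mkPositions k≤q q≤N) (orient o f′)
... | g , ins = orient o g , orient-cubic o g³ ,
      insertion-cong (≗-sym (orient-involutive o g³)) (λ _ → refl) ins
  where g³ = insertion-cubic ins (orient-cubic o f′³)

decode : ∀ {w} → Legal w → ∃[ f ] ∃[ o ] Enc {size w} w o f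
decode empty = id , true , empty
decode (fixed L) with decode L
... | f′ , o , enc = lifted , o , fixed enc record { at-zero = refl ; at-suc = λ _ → refl }
  where
  lifted : Endo _
  lifted zero    = zero
  lifted (suc x) = suc (f′ x)
decode (turn L) with decode L
... | f′ , o , enc with insert-oriented (not o) (enc-cubic enc) z≤n z≤n
... | f , f³ , ins = f , not o , turn f³ enc ins
decode (block c≤s L) with decode L
... | f′ , o , enc with insert-oriented o (enc-cubic enc) z≤n
                          (Spec.α-bounded (Invariant.spec (enc⇒invariant enc)) c≤s)
... | f , f³ , ins = f , o , block f³ enc c≤s ins
decode (extend j<t L) with decode L
... | f′ , o , enc with Spec.extend-sound (Invariant.spec (enc⇒invariant enc)) j<t
... | q , q≤N , v with insert-oriented o (enc-cubic enc) (Valid.k≤q v) q≤N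
... | f , f³ , ins = f , o , extend f³ enc j<t v ins

delete-zero : ∀ {f : Endo (suc n)} → Cubic f → f zero ≡ zero → ∃[ f′ ] FixedInsertion f f′
delete-zero {f = f} f³ f0≡0 = (λ x → punchOut (0≢ x)) , record
  { at-zero = f0≡0 ; at-suc = λ x → sym (Fin.punchIn-punchOut (0≢ x)) }
  where
  0≢ : ∀ x → zero ≢ f (suc x)
  0≢ x 0≡ = Fin.0≢1+n (cubic⇒injective {f = f} f³ (trans f0≡0 0≡))

fixed-delete-cubic : ∀ {N} {f : Endo (suc N)} {f′} → FixedInsertion f f′ → Cubic f → Cubic f′
fixed-delete-cubic {f = f} {f′} fix f³ x = Fin.suc-injective (trans (sym (trans (cong (f ∘ f) (at-suc x))
  (trans (cong f (at-suc (f′ x))) (at-suc _)))) (f³ (suc x)))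
  where open FixedInsertion fix

fixed-delete-avoiding : ∀ {N} {f : Endo (suc N)} {f′} → FixedInsertion f f′ → Avoiding f → Avoiding f′
fixed-delete-avoiding fix av {x} {y} {z} x<y y<z p q = av (s<s x<y) (s<s y<z)
  (subst₂ Fin._<_ (sym (at-suc y)) (sym (at-suc x)) (s<s p))
  (subst₂ Fin._<_ (sym (at-suc x)) (sym (at-suc z)) (s<s q))
  where open FixedInsertion fix

-- If the last element were fixed, f would be increasing.
last-moves : ∀ {N} {f : Endo (3 + N)} → Cubic f → Avoiding f → f zero ≢ zero → f (lastOf N) ≢ lastOf N
last-moves {N} {f} f³ av f0≢0 fl≡l =
  contradiction (subst (f (f zero) Fin.<_) (f³ zero) (mono f0<ff0)) λ ()
  where
  l : Fin (3 + N)
  l = lastOf N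
  <l : ∀ {x} → x ≢ l → x Fin.< l
  <l {x} x≢l = ℕ.≤∧≢⇒< (subst (toℕ x ≤_) (sym (toℕ-lastOf N)) (s≤s⁻¹ (Fin.toℕ<n x))) (x≢l ∘ Fin.toℕ-injective)
  f<l : ∀ {x} → x ≢ l → f x Fin.< l
  f<l x≢l = <l λ fx≡l → x≢l (cubic⇒injective {f = f} f³ (trans fx≡l (sym fl≡l)))
  mono : ∀ {x y} → x Fin.< y → f x Fin.< f y
  mono {x} {y} x<y with toℕ y ℕ.≟ toℕ l | ℕ.<-cmp (toℕ (f x)) (toℕ (f y))
  ... | _ | tri< fx<fy _ _ = fx<fy
  ... | _ | tri≈ _ fx≡fy _ =
    contradiction x<y (<-irrefl (cong toℕ (cubic⇒injective {f = f} f³ (Fin.toℕ-injective fx≡fy))))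
  ... | yes y≡l | tri> _ _ _ with Fin.toℕ-injective y≡l
  ... | refl = subst (f x Fin.<_) (sym fl≡l) (f<l (Fin.<⇒≢ x<y))
  mono {x} {y} x<y | no y≢l | tri> _ _ fy<fx = ⊥-elim (av x<y y<l fy<fx
    (subst (f x Fin.<_) (sym fl≡l) (f<l (Fin.<⇒≢ (<-trans x<y y<l)))))
    where
    y<l : y Fin.< l
    y<l = <l (y≢l ∘ cong toℕ)
  0<f0 : 0 < toℕ (f zero)
  0<f0 = ℕ.≤∧≢⇒< z≤n (f0≢0 ∘ sym ∘ Fin.toℕ-injective)
  f0<ff0 : f zero Fin.< f (f zero)
  f0<ff0 = mono 0<f0

delete-cycle : ∀ {N} {g : Endo (3 + N)} → Cubic g → g (lastOf N) Fin.< g (g (lastOf N)) →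
  g (g (lastOf N)) ≢ lastOf N → ∃[ k ] ∃[ q ] ∃[ g′ ] Insertion k q g g′
delete-cycle {N} {g} g³ t<m m≢l = _ , _ , insertion-restrict pos g³ refl refl (g³ l)
  where
  l t m : Fin (3 + N)
  l = lastOf N
  t = g l
  m = g t
  m≡1+ : toℕ m ≡ suc (pred (toℕ m))
  m≡1+ = sym (ℕ.suc-pred (toℕ m) ⦃ >-nonZero (≤-<-trans z≤n t<m) ⦄)
  pos : Positions N (toℕ t) (pred (toℕ m))
  pos = record
    { t = t ; m = m ; toℕ-t = refl ; toℕ-m = m≡1+
    ; k≤q = s≤s⁻¹ (subst (toℕ t <_) m≡1+ t<m)
    ; q≤N = s≤s⁻¹ (s≤s⁻¹ (subst₂ _<_ m≡1+ (toℕ-lastOf N) (ℕ.≤∧≢⇒<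
        (subst (toℕ m ≤_) (sym (toℕ-lastOf N)) (s≤s⁻¹ (Fin.toℕ<n m))) (m≢l ∘ Fin.toℕ-injective)))) }

orient-zero : ∀ o {f : Endo (suc n)} → Cubic f → f zero ≢ zero → orient o f zero ≢ zero
orient-zero true  f³ f0≢0 = f0≢0
orient-zero false {f} f³ f0≢0 ff0≡0 = f0≢0 (trans (cong f (sym ff0≡0)) (f³ zero))

-- As `l` is moved, `f l` and `f (f l)` are distinct and differ from `l`; their order selects the
-- orientation in which `t < m`.
peel : ∀ {N} {f : Endo (3 + N)} → Cubic f → Avoiding f → f zero ≢ zero →
  ∃[ o ] ∃[ k ] ∃[ q ] ∃[ f′ ] Cubic f′ × Avoiding f′ × Valid (orient o f′) k q ×
    Insertion k q (orient o f) (orient o f′)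
peel {N} {f} f³ av f0≢0 = oriented (ℕ.<-cmp (toℕ t₁) (toℕ t₂))
  where
  l t₁ t₂ : Fin (3 + N)
  l = lastOf N
  t₁ = f l
  t₂ = f t₁
  t₁≢l : t₁ ≢ l
  t₁≢l = last-moves f³ av f0≢0
  t₂≢l : t₂ ≢ l
  t₂≢l eq = t₁≢l (trans (cong f (sym eq)) (f³ l))
  finish : ∀ o → (let g = orient o f) → g l Fin.< g (g l) → g (g l) ≢ l →
    ∃[ o ] ∃[ k ] ∃[ q ] ∃[ f′ ] Cubic f′ × Avoiding f′ × Valid (orient o f′) k q ×
      Insertion k q (orient o f) (orient o f′)
  finish o lt ne with delete-cycle (orient-cubic o f³) lt ne
  ... | k , q , g′ , ins = o , k , q , orient o g′ , orient-cubic o g′³ ,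
        orient-avoiding o g′³ (avoiding-delete ins g-av) ,
        valid-cong inv (valid-delete ins g³ g-av (orient-zero o f³ f0≢0)) ,
        insertion-cong (λ _ → refl) inv ins
    where
    g³ = orient-cubic o f³
    g-av = orient-avoiding o f³ av
    g′³ = deletion-cubic ins g³
    inv = ≗-sym (orient-involutive o g′³)
  oriented : _ → _
  oriented (tri< t₁<t₂ _ _) = finish true t₁<t₂ t₂≢l
  oriented (tri≈ _ t₁≡t₂ _) = contradiction (cubic⇒injective {f = f} f³ (Fin.toℕ-injective (sym t₁≡t₂))) t₁≢l
  oriented (tri> _ _ t₂<t₁) = finish false (subst (t₂ Fin.<_) (sym (cong f (f³ l))) t₂<t₁)
    (λ eq → t₁≢l (trans (sym (cong f (f³ l))) eq))

-- Against the previous orientation `rigid` leaves only a turn; along it, the completeness half of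
-- `Spec` supplies the letter.
encode-insertion : ∀ {N w o₀} o {f : Endo (3 + N)} {f′} → Cubic f → Enc w o₀ f′ →
  Valid (orient o f′) k q → Insertion k q (orient o f) (orient o f′) → ∃[ v ] ∃[ o ] Enc v o f
encode-insertion {k = k} {q} {w = w} {o₀} o {f} {f′} f³ enc v ins with o Bool.≟ o₀
... | no o≢o₀ rewrite Bool.¬-not o≢o₀ with rigid (Insertion.q≤N ins) v
  where open Invariant (enc⇒invariant enc)
... | refl , refl = _ , _ , turn f³ enc ins
encode-insertion {k = zero} {q} o f³ enc v ins | yes refl
  with Spec.block-complete (Invariant.spec (enc⇒invariant enc)) (Insertion.q≤N ins) v
... | c , c≤s , refl = _ , _ , block f³ enc c≤s ins
encode-insertion {k = suc k} {q} o f³ enc v ins | yes refl =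
  _ , _ , extend f³ enc (Spec.extend-complete (Invariant.spec (enc⇒invariant enc)) (Insertion.q≤N ins) v) v ins

-- `b` is a bound on `n` that drives the recursion, because a deleted cycle lowers `n` by 3. On at
-- most two elements, a map of order dividing 3 cannot move 0.
encode : ∀ b n {f : Endo n} → n ≤ b → Cubic f → Avoiding f → ∃[ w ] ∃[ o ] Enc w o f
encode b zero _ f³ av = _ , _ , empty
encode (suc b) (suc n) {f} (s≤s n≤b) f³ av with f zero Fin.≟ zero
... | yes f0≡0 with delete-zero f³ f0≡0
... | f′ , fix with encode b n n≤b (fixed-delete-cubic fix f³) (fixed-delete-avoiding fix av)
... | w , o , enc = _ , _ , fixed enc fix
encode (suc b) (suc zero) {f} (s≤s n≤b) f³ av | no f0≢0 with f zero
... | zero = contradiction refl f0≢0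
encode (suc b) (suc (suc zero)) {f} (s≤s n≤b) f³ av | no f0≢0 with f zero in eq | f (suc zero) in eq′
... | zero | _ = contradiction refl f0≢0
... | suc zero | suc zero = contradiction (cubic⇒injective {f = f} f³ (trans eq (sym eq′))) λ ()
... | suc zero | zero = contradiction (trans (sym (f³ zero)) (trans (cong (f ∘ f) eq) (trans (cong f eq′) eq))) λ ()
encode (suc b) (suc (suc (suc N))) {f} (s≤s n≤b) f³ av | no f0≢0 with peel f³ av f0≢0
... | o , k , q , f′ , f′³ , av′ , v , ins with encode b N (≤-trans (m≤n⇒m≤1+n (m≤n⇒m≤1+n ≤-refl)) n≤b) f′³ av′
... | w , o₀ , enc = encode-insertion o f³ enc v ins

-- Counting the continuations of a word

∑< : ℕ → (ℕ → ℕ) → ℕ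
∑< zero    f = 0
∑< (suc n) f = f 0 + ∑< n (f ∘ suc)

∑<-cong : ∀ n {f g : ℕ → ℕ} → (∀ i → i < n → f i ≡ g i) → ∑< n f ≡ ∑< n g
∑<-cong zero    eq = refl
∑<-cong (suc n) eq = cong₂ _+_ (eq 0 z<s) (∑<-cong n λ i i<n → eq (suc i) (s<s i<n))

∑<-+ : ∀ n (f g : ℕ → ℕ) → ∑< n (λ i → f i + g i) ≡ ∑< n f + ∑< n g
∑<-+ zero    f g = refl
∑<-+ (suc n) f g = trans (cong (f 0 + g 0 +_) (∑<-+ n (f ∘ suc) (g ∘ suc)))
  (interchange (f 0) (g 0) _ _)

∑<-*ˡ : ∀ n a (f : ℕ → ℕ) → ∑< n (λ i → a * f i) ≡ a * ∑< n f
∑<-*ˡ zero    a f = sym (*-zeroʳ a)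
∑<-*ˡ (suc n) a f = trans (cong (a * f 0 +_) (∑<-*ˡ n a (f ∘ suc))) (sym (*-distribˡ-+ a (f 0) _))

∑<-0 : ∀ n → ∑< n (λ _ → 0) ≡ 0
∑<-0 zero    = refl
∑<-0 (suc n) = ∑<-0 n

∑<-last : ∀ n (f : ℕ → ℕ) → ∑< (suc n) f ≡ ∑< n f + f n
∑<-last zero    f = +-identityʳ (f 0)
∑<-last (suc n) f = trans (cong (f 0 +_) (∑<-last n (f ∘ suc))) (sym (+-assoc (f 0) _ _))

children : ℕ → ℕ → (ℕ → ℕ → ℕ) → ℕ
children s t φ = φ 1 1 + (∑< (suc s) (λ c → φ (suc c) 1) + ∑< t (λ j → φ s (2 + j)))

-- The number of ways to go on from the node `(s , t)` with `m` more 3-cycles and `r` more fixed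
-- points; each fixed point resets the node to `(0 , 0)`.
continuations : (s t m r : ℕ) → ℕ
continuations s t zero    zero    = 1
continuations s t zero    (suc r) = continuations 0 0 zero r
continuations s t (suc m) zero    = children s t λ s t → continuations s t m zero
continuations s t (suc m) (suc r) =
  continuations 0 0 (suc m) r + children s t λ s t → continuations s t m (suc r)

continuations-0 : ∀ s t r → continuations s t 0 r ≡ 1
continuations-0 s t zero    = refl
continuations-0 s t (suc r) = continuations-0 0 0 r

-- The node `(s , t + 1)` has the children of `(s , t)` and in addition `(s , t + 2)`; a fixed point
-- leads from both to `(0 , 0)`.
continuations-t : ∀ s t m r → continuations s (suc t) (suc m) r ≡ continuations s t (suc m) r + continuations s (2 + t) m r
continuations-t s t m r = lemma r
  where
  children-t : ∀ φ → children s (suc t) φ ≡ children s t φ + φ s (2 + t)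
  children-t φ = trans (cong (λ a → φ 1 1 + (A + a)) (∑<-last t _))
    (trans (cong (φ 1 1 +_) (sym (+-assoc A _ _))) (sym (+-assoc (φ 1 1) _ _)))
    where A = ∑< (suc s) (λ c → φ (suc c) 1)
  lemma : ∀ r → continuations s (suc t) (suc m) r ≡ continuations s t (suc m) r + continuations s (2 + t) m r
  lemma zero    = children-t λ s t → continuations s t m zero
  lemma (suc r) = trans (cong (continuations 0 0 (suc m) r +_) (children-t λ s t → continuations s t m (suc r)))
    (sym (+-assoc (continuations 0 0 (suc m) r) _ _))

-- The additional child is the one of the new block point `c = s + 1`.
continuations-s : ∀ s m r → continuations (suc s) 0 (suc m) r ≡ continuations s 0 (suc m) r + continuations (2 + s) 1 m r
continuations-s s m r = lemma r
  where
  children-s : ∀ φ → children (suc s) 0 φ ≡ children s 0 φ + φ (2 + s) 1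
  children-s φ = trans (cong (λ a → φ 1 1 + (a + 0)) (∑<-last (suc s) λ c → φ (suc c) 1))
    (solve 3 (λ a b c → a :+ ((b :+ c) :+ con 0) := (a :+ (b :+ con 0)) :+ c) refl
      (φ 1 1) (∑< (suc s) λ c → φ (suc c) 1) (φ (2 + s) 1))
    where open +-*-Solver
  lemma : ∀ r → continuations (suc s) 0 (suc m) r ≡ continuations s 0 (suc m) r + continuations (2 + s) 1 m r
  lemma zero    = children-s λ s t → continuations s t m zero
  lemma (suc r) = trans (cong (continuations 0 0 (suc m) r +_) (children-s λ s t → continuations s t m (suc r)))
    (sym (+-assoc (continuations 0 0 (suc m) r) _ _))

-- Power series in z and the powers of the Catalan series

Series : Set
Series = ℕ → ℕ

-- The Cauchy product.
conv : Series → Series → Series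
conv c g zero    = c 0 * g 0
conv c g (suc m) = c 0 * g (suc m) + conv (c ∘ suc) g m

conv-congʳ : ∀ c {g h} m → (∀ i → i ≤ m → g i ≡ h i) → conv c g m ≡ conv c h m
conv-congʳ c zero    eq = cong (c 0 *_) (eq 0 z≤n)
conv-congʳ c (suc m) eq = cong₂ _+_ (cong (c 0 *_) (eq (suc m) ≤-refl))
  (conv-congʳ (c ∘ suc) m λ i i≤m → eq i (m≤n⇒m≤1+n i≤m))

conv-+ˡ : ∀ c d g m → conv (λ n → c n + d n) g m ≡ conv c g m + conv d g m
conv-+ˡ c d g zero    = *-distribʳ-+ (g 0) (c 0) (d 0)
conv-+ˡ c d g (suc m) = trans (cong₂ _+_ (*-distribʳ-+ (g (suc m)) (c 0) (d 0)) (conv-+ˡ (c ∘ suc) (d ∘ suc) g m))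
  (interchange (c 0 * g (suc m)) (d 0 * g (suc m)) _ _)

conv-+ʳ : ∀ c g h m → conv c (λ i → g i + h i) m ≡ conv c g m + conv c h m
conv-+ʳ c g h zero    = *-distribˡ-+ (c 0) (g 0) (h 0)
conv-+ʳ c g h (suc m) = trans (cong₂ _+_ (*-distribˡ-+ (c 0) (g (suc m)) (h (suc m))) (conv-+ʳ (c ∘ suc) g h m))
  (interchange (c 0 * g (suc m)) (c 0 * h (suc m)) _ _)

conv-*ʳ : ∀ c g a m → conv c (λ i → g i * a) m ≡ conv c g m * a
conv-*ʳ c g a zero    = sym (*-assoc (c 0) (g 0) a)
conv-*ʳ c g a (suc m) = trans (cong₂ _+_ (sym (*-assoc (c 0) (g (suc m)) a)) (conv-*ʳ (c ∘ suc) g a m))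
  (sym (*-distribʳ-+ a (c 0 * g (suc m)) _))

conv-0ˡ : ∀ g m → conv (λ _ → 0) g m ≡ 0
conv-0ˡ g zero    = refl
conv-0ˡ g (suc m) = conv-0ˡ g m

conv-0ʳ : ∀ c m → conv c (λ _ → 0) m ≡ 0
conv-0ʳ c zero    = *-zeroʳ (c 0)
conv-0ʳ c (suc m) = cong₂ _+_ (*-zeroʳ (c 0)) (conv-0ʳ (c ∘ suc) m)

-- The coefficients of the s-th power of the Catalan series C, computed from
-- C ^ (1 + s) = C ^ s + z C ^ (2 + s).
catalanPower : ℕ → Series
catalanPower zero    zero    = 1
catalanPower zero    (suc n) = 0
catalanPower (suc s) zero    = 1
catalanPower (suc s) (suc n) = catalanPower s (suc n) + catalanPower (2 + s) n

catalanPower-0 : ∀ s → catalanPower s 0 ≡ 1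
catalanPower-0 zero    = refl
catalanPower-0 (suc s) = refl

conv-power-0 : ∀ g m → conv (catalanPower 0) g m ≡ g m
conv-power-0 g zero    = +-identityʳ (g 0)
conv-power-0 g (suc m) = trans (cong₂ _+_ (+-identityʳ (g (suc m))) (conv-0ˡ g m)) (+-identityʳ _)

conv-power-suc : ∀ s g m →
  conv (catalanPower (suc s)) g (suc m) ≡ conv (catalanPower s) g (suc m) + conv (catalanPower (2 + s)) g m
conv-power-suc s g m = trans (cong (1 * g (suc m) +_) (conv-+ˡ (catalanPower s ∘ suc) (catalanPower (2 + s)) g m))
  (trans (sym (+-assoc (1 * g (suc m)) _ _))
    (cong (λ a → a * g (suc m) + conv (catalanPower s ∘ suc) g m + conv (catalanPower (2 + s)) g m) (sym (catalanPower-0 s))))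

-- Exponents add because both sides obey the defining recurrence in `s`; the induction is
-- lexicographic in `m` and `s`.
conv-power-+ : ∀ s t g m → conv (catalanPower s) (conv (catalanPower t) g) m ≡ conv (catalanPower (s + t)) g m
conv-power-+ zero    t g m = conv-power-0 (conv (catalanPower t) g) m
conv-power-+ (suc s) t g zero = trans (+-identityʳ _) (cong (_* g 0) (catalanPower-0 t))
conv-power-+ (suc s) t g (suc m) = trans (conv-power-suc s _ m) (trans
  (cong₂ _+_ (conv-power-+ s t g (suc m)) (conv-power-+ (2 + s) t g m))
  (sym (conv-power-suc (s + t) g m)))

-- In `t`, the counts obey the recurrence that defines `catalanPower`, with initial value `T s` in
-- place of 1.
continuations-conv : ∀ s t m r →
  continuations s t m r ≡ conv (catalanPower t) (λ m → continuations s 0 m r) m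
continuations-conv s zero    m r = sym (conv-power-0 _ m)
continuations-conv s (suc t) zero r = trans (continuations-0 s (suc t) r) (sym (trans (+-identityʳ _) (continuations-0 s 0 r)))
continuations-conv s (suc t) (suc m) r = trans (continuations-t s t m r) (trans
  (cong₂ _+_ (continuations-conv s t (suc m) r) (continuations-conv s (2 + t) m r))
  (sym (conv-power-suc t _ m)))

-- Multiplication by X = z C and by D = z C ^ 2 = X / (1 - X).
X D : Series → Series
X g zero    = 0
X g (suc m) = conv (catalanPower 1) g m
D g zero    = 0
D g (suc m) = conv (catalanPower 2) g m

X-cong : ∀ {g h : Series} m → (∀ i → i < m → g i ≡ h i) → X g m ≡ X h m
X-cong zero    eq = refl
X-cong (suc m) eq = conv-congʳ _ m λ i i≤m → eq i (s≤s i≤m)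

D-cong : ∀ {g h : Series} m → (∀ i → i < m → g i ≡ h i) → D g m ≡ D h m
D-cong zero    eq = refl
D-cong (suc m) eq = conv-congʳ _ m λ i i≤m → eq i (s≤s i≤m)

X-+ : ∀ g h m → X (λ i → g i + h i) m ≡ X g m + X h m
X-+ g h zero    = refl
X-+ g h (suc m) = conv-+ʳ _ g h m

D-+ : ∀ g h m → D (λ i → g i + h i) m ≡ D g m + D h m
D-+ g h zero    = refl
D-+ g h (suc m) = conv-+ʳ _ g h m

D-* : ∀ g a m → D (λ i → g i * a) m ≡ D g m * a
D-* g a zero    = refl
D-* g a (suc m) = conv-*ʳ _ g a m

D-0 : ∀ m → D (λ _ → 0) m ≡ 0
D-0 zero    = refl
D-0 (suc m) = conv-0ʳ _ m

D-∑ : ∀ n (g : ℕ → Series) m → D (λ i → ∑< n λ j → g j i) m ≡ ∑< n λ j → D (g j) m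
D-∑ zero    g m = D-0 m
D-∑ (suc n) g m = trans (D-+ (g 0) _ m) (cong (D (g 0) m +_) (D-∑ n (g ∘ suc) m))

-- `D = X (1 + D)`, because `C ^ 2 = C · C` and `C = 1 + z C ^ 2`.
D≡X : ∀ g m → D g m ≡ X (λ i → g i + D g i) m
D≡X g zero    = refl
D≡X g (suc m) = trans (sym (conv-power-+ 1 1 g m)) (conv-congʳ _ m λ i _ → unfold i)
  where
  unfold : ∀ i → conv (catalanPower 1) g i ≡ g i + D g i
  unfold zero    = refl
  unfold (suc i) = cong (_+ D g (suc i)) (+-identityʳ (g (suc i)))

-- `X` raises the degree, so `y = X (g + y)` determines `y` coefficient by coefficient. This is how
-- division by `1 - X` is carried out over the naturals.
D-unique : ∀ {g y : Series} → (∀ m → y m ≡ X (λ i → g i + y i) m) → ∀ m → y m ≡ D g m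
D-unique {g} {y} eq m = below (suc m) m ≤-refl
  where
  below : ∀ b m → m < b → y m ≡ D g m
  below (suc b) m m<b = trans (eq m) (trans
    (X-cong m λ i i<m → cong (g i +_) (below b i (≤-trans i<m (s≤s⁻¹ m<b))))
    (sym (D≡X g m)))

X^ : ℕ → Series → Series
X^ zero    g = g
X^ (suc h) g = X (X^ h g)

X^-cong : ∀ h {g g′} → (∀ i → g i ≡ g′ i) → ∀ m → X^ h g m ≡ X^ h g′ m
X^-cong zero    eq m = eq m
X^-cong (suc h) eq m = X-cong m λ i _ → X^-cong h eq i

X^-+ : ∀ h g g′ m → X^ h (λ i → g i + g′ i) m ≡ X^ h g m + X^ h g′ m
X^-+ zero    g g′ m = refl
X^-+ (suc h) g g′ m = trans (X-cong m λ i _ → X^-+ h g g′ i) (X-+ _ _ m)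

X^-X : ∀ h g m → X^ h (X g) m ≡ X (X^ h g) m
X^-X zero    g m = refl
X^-X (suc h) g m = X-cong m λ i _ → X^-X h g i

δ : Series
δ zero    = 1
δ (suc _) = 0

-- Multiplication by `1 / (1 - u)` on coefficients of powers of `u`.
partialSum : (ℕ → ℕ) → ℕ → ℕ
partialSum y zero    = y 0
partialSum y (suc r) = partialSum y r + y (suc r)

partialSum-cong : ∀ {y z : ℕ → ℕ} r → (∀ i → y i ≡ z i) → partialSum y r ≡ partialSum z r
partialSum-cong zero    eq = eq 0
partialSum-cong (suc r) eq = cong₂ _+_ (partialSum-cong r eq) (eq (suc r))

partialSum-+ : ∀ (y z : ℕ → ℕ) r → partialSum (λ i → y i + z i) r ≡ partialSum y r + partialSum z r
partialSum-+ y z zero    = refl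
partialSum-+ y z (suc r) = trans (cong (_+ (y (suc r) + z (suc r))) (partialSum-+ y z r))
  (interchange (partialSum y r) (partialSum z r) _ _)

partialSum-* : ∀ a (y : ℕ → ℕ) r → partialSum (λ i → a * y i) r ≡ a * partialSum y r
partialSum-* a y zero    = refl
partialSum-* a y (suc r) = trans (cong (_+ a * y (suc r)) (partialSum-* a y r)) (sym (*-distribˡ-+ a _ _))

partialSum-0 : ∀ r → partialSum (λ _ → 0) r ≡ 0
partialSum-0 zero    = refl
partialSum-0 (suc r) = cong (_+ 0) (partialSum-0 r)

partialSum-∑ : ∀ n (y : ℕ → ℕ → ℕ) r → partialSum (λ i → ∑< n λ j → y j i) r ≡ ∑< n λ j → partialSum (y j) r
partialSum-∑ zero    y r = partialSum-0 r
partialSum-∑ (suc n) y r = trans (partialSum-+ (y 0) _ r) (cong (partialSum (y 0) r +_) (partialSum-∑ n (y ∘ suc) r))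

-- From the generating tree to weighted Motzkin paths

S : ℕ → ℕ → Series
S s r m = continuations s 0 m r

X-S : ∀ s r m → X (S s r) (suc m) ≡ continuations s 1 m r
X-S s r m = sym (continuations-conv s 1 m r)

S-suc : ∀ s r m → S (suc s) r m ≡ S s r m + X (S (2 + s) r) m
S-suc s r zero    = trans (continuations-0 (suc s) 0 r) (sym (trans (+-identityʳ _) (continuations-0 s 0 r)))
S-suc s r (suc m) = trans (continuations-s s m r) (cong (S s r (suc m) +_) (sym (X-S (2 + s) r m)))

-- From `(0 , 0)`, `turn` and `block 0` both lead to `(1 , 1)`, and a fixed point leads back. This
-- is `T 0 = (1 + 2 X T 1) / (1 - u)`.
S-zero : ∀ r m → S 0 r m ≡ δ m + 2 * partialSum (λ r → X (S 1 r) m) r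
S-zero r zero = trans (continuations-0 0 0 r) (cong (λ a → 1 + 2 * a) (sym (partialSum-0 r)))
S-zero r (suc m) = lemma r
  where
  open +-*-Solver
  twice : ∀ r → children 0 0 (λ s t → continuations s t m r) ≡ 2 * X (S 1 r) (suc m)
  twice r = trans (solve 1 (λ a → a :+ ((a :+ con 0) :+ con 0) := con 2 :* a) refl (continuations 1 1 m r))
    (cong (2 *_) (sym (X-S 1 r m)))
  lemma : ∀ r → S 0 r (suc m) ≡ 2 * partialSum (λ r → X (S 1 r) (suc m)) r
  lemma zero    = twice 0
  lemma (suc r) = trans (cong₂ _+_ (lemma r) (twice (suc r)))
    (sym (*-distribˡ-+ 2 (partialSum (λ r → X (S 1 r) (suc m)) r) _))

odd : ℕ → ℕ
odd zero    = 1
odd (suc h) = 2 + odd h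

-- With q = 2 / (1 - u), where u marks fixed points, K h is q / 2 times the
-- weight of the paths from height h to 0 in which every step, and an
-- additional initial one, has weight D, and flat steps at height 0 have the
-- additional weight q.
K : ℕ → ℕ → Series
K h r = X^ (suc h) (S (odd h) r)

-- Using `S-suc` three times gives `T (o + 2) = T o + 2 X T (o + 2) + X ^ 2 T (o + 4)` for `o = 2 h
-- + 1`. One of the two middle terms is the unknown itself, which `D-unique` absorbs by turning `X`
-- into `D`.
K-suc : ∀ h r m → K (suc h) r m ≡ D (λ i → K h r i + K (suc h) r i + K (2 + h) r i) m
K-suc h r = D-unique {y = K (suc h) r} λ m → X-cong m λ i _ → trans (X^-cong (suc h) expand i) (trans (linear i)
    (solve 3 (λ a b c → (a :+ b) :+ (b :+ c) := ((a :+ b) :+ c) :+ b) refl (K h r i) (K (suc h) r i) (K (2 + h) r i)))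
  where
  open +-*-Solver
  o = odd h
  expand : ∀ i → S (2 + o) r i ≡ (S o r i + X (S (2 + o) r) i) + (X (S (2 + o) r) i + X (X (S (4 + o) r)) i)
  expand i = trans (S-suc (1 + o) r i) (cong₂ _+_ (S-suc o r i)
    (trans (X-cong i λ j _ → S-suc (2 + o) r j) (X-+ (S (2 + o) r) _ i)))
  linear : ∀ i → X^ (suc h) (λ i → (S o r i + X (S (2 + o) r) i) + (X (S (2 + o) r) i + X (X (S (4 + o) r)) i)) i
    ≡ (K h r i + K (suc h) r i) + (K (suc h) r i + K (2 + h) r i)
  linear i = trans (X^-+ (suc h) _ _ i) (cong₂ _+_
    (trans (X^-+ (suc h) (S o r) _ i) (cong (K h r i +_) (X^-X (suc h) _ i)))
    (trans (X^-+ (suc h) (X (S (2 + o) r)) _ i) (cong₂ _+_ (X^-X (suc h) _ i)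
      (trans (X^-X (suc h) _ i) (X-cong i λ j _ → X^-X (suc h) _ j)))))

K-zero : ∀ r m → K 0 r m ≡ D (λ i → δ i + 2 * partialSum (λ r → K 0 r i) r + K 1 r i) m
K-zero r = D-unique {y = K 0 r} λ m → X-cong m λ i _ → trans (S-suc 0 r i)
  (trans (cong₂ _+_ (S-zero r i) (trans (X-cong i λ j _ → S-suc 1 r j) (X-+ (S 1 r) _ i)))
    (solve 3 (λ a b c → a :+ (b :+ c) := (a :+ c) :+ b) refl _ (K 0 r i) (K 1 r i)))
  where open +-*-Solver

-- The powers of `D`. The coefficients of `D = C - 1` are the Catalan numbers of positive index, so
-- a power collects compositions.
compositionSum : ℕ → Series
compositionSum zero    = δ
compositionSum (suc k) = D (compositionSum k)

-- The coefficient of `u ^ r` in `q / 2` times the weight of the paths from height `h` to 0 of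
-- length `i`, each flat step at height 0 having weight `q = 2 / (1 - u)`.
ν : ℕ → ℕ → ℕ → ℕ
ν zero    zero    r = 1
ν (suc h) zero    r = 0
ν zero    (suc i) r = 2 * partialSum (ν 0 i) r + ν 1 i r
ν (suc h) (suc i) r = ν h i r + ν (suc h) i r + ν (2 + h) i r

-- Unrolls the recurrences of `K` step by step. Each step contributes a factor `D`, which has no
-- constant term, so `b` terms suffice for the coefficients up to `b`.
K≡∑ : ∀ b m → m ≤ b → ∀ h r → K h r m ≡ ∑< b λ i → compositionSum (suc i) m * ν h i r
K≡∑ zero    zero _ h r = refl
K≡∑ (suc b) m m≤b h r = trans (step h) (trans (D-+ (λ i → δ i * ν h 0 r) _ m)
  (cong₂ _+_ (D-* δ (ν h 0 r) m) (trans (D-∑ b _ m) (∑<-cong b λ i _ → D-* (compositionSum (suc i)) (ν h (suc i) r) m))))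
  where
  IH : ∀ j → j < m → ∀ h r → K h r j ≡ ∑< b λ i → compositionSum (suc i) j * ν h i r
  IH j j<m = K≡∑ b j (s≤s⁻¹ (≤-trans j<m m≤b))
  three : ∀ j (x y z : ℕ → ℕ) → let c = λ i → compositionSum (suc i) j in
    ∑< b (λ i → c i * (x i + y i + z i)) ≡ ∑< b (λ i → c i * x i) + ∑< b (λ i → c i * y i) + ∑< b (λ i → c i * z i)
  three j x y z = trans (∑<-cong b λ i _ →
      trans (*-distribˡ-+ (c i) (x i + y i) (z i)) (cong (_+ c i * z i) (*-distribˡ-+ (c i) (x i) (y i))))
    (trans (∑<-+ b _ _) (cong (_+ ∑< b (λ i → c i * z i)) (∑<-+ b _ _)))
    where c = λ i → compositionSum (suc i) j
  two : ∀ j (x y : ℕ → ℕ) → let c = λ i → compositionSum (suc i) j in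
    ∑< b (λ i → c i * (x i + y i)) ≡ ∑< b (λ i → c i * x i) + ∑< b (λ i → c i * y i)
  two j x y = trans (∑<-cong b λ i _ → *-distribˡ-+ (compositionSum (suc i) j) (x i) (y i)) (∑<-+ b _ _)
  twice : ∀ j → j < m → 2 * partialSum (λ r → K 0 r j) r ≡ ∑< b λ i → compositionSum (suc i) j * (2 * partialSum (ν 0 i) r)
  twice j j<m = trans (cong (2 *_) (trans (partialSum-cong r λ r → IH j j<m 0 r) (partialSum-∑ b _ r)))
    (trans (sym (∑<-*ˡ b 2 _)) (∑<-cong b λ i _ →
      trans (cong (2 *_) (partialSum-* (compositionSum (suc i) j) (ν 0 i) r))
        (trans (sym (*-assoc 2 (compositionSum (suc i) j) _)) (trans (cong (_* partialSum (ν 0 i) r) (*-comm 2 (compositionSum (suc i) j)))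
          (*-assoc (compositionSum (suc i) j) 2 _)))))
  step : ∀ h → K h r m ≡ D (λ j → δ j * ν h 0 r + ∑< b λ i → compositionSum (suc i) j * ν h (suc i) r) m
  step zero = trans (K-zero r m) (D-cong m λ j j<m → trans (+-assoc (δ j) _ _) (cong₂ _+_ (sym (ℕ.*-identityʳ (δ j)))
    (trans (cong₂ _+_ (twice j j<m) (IH j j<m 1 r)) (sym (two j _ _)))))
  step (suc h) = trans (K-suc h r m) (D-cong m λ j j<m → trans
    (cong₂ _+_ (cong₂ _+_ (IH j j<m h r) (IH j j<m (suc h) r)) (IH j j<m (2 + h) r))
    (trans (sym (three j _ _ _)) (cong (_+ ∑< b (λ i → compositionSum (suc i) j * ν (suc h) (suc i) r)) (sym (*-zeroʳ (δ j))))))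

-- Motzkin paths from height h to 0 of length i with j flat steps at height 0.
μ : ℕ → ℕ → ℕ → ℕ
μ zero    zero    zero    = 1
μ zero    zero    (suc j) = 0
μ (suc h) zero    j       = 0
μ zero    (suc i) zero    = μ 1 i 0
μ zero    (suc i) (suc j) = μ 0 i j + μ 1 i (suc j)
μ (suc h) (suc i) j       = μ h i j + μ (suc h) i j + μ (2 + h) i j

-- The coefficient of u ^ r in q ^ (1 + j) / 2.
β : ℕ → ℕ → ℕ
β j r = 2 ^ j * ((r + j) C r)

β-zero : ∀ r → β 0 r ≡ 1
β-zero r = trans (+-identityʳ _) (trans (cong (_C r) (+-identityʳ r)) (nCn≡1 r))

hockey-stick : ∀ j r → partialSum (λ r → (r + j) C r) r ≡ (r + suc j) C r
hockey-stick j zero    = refl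
hockey-stick j (suc r) = trans (cong₂ _+_ (hockey-stick j r) (cong (_C suc r) (sym (ℕ.+-suc r j))))
  (nCk+nC[k+1]≡[n+1]C[k+1] (r + suc j) r)

β-suc : ∀ j r → β (suc j) r ≡ 2 * partialSum (β j) r
β-suc j r = trans (*-assoc 2 (2 ^ j) _) (cong (2 *_) (trans (cong (2 ^ j *_) (sym (hockey-stick j r)))
  (sym (partialSum-* (2 ^ j) _ r))))

-- Sorts the paths by their number `j` of flat steps at height 0, which is at most `i`.
ν≡∑ : ∀ h i b r → i < b → ν h i r ≡ ∑< b λ j → β j r * μ h i j
ν≡∑ zero    zero (suc b) r _ = sym (cong₂ _+_ (trans (ℕ.*-identityʳ _) (β-zero r))
  (trans (∑<-cong b λ j _ → *-zeroʳ (β (suc j) r)) (∑<-0 b)))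
ν≡∑ (suc h) zero b r _ = sym (trans (∑<-cong b λ j _ → *-zeroʳ (β j r)) (∑<-0 b))
ν≡∑ zero (suc i) (suc b) r (s<s i<b) = trans (cong₂ _+_ twice (ν≡∑ 1 i (suc b) r (m≤n⇒m≤1+n i<b)))
  (trans (x∙yz≈y∙xz A (β 0 r * μ 1 i 0) B) (cong (β 0 r * μ 1 i 0 +_) (trans (sym (∑<-+ b _ _))
    (∑<-cong b λ j _ → sym (*-distribˡ-+ (β (suc j) r) _ _)))))
  where
  A = ∑< b λ j → β (suc j) r * μ 0 i j
  B = ∑< b λ j → β (suc j) r * μ 1 i (suc j)
  twice : 2 * partialSum (ν 0 i) r ≡ A
  twice = trans (cong (2 *_) (trans (partialSum-cong r λ r → ν≡∑ 0 i b r i<b) (partialSum-∑ b _ r)))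
    (trans (sym (∑<-*ˡ b 2 _)) (∑<-cong b λ j _ → trans
      (cong (2 *_) (trans (partialSum-cong r λ r → *-comm (β j r) (μ 0 i j))
        (trans (partialSum-* (μ 0 i j) (β j) r) (*-comm (μ 0 i j) _))))
      (trans (sym (*-assoc 2 (partialSum (β j) r) _)) (cong (_* μ 0 i j) (sym (β-suc j r))))))
ν≡∑ (suc h) (suc i) b r i<b = trans
  (cong₂ _+_ (cong₂ _+_ (ν≡∑ h i b r i<b′) (ν≡∑ (suc h) i b r i<b′)) (ν≡∑ (2 + h) i b r i<b′))
  (sym (trans (∑<-cong b λ j _ → trans (*-distribˡ-+ (β j r) _ _) (cong (_+ β j r * μ (2 + h) i j) (*-distribˡ-+ (β j r) _ _)))
    (trans (∑<-+ b _ _) (cong (_+ ∑< b (λ j → β j r * μ (2 + h) i j)) (∑<-+ b _ _)))))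
  where
  i<b′ : i < b
  i<b′ = ≤-trans (m≤n⇒m≤1+n ≤-refl) i<b

-- `S-zero` contributes one more factor `q`, so `β j` becomes `β (suc j)`.
continuations≡∑ : ∀ m r → continuations 0 0 (suc m) r ≡
  ∑< (suc m) λ i → ∑< (i + 1) λ j → β (suc j) r * μ 0 i j * compositionSum (suc i) (suc m)
continuations≡∑ m r = trans (S-zero r (suc m)) (trans
  (cong (2 *_) (trans (partialSum-cong r λ r → K≡∑ (suc m) (suc m) ≤-refl 0 r)
    (partialSum-∑ (suc m) (λ i r → compositionSum (suc i) (suc m) * ν 0 i r) r)))
  (trans (sym (∑<-*ˡ (suc m) 2 λ i → partialSum (λ r → compositionSum (suc i) (suc m) * ν 0 i r) r))
    (∑<-cong (suc m) λ i _ → term i)))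
  where
  term : ∀ i → 2 * partialSum (λ r → compositionSum (suc i) (suc m) * ν 0 i r) r
    ≡ ∑< (i + 1) λ j → β (suc j) r * μ 0 i j * compositionSum (suc i) (suc m)
  term i = trans (cong (2 *_) (trans (partialSum-cong r λ r → trans (cong (c *_) (ν≡∑ 0 i (i + 1) r (ℕ.m<m+n i z<s)))
        (sym (∑<-*ˡ (i + 1) c _))) (partialSum-∑ (i + 1) _ r)))
    (trans (sym (∑<-*ˡ (i + 1) 2 _)) (∑<-cong (i + 1) λ j _ → trans
      (cong (2 *_) (trans (partialSum-cong r λ r → solve 3 (λ c b m → c :* (b :* m) := (m :* c) :* b) refl c (β j r) (μ 0 i j))
        (partialSum-* (μ 0 i j * c) (β j) r)))
      (trans (solve 3 (λ m c p → con 2 :* ((m :* c) :* p) := ((con 2 :* p) :* m) :* c) refl (μ 0 i j) c (partialSum (β j) r))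
        (cong (λ a → a * μ 0 i j * c) (sym (β-suc j r))))))
    where
    open +-*-Solver
    c = compositionSum (suc i) (suc m)

-- Catalan numbers, Motzkin paths and compositions

absorption : ∀ a k → suc k * ((a + k) C suc k) ≡ a * ((a + k) C k)
absorption zero k = trans (cong (suc k *_) (k>n⇒nCk≡0 (ℕ.n<1+n k))) (*-zeroʳ (suc k))
absorption (suc a) k = trans (cong (suc k *_) (sym (nCk+nC[k+1]≡[n+1]C[k+1] (a + k) k)))
  (trans (*-distribˡ-+ (suc k) ((a + k) C k) _) (trans (cong (suc k * ((a + k) C k) +_) (absorption a k)) (rest k)))
  where
  open +-*-Solver
  rest : ∀ k → suc k * ((a + k) C k) + a * ((a + k) C k) ≡ suc a * (suc (a + k) C k)
  rest zero = solve 1 (λ a → (con 1 :* con 1) :+ (a :* con 1) := (con 1 :+ a) :* con 1) refl a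
  rest (suc k) = trans
    (solve 3 (λ a k x → (con 2 :+ k) :* x :+ a :* x := (con 1 :+ k) :* x :+ (con 1 :+ a) :* x) refl a k ((a + suc k) C suc k))
    (trans (cong (_+ suc a * ((a + suc k) C suc k)) lower)
      (trans (sym (*-distribˡ-+ (suc a) ((a + suc k) C k) _)) (cong (suc a *_) (nCk+nC[k+1]≡[n+1]C[k+1] (a + suc k) k))))
    where
    lower : suc k * ((a + suc k) C suc k) ≡ suc a * ((a + suc k) C k)
    lower rewrite ℕ.+-suc a k = absorption (suc a) k

-- The ballot numbers as a difference of two binomial coefficients, written without subtraction. The
-- case `s = 0` is the symmetry of binomials; the recurrence in `s` is Pascal's rule.
catalanPower-ballot : ∀ s n → catalanPower s (suc n) + (n + n + suc s) C n ≡ (n + n + suc s) C suc n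
catalanPower-ballot zero n = trans (nCk≡nC[n∸k] n≤) (cong ((n + n + 1) C_) eq)
  where
  n≤ : n ≤ n + n + 1
  n≤ = ≤-trans (ℕ.m≤m+n n n) (ℕ.m≤m+n (n + n) 1)
  eq : n + n + 1 ∸ n ≡ suc n
  eq = trans (cong (_∸ n) (trans (+-assoc n n 1) (cong (n +_) (+-comm n 1)))) (ℕ.m+n∸m≡n n (suc n))
catalanPower-ballot (suc s) zero = trans
  (solve 1 (λ x → (x :+ con 1) :+ con 1 := con 1 :+ (x :+ con 1)) refl (catalanPower s 1))
  (trans (cong suc (catalanPower-ballot s 0)) (nCk+nC[k+1]≡[n+1]C[k+1] (suc s) 0))
  where open +-*-Solver
catalanPower-ballot (suc s) (suc n) = begin
  (a + b) + (suc n + suc n + suc (suc s)) C suc n  ≡⟨ cong (λ M → (a + b) + M C suc n) M-suc ⟩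
  (a + b) + suc M C suc n                          ≡⟨ cong ((a + b) +_) (nCk+nC[k+1]≡[n+1]C[k+1] M n) ⟨
  (a + b) + (M C n + M C suc n)                    ≡⟨ solve 4 (λ a b x y → (a :+ b) :+ (x :+ y) := (b :+ x) :+ (a :+ y)) refl a b (M C n) (M C suc n) ⟩
  (b + M C n) + (a + M C suc n)                    ≡⟨ cong₂ _+_ ballot-b (catalanPower-ballot s (suc n)) ⟩
  M C suc n + M C suc (suc n)                      ≡⟨ nCk+nC[k+1]≡[n+1]C[k+1] M (suc n) ⟩
  suc M C suc (suc n)                              ≡⟨ cong (_C suc (suc n)) M-suc ⟨
  (suc n + suc n + suc (suc s)) C suc (suc n)      ∎
  where
  open ≡-Reasoning
  open +-*-Solver
  a = catalanPower s (suc (suc n))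
  b = catalanPower (2 + s) (suc n)
  M = suc n + suc n + suc s
  M-suc : suc n + suc n + suc (suc s) ≡ suc M
  M-suc = ℕ.+-suc (suc n + suc n) (suc s)
  ballot-b : b + M C n ≡ M C suc n
  ballot-b = subst (λ M → b + M C n ≡ M C suc n)
    (solve 2 (λ n s → n :+ n :+ (con 3 :+ s) := con 1 :+ n :+ (con 1 :+ n) :+ (con 1 :+ s)) refl n s) (catalanPower-ballot (2 + s) n)

-- The ballot formula at `s = 1`, together with `absorption`, writes the central binomial
-- coefficient as an exact multiple of `suc n`.
catalan≡power : ∀ n → Catalan n ≡ catalanPower 1 n
catalan≡power n = trans (cong (_/ suc n) (central n)) (m*n/n≡m (catalanPower 1 n) (suc n))
  where
  open +-*-Solver
  central : ∀ n → (2 * n) C n ≡ catalanPower 1 n * suc n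
  central zero = refl
  central (suc n) = ℕ.+-cancelʳ-≡ (suc n * x) _ _ (begin
    x + suc n * x                        ≡⟨⟩
    suc (suc n) * x                      ≡⟨ cong (suc (suc n) *_) (sym ballot) ⟩
    suc (suc n) * (c + y)                ≡⟨ *-distribˡ-+ (suc (suc n)) c y ⟩
    suc (suc n) * c + suc (suc n) * y    ≡⟨ cong₂ _+_ (*-comm (suc (suc n)) c) (sym absorb) ⟩
    c * suc (suc n) + suc n * x          ∎)
    where
    open ≡-Reasoning
    c = catalanPower 1 (suc n)
    x = (2 * suc n) C suc n
    y = (2 * suc n) C n
    ballot : c + y ≡ x
    ballot = subst (λ M → c + M C n ≡ M C suc n)
      (solve 1 (λ n → n :+ n :+ con 2 := con 2 :* (con 1 :+ n)) refl n) (catalanPower-ballot 1 n)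
    absorb : suc n * x ≡ suc (suc n) * y
    absorb = subst (λ M → suc n * (M C suc n) ≡ suc (suc n) * (M C n))
      (solve 1 (λ n → con 2 :+ n :+ n := con 2 :* (con 1 :+ n)) refl n) (absorption (suc (suc n)) n)

sum-map-upTo : ∀ n f → sum (map f (upTo n)) ≡ ∑< n f
sum-map-upTo n f = trans (cong sum (map-upTo f n)) (go n f)
  where
  go : ∀ n f → sum (applyUpTo f n) ≡ ∑< n f
  go zero    f = refl
  go (suc n) f = cong (f 0 +_) (go n (f ∘ suc))

module _ {A : Set} {P Q : Pred (List A) 0ℓ} (P? : Decidable P) (Q? : Decidable Q) where

  length-filter-prefix : ∀ a → (∀ w → P (a ∷ w) ⇔ Q w) → ∀ ws →
    length (filter P? (map (a ∷_) ws)) ≡ length (filter Q? ws)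
  length-filter-prefix a P⇔Q [] = refl
  length-filter-prefix a P⇔Q (w ∷ ws) with P? (a ∷ w) | Q? w
  ... | yes _ | yes _ = cong suc (length-filter-prefix a P⇔Q ws)
  ... | no _  | no _  = length-filter-prefix a P⇔Q ws
  ... | yes p | no ¬q = contradiction (Equivalence.to (P⇔Q w) p) ¬q
  ... | no ¬p | yes q = contradiction (Equivalence.from (P⇔Q w) q) ¬p

module _ {P Q : Pred (List ℕ) 0ℓ} (P? : Decidable P) (Q? : Decidable Q) (φ : ℕ → ℕ) where

  weight : List ℕ → ℕ
  weight xs = product (map φ xs)

  sum-filter-prefix : ∀ a → (∀ w → P (a ∷ w) ⇔ Q w) → ∀ ws →
    sum (map weight (filter P? (map (a ∷_) ws))) ≡ φ a * sum (map weight (filter Q? ws))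
  sum-filter-prefix a P⇔Q [] = sym (*-zeroʳ (φ a))
  sum-filter-prefix a P⇔Q (w ∷ ws) with P? (a ∷ w) | Q? w
  ... | yes _ | yes _ = trans (cong (φ a * weight w +_) (sum-filter-prefix a P⇔Q ws)) (sym (*-distribˡ-+ (φ a) _ _))
  ... | no _  | no _  = sum-filter-prefix a P⇔Q ws
  ... | yes p | no ¬q = contradiction (Equivalence.to (P⇔Q w) p) ¬q
  ... | no ¬p | yes q = contradiction (Equivalence.from (P⇔Q w) q) ¬p

filter-prefix-none : ∀ {A : Set} {P : Pred (List A) 0ℓ} (P? : Decidable P) a → (∀ w → ¬ P (a ∷ w)) → ∀ ws →
  filter P? (map (a ∷_) ws) ≡ []
filter-prefix-none P? a ¬P [] = refl
filter-prefix-none P? a ¬P (w ∷ ws) with P? (a ∷ w)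
... | yes p = contradiction p (¬P w)
... | no _  = filter-prefix-none P? a ¬P ws

-- An arbitrary starting height lets the first step be removed.
IsMotzkinFrom : ℤ → ℕ → Pred (List Step) 0ℓ
IsMotzkinFrom h j ss = (All (0ℤ ℤ.≤_) (startHeights h ss) × endHeight h ss ≡ 0ℤ)
  × length (filter (λ (s , h) → flat? s ×-dec (h ℤ.≟ 0ℤ)) (zip ss (startHeights h ss))) ≡ j

isMotzkinFrom? : ∀ h j → Decidable (IsMotzkinFrom h j)
isMotzkinFrom? h j ss =
  (All.all? (0ℤ ℤ.≤?_) (startHeights h ss) ×-dec (endHeight h ss ℤ.≟ 0ℤ)) ×-dec (_ ℕ.≟ j)

steps : List Step
steps = up ∷ down ∷ flat ∷ []

motzkinFrom : ℤ → ℕ → ℕ → ℕ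
motzkinFrom h k j = length (filter (isMotzkinFrom? h j) (words steps k))

¬motzkin-below : ∀ n j ss → ¬ IsMotzkinFrom -[1+ n ] j ss
¬motzkin-below n j [] ((_ , ()) , _)
¬motzkin-below n j (_ ∷ _) ((() ∷ _ , _) , _)

motzkinFrom-suc : ∀ h k j → let F = λ s → length (filter (isMotzkinFrom? h j) (map (s ∷_) (words steps k))) in
  motzkinFrom h (suc k) j ≡ F up + (F down + F flat)
motzkinFrom-suc h k j = trans (split up _) (cong (F up +_) (trans (split down _)
  (cong (F down +_) (trans (split flat []) (+-identityʳ (F flat))))))
  where
  F : Step → ℕ
  F s = length (filter (isMotzkinFrom? h j) (map (s ∷_) (words steps k)))
  split : ∀ s ys → length (filter (isMotzkinFrom? h j) (map (s ∷_) (words steps k) ++ ys))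
    ≡ F s + length (filter (isMotzkinFrom? h j) ys)
  split s ys = trans (cong length (filter-++ (isMotzkinFrom? h j) (map (s ∷_) (words steps k)) ys))
    (length-++ (filter (isMotzkinFrom? h j) (map (s ∷_) (words steps k))))

motzkinFrom≡μ : ∀ k h j → motzkinFrom (ℤ.+ h) k j ≡ μ h k j
motzkinFrom≡μ zero zero zero = refl
motzkinFrom≡μ zero zero (suc j) = refl
motzkinFrom≡μ zero (suc h) j = refl
motzkinFrom≡μ (suc k) h j = trans (motzkinFrom-suc (ℤ.+ h) k j) (trans (cong (_+ (F h j down + F h j flat))
    (trans (length-filter-prefix _ (isMotzkinFrom? (ℤ.+ suc h) j) up up⇔ ws) (motzkinFrom≡μ k (suc h) j))) (rest h j))
  where
  open +-*-Solver
  ws = words steps k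
  F : ℕ → ℕ → Step → ℕ
  F h j s = length (filter (isMotzkinFrom? (ℤ.+ h) j) (map (s ∷_) ws))
  up⇔ : ∀ w → IsMotzkinFrom (ℤ.+ h) j (up ∷ w) ⇔ IsMotzkinFrom (ℤ.+ suc h) j w
  up⇔ w rewrite +-comm h 1 = mk⇔ (λ { ((_ ∷ p , e) , n) → (p , e) , n }) (λ ((p , e) , n) → (ℤ.+≤+ z≤n ∷ p , e) , n)
  flat⁺⇔ : ∀ h j w → IsMotzkinFrom (ℤ.+ suc h) j (flat ∷ w) ⇔ IsMotzkinFrom (ℤ.+ suc h) j w
  flat⁺⇔ h j w rewrite +-identityʳ h =
    mk⇔ (λ { ((_ ∷ p , e) , n) → (p , e) , n }) (λ ((p , e) , n) → (ℤ.+≤+ z≤n ∷ p , e) , n)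
  flat⁰⇔ : ∀ j w → IsMotzkinFrom (ℤ.+ 0) (suc j) (flat ∷ w) ⇔ IsMotzkinFrom (ℤ.+ 0) j w
  flat⁰⇔ j w =
    mk⇔ (λ { ((_ ∷ p , e) , n) → (p , e) , ℕ.suc-injective n }) (λ ((p , e) , n) → (ℤ.+≤+ z≤n ∷ p , e) , cong suc n)
  down⇔ : ∀ h j w → IsMotzkinFrom (ℤ.+ suc h) j (down ∷ w) ⇔ IsMotzkinFrom (ℤ.+ h) j w
  down⇔ h j w = mk⇔ (λ { ((_ ∷ p , e) , n) → (p , e) , n }) (λ ((p , e) , n) → (ℤ.+≤+ z≤n ∷ p , e) , n)
  F-down-0 : ∀ j → F 0 j down ≡ 0
  F-down-0 j = cong length (filter-prefix-none (isMotzkinFrom? (ℤ.+ 0) j) down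
    (λ { w ((_ ∷ p , e) , n) → ¬motzkin-below 0 j w ((p , e) , n) }) ws)
  rest : ∀ h j → μ (suc h) k j + (F h j down + F h j flat) ≡ μ h (suc k) j
  rest zero zero = trans (cong (μ 1 k 0 +_) (cong₂ _+_ (F-down-0 0) (cong length
    (filter-prefix-none (isMotzkinFrom? (ℤ.+ 0) 0) flat (λ { w (_ , ()) }) ws)))) (+-identityʳ _)
  rest zero (suc j) = trans (cong (μ 1 k (suc j) +_) (cong₂ _+_ (F-down-0 (suc j))
    (trans (length-filter-prefix _ (isMotzkinFrom? (ℤ.+ 0) j) flat (flat⁰⇔ j) ws) (motzkinFrom≡μ k 0 j))))
    (+-comm (μ 1 k (suc j)) (μ 0 k j))
  rest (suc h) j = trans (cong (μ (2 + h) k j +_) (cong₂ _+_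
    (trans (length-filter-prefix _ (isMotzkinFrom? (ℤ.+ h) j) down (down⇔ h j) ws) (motzkinFrom≡μ k h j))
    (trans (length-filter-prefix _ (isMotzkinFrom? (ℤ.+ suc h) j) flat (flat⁺⇔ h j) ws) (motzkinFrom≡μ k (suc h) j))))
    (+-comm (μ (2 + h) k j) _)

Motzkin≡μ : ∀ k j → Motzkin k j ≡ μ 0 k j
Motzkin≡μ k j = motzkinFrom≡μ k 0 j

conv≡∑ : ∀ b m (c g H : ℕ → ℕ) → m < b → (∀ x y → x + y ≡ m → H x ≡ c x * g y) →
  (∀ x → m < x → H x ≡ 0) → ∑< b H ≡ conv c g m
conv≡∑ (suc b) zero    c g H _ eq none = trans
  (cong₂ _+_ (eq 0 0 refl) (trans (∑<-cong b λ x _ → none (suc x) z<s) (∑<-0 b))) (+-identityʳ _)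
conv≡∑ (suc b) (suc m) c g H (s<s m<b) eq none = cong₂ _+_ (eq 0 (suc m) refl)
  (conv≡∑ b m (c ∘ suc) g (H ∘ suc) m<b (λ x y x+y≡m → eq (suc x) y (cong suc x+y≡m)) (λ x m<x → none (suc x) (s<s m<x)))

-- Separates the alphabet bound `b` from the total `m`: after removal of the first part the total
-- shrinks, but the alphabet does not.
compositionsWithin : ℕ → ℕ → ℕ → List (List ℕ)
compositionsWithin b m k = filter (isComposition? m) (words (upTo (suc b)) k)

catalanWeight : List ℕ → ℕ
catalanWeight xs = product (map Catalan xs)

compositions-suc : ∀ b m k → sum (map catalanWeight (compositionsWithin b m (suc k))) ≡
  ∑< (suc b) λ x → sum (map catalanWeight (filter (isComposition? m) (map (x ∷_) (words (upTo (suc b)) k))))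
compositions-suc b m k = trans (split (upTo (suc b))) (sum-map-upTo (suc b) _)
  where
  ws = words (upTo (suc b)) k
  G : ℕ → ℕ
  G x = sum (map catalanWeight (filter (isComposition? m) (map (x ∷_) ws)))
  split : ∀ as → sum (map catalanWeight (filter (isComposition? m) (cartesianProductWith _∷_ as ws))) ≡ sum (map G as)
  split []       = refl
  split (a ∷ as) = trans (cong (sum ∘ map catalanWeight) (filter-++ (isComposition? m) (map (a ∷_) ws) _))
    (trans (cong sum (map-++ catalanWeight (filter (isComposition? m) (map (a ∷_) ws)) _))
      (trans (sum-++ (map catalanWeight (filter (isComposition? m) (map (a ∷_) ws))) _) (cong (G a +_) (split as))))

compositionSum≡ : ∀ k b m → m ≤ b → sum (map catalanWeight (compositionsWithin b m k)) ≡ compositionSum k m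
compositionSum≡ zero b zero    _ = refl
compositionSum≡ zero b (suc m) _ = refl
compositionSum≡ (suc k) b m m≤b = trans (compositions-suc b m k)
  (trans (cong (_+ ∑< b (G m ∘ suc)) (none m 0 λ { w (() ∷ _ , _) })) (tail m m≤b))
  where
  ws = words (upTo (suc b)) k
  G : ℕ → ℕ → ℕ
  G m x = sum (map catalanWeight (filter (isComposition? m) (map (x ∷_) ws)))
  none : ∀ m x → (∀ w → ¬ IsComposition m (x ∷ w)) → G m x ≡ 0
  none m x ¬P = cong (sum ∘ map catalanWeight) (filter-prefix-none (isComposition? m) x ¬P ws)
  tail : ∀ m → m ≤ b → ∑< b (G m ∘ suc) ≡ D (compositionSum k) m
  tail zero _ = trans (∑<-cong b λ x _ → none 0 (suc x) λ { w (_ , ()) }) (∑<-0 b)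
  tail (suc m) m<b = conv≡∑ b m (catalanPower 2) (compositionSum k) (G (suc m) ∘ suc) m<b
    (λ x y x+y≡m → trans
      (sum-filter-prefix (isComposition? (suc m)) (isComposition? y) Catalan (suc x) (λ w → mk⇔
        (λ { (_ ∷ p , e) → p , ℕ.+-cancelˡ-≡ (suc x) _ _ (trans e (cong suc (sym x+y≡m))) })
        (λ (p , e) → z<s ∷ p , trans (cong (suc x +_) e) (cong suc x+y≡m))) ws)
      -- The coefficient needed is `catalanPower 2 x`, to which `catalanPower 1 (suc x)` reduces.
      (cong₂ _*_ (catalan≡power (suc x)) (compositionSum≡ k b y
        (≤-trans (subst (y ≤_) x+y≡m (ℕ.m≤n+m y x)) (ℕ.<⇒≤ m<b)))))
    (λ x m<x → none (suc m) (suc x) λ { w (_ , e) →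
      <⇒≱ m<x (subst (x ≤_) (ℕ.suc-injective e) (ℕ.m≤m+n x _)) })

formula : ∀ m r →
  ∑[ 1 ⋯ suc m ] (λ k → ∑[ 2 ⋯ k + 1 ] (λ ℓ →
    2 ^ (ℓ ∸ 1) * ((r + ℓ ∸ 1) C r) * Motzkin (k ∸ 1) (ℓ ∸ 2)
      * sum (map (λ xs → product (map Catalan xs)) (compositions (suc m) k))))
  ≡ continuations 0 0 (suc m) r
formula m r = trans (sum-map-upTo (suc m) _) (trans
  (∑<-cong (suc m) λ i _ → trans (sum-map-upTo (i + 1) _) (∑<-cong (i + 1) λ j _ →
    cong₂ _*_ (cong₂ _*_ (cong (λ a → 2 ^ suc j * (a C r)) (cong (_∸ 1) (ℕ.+-suc r (suc j)))) (Motzkin≡μ i j))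
      (compositionSum≡ (suc i) (suc m) (suc m) ≤-refl)))
  (sym (continuations≡∑ m r)))

-- Enumeration of the words

data Child (w : Word) : Word → Set where
  turn   : Child w (turn ∷ w)
  block  : ∀ {c} → c ≤ blocks w → Child w (block c ∷ w)
  extend : ∀ {j} → j < extensions w → Child w (extend j ∷ w)

withChildren : Word → (Word → List Word) → List Word
withChildren w E = E (turn ∷ w) ++
  (concatMap (λ c → E (block c ∷ w)) (upTo (suc (blocks w))) ++
   concatMap (λ j → E (extend j ∷ w)) (upTo (extensions w)))

-- Follows the recursion of `continuations` clause by clause, so that the length is that number.
extendedWords : Word → ℕ → ℕ → List Word
extendedWords w zero    zero    = w ∷ []
extendedWords w zero    (suc r) = extendedWords (fixed ∷ w) zero r
extendedWords w (suc m) zero    = withChildren w λ w → extendedWords w m zero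
extendedWords w (suc m) (suc r) =
  extendedWords (fixed ∷ w) (suc m) r ++ withChildren w λ w → extendedWords w m (suc r)

length-concatMap-upTo : ∀ {A : Set} n (f : ℕ → List A) →
  length (concatMap f (upTo n)) ≡ ∑< n (length ∘ f)
length-concatMap-upTo n f = trans (cong (length ∘ concat) (List.map-upTo f n)) (go n f)
  where
  go : ∀ n f → length (concat (applyUpTo f n)) ≡ ∑< n (length ∘ f)
  go zero    f = refl
  go (suc n) f = trans (length-++ (f 0)) (cong (length (f 0) +_) (go n (f ∘ suc)))

length-extendedWords : ∀ w m r →
  length (extendedWords w m r) ≡ continuations (blocks w) (extensions w) m r
length-withChildren : ∀ w m r → length (withChildren w λ w → extendedWords w m r) ≡
  children (blocks w) (extensions w) (λ s t → continuations s t m r)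
length-withChildren w m r = trans (length-++ (extendedWords (turn ∷ w) m r)) (cong₂ _+_
  (length-extendedWords (turn ∷ w) m r)
  (trans (length-++ (concatMap (λ c → extendedWords (block c ∷ w) m r) (upTo (suc (blocks w))))) (cong₂ _+_
    (trans (length-concatMap-upTo (suc (blocks w)) λ c → extendedWords (block c ∷ w) m r)
      (∑<-cong (suc (blocks w)) λ c _ → length-extendedWords (block c ∷ w) m r))
    (trans (length-concatMap-upTo (extensions w) λ j → extendedWords (extend j ∷ w) m r)
      (∑<-cong (extensions w) λ j _ → length-extendedWords (extend j ∷ w) m r)))))
length-extendedWords w zero    zero    = refl
length-extendedWords w zero    (suc r) = length-extendedWords (fixed ∷ w) zero r
length-extendedWords w (suc m) zero    = length-withChildren w m zero
length-extendedWords w (suc m) (suc r) = trans (length-++ (extendedWords (fixed ∷ w) (suc m) r))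
  (cong₂ _+_ (length-extendedWords (fixed ∷ w) (suc m) r) (length-withChildren w m (suc r)))

data Extends (w : Word) : ℕ → ℕ → Word → Set where
  done       : Extends w 0 0 w
  grow-fixed : ∀ {m r v} → Extends (fixed ∷ w) m r v → Extends w m (suc r) v
  grow-cycle : ∀ {w′ m r v} → Child w w′ → Extends w′ m r v → Extends w (suc m) r v

∈-concatMap-upTo⁺ : ∀ {A : Set} n (f : ℕ → List A) {i v} → i < n → v ∈ f i → v ∈ concatMap f (upTo n)
∈-concatMap-upTo⁺ n f i<n v∈ = ∈-concatMap⁺ f (lose (∈-upTo⁺ i<n) v∈)

∈-concatMap-upTo⁻ : ∀ {A : Set} n (f : ℕ → List A) {v} → v ∈ concatMap f (upTo n) → ∃[ i ] i < n × v ∈ f i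
∈-concatMap-upTo⁻ n f v∈ = let i , i∈ , v∈fi = find (∈-concatMap⁻ f {xs = upTo n} v∈) in i , ∈-upTo⁻ i∈ , v∈fi

module _ (w : Word) (E : Word → List Word) where
  private
    Eb Ee : ℕ → List Word
    Eb c = E (block c ∷ w)
    Ee j = E (extend j ∷ w)

  ∈-withChildren⁺ : ∀ {w′ v} → Child w w′ → v ∈ E w′ → v ∈ withChildren w E
  ∈-withChildren⁺ turn         v∈ = ∈-++⁺ˡ v∈
  ∈-withChildren⁺ (block c≤s)  v∈ = ∈-++⁺ʳ (E (turn ∷ w)) (∈-++⁺ˡ (∈-concatMap-upTo⁺ _ Eb (s≤s c≤s) v∈))
  ∈-withChildren⁺ (extend j<t) v∈ = ∈-++⁺ʳ (E (turn ∷ w))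
    (∈-++⁺ʳ (concatMap Eb (upTo (suc (blocks w)))) (∈-concatMap-upTo⁺ _ Ee j<t v∈))

  ∈-withChildren⁻ : ∀ {v} → v ∈ withChildren w E → ∃[ w′ ] Child w w′ × v ∈ E w′
  ∈-withChildren⁻ v∈ with ∈-++⁻ (E (turn ∷ w)) v∈
  ... | inj₁ v∈t = _ , turn , v∈t
  ... | inj₂ v∈r with ∈-++⁻ (concatMap Eb (upTo (suc (blocks w)))) v∈r
  ... | inj₁ v∈b = let c , c<n , v∈c = ∈-concatMap-upTo⁻ _ Eb v∈b in _ , block (s≤s⁻¹ c<n) , v∈c
  ... | inj₂ v∈e = let j , j<n , v∈j = ∈-concatMap-upTo⁻ _ Ee v∈e in _ , extend j<n , v∈j

∈-extendedWords⁺ : ∀ {w m r v} → Extends w m r v → v ∈ extendedWords w m r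
∈-extendedWords⁺ done = here refl
∈-extendedWords⁺ {m = zero}  (grow-fixed ext) = ∈-extendedWords⁺ ext
∈-extendedWords⁺ {m = suc m} (grow-fixed ext) = ∈-++⁺ˡ (∈-extendedWords⁺ ext)
∈-extendedWords⁺ {w} {suc m} {zero} (grow-cycle child ext) =
  ∈-withChildren⁺ w (λ w → extendedWords w m zero) child (∈-extendedWords⁺ ext)
∈-extendedWords⁺ {w} {suc m} {suc r} (grow-cycle child ext) = ∈-++⁺ʳ (extendedWords (fixed ∷ w) (suc m) r)
  (∈-withChildren⁺ w (λ w → extendedWords w m (suc r)) child (∈-extendedWords⁺ ext))

∈-extendedWords⁻ : ∀ w m r {v} → v ∈ extendedWords w m r → Extends w m r v
∈-extendedWords⁻ w zero    zero    (here refl) = done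
∈-extendedWords⁻ w zero    (suc r) v∈ = grow-fixed (∈-extendedWords⁻ (fixed ∷ w) zero r v∈)
∈-extendedWords⁻ w (suc m) zero    v∈ =
  let w′ , child , v∈′ = ∈-withChildren⁻ w (λ w → extendedWords w m zero) v∈
  in grow-cycle child (∈-extendedWords⁻ w′ m zero v∈′)
∈-extendedWords⁻ w (suc m) (suc r) v∈ =
  [ (λ v∈f → grow-fixed (∈-extendedWords⁻ (fixed ∷ w) (suc m) r v∈f))
  , (λ v∈c → let w′ , child , v∈′ = ∈-withChildren⁻ w (λ w → extendedWords w m (suc r)) v∈c
             in grow-cycle child (∈-extendedWords⁻ w′ m (suc r) v∈′))
  ]′ (∈-++⁻ (extendedWords (fixed ∷ w) (suc m) r) v∈)

extends-suffix : ∀ {w m r v} → Extends w m r v → ∃[ u ] v ≡ u ++ w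
extends-suffix done = [] , refl
extends-suffix {w} (grow-fixed ext) with extends-suffix ext
... | u , refl = u ∷ʳ fixed , sym (++-assoc u (fixed ∷ []) w)
extends-suffix {w} (grow-cycle turn ext) with extends-suffix ext
... | u , refl = u ∷ʳ turn , sym (++-assoc u (turn ∷ []) w)
extends-suffix {w} (grow-cycle (block {c} _) ext) with extends-suffix ext
... | u , refl = u ∷ʳ block c , sym (++-assoc u (block c ∷ []) w)
extends-suffix {w} (grow-cycle (extend {j} _) ext) with extends-suffix ext
... | u , refl = u ∷ʳ extend j , sym (++-assoc u (extend j ∷ []) w)

-- All these words end in `w`, and the letter just before this suffix tells the two lists apart.
extendedWords-disjoint : ∀ {w ℓ ℓ′ m r m′ r′} → ℓ ≢ ℓ′ →
  Disjoint (extendedWords (ℓ ∷ w) m r) (extendedWords (ℓ′ ∷ w) m′ r′)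
extendedWords-disjoint {w} {ℓ} {ℓ′} {m} {r} {m′} {r′} ℓ≢ℓ′ (v∈ , v∈′)
  with extends-suffix (∈-extendedWords⁻ (ℓ ∷ w) m r v∈) | extends-suffix (∈-extendedWords⁻ (ℓ′ ∷ w) m′ r′ v∈′)
... | u , refl | u′ , eq = ℓ≢ℓ′ (∷ʳ-injectiveʳ u u′ (++-cancelʳ w (u ∷ʳ ℓ) (u′ ∷ʳ ℓ′)
  (trans (++-assoc u (ℓ ∷ []) w) (trans eq (sym (++-assoc u′ (ℓ′ ∷ []) w))))))

concatMap-unique : ∀ {A : Set} n (f : ℕ → List A) → (∀ i → Unique (f i)) →
  (∀ {i j} → i ≢ j → Disjoint (f i) (f j)) → Unique (concatMap f (upTo n))
concatMap-unique n f uniq disj = Unique.concat⁺ (All.map⁺ (All.tabulate λ {i} _ → uniq i))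
  (AllPairs.map⁺ (AllPairs.map disj (Unique.upTo⁺ n)))

withChildren-unique : ∀ w m r → (∀ w → Unique (extendedWords w m r)) → Unique (withChildren w λ w → extendedWords w m r)
withChildren-unique w m r uniq = Unique.++⁺ (uniq (turn ∷ w))
  (Unique.++⁺
    (concatMap-unique (suc (blocks w)) Eb (λ c → uniq (block c ∷ w)) (λ c≢d → disjoint λ { refl → c≢d refl }))
    (concatMap-unique (extensions w) Ee (λ j → uniq (extend j ∷ w)) (λ i≢j → disjoint λ { refl → i≢j refl }))
    λ (v∈b , v∈e) → let c , _ , v∈c = ∈-concatMap-upTo⁻ (suc (blocks w)) Eb v∈b
                        j , _ , v∈j = ∈-concatMap-upTo⁻ (extensions w) Ee v∈e
                    in disjoint {block c} {extend j} (λ ()) (v∈c , v∈j))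
  λ (v∈t , v∈) → turn-disjoint v∈t (∈-++⁻ (concatMap Eb (upTo (suc (blocks w)))) v∈)
  where
  Eb Ee : ℕ → List Word
  Eb c = extendedWords (block c ∷ w) m r
  Ee j = extendedWords (extend j ∷ w) m r
  disjoint : ∀ {ℓ ℓ′} → ℓ ≢ ℓ′ → Disjoint (extendedWords (ℓ ∷ w) m r) (extendedWords (ℓ′ ∷ w) m r)
  disjoint = extendedWords-disjoint {w} {m = m} {r} {m} {r}
  turn-disjoint : ∀ {v} → v ∈ extendedWords (turn ∷ w) m r → _ ⊎ _ → ⊥
  turn-disjoint v∈t (inj₁ v∈) =
    let c , _ , v∈c = ∈-concatMap-upTo⁻ (suc (blocks w)) Eb v∈ in disjoint {turn} {block c} (λ ()) (v∈t , v∈c)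
  turn-disjoint v∈t (inj₂ v∈) =
    let j , _ , v∈j = ∈-concatMap-upTo⁻ (extensions w) Ee v∈ in disjoint {turn} {extend j} (λ ()) (v∈t , v∈j)

extendedWords-unique : ∀ w m r → Unique (extendedWords w m r)
extendedWords-unique w zero    zero    = [] ∷ []
extendedWords-unique w zero    (suc r) = extendedWords-unique (fixed ∷ w) zero r
extendedWords-unique w (suc m) zero    = withChildren-unique w m zero λ w → extendedWords-unique w m zero
extendedWords-unique w (suc m) (suc r) = Unique.++⁺ (extendedWords-unique (fixed ∷ w) (suc m) r)
  (withChildren-unique w m (suc r) λ w → extendedWords-unique w m (suc r))
  λ (v∈f , v∈) → disj v∈f (∈-withChildren⁻ w (λ w → extendedWords w m (suc r)) v∈)
  where
  disj : ∀ {v} → v ∈ extendedWords (fixed ∷ w) (suc m) r → ∃[ w′ ] Child w w′ × v ∈ extendedWords w′ m (suc r) → ⊥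
  disj v∈f (_ , turn , v∈)            = extendedWords-disjoint {w} {m = suc m} {r} {m} {suc r} (λ ()) (v∈f , v∈)
  disj v∈f (_ , block {c} _ , v∈)     = extendedWords-disjoint {w} {m = suc m} {r} {m} {suc r} (λ ()) (v∈f , v∈)
  disj v∈f (_ , extend {j} _ , v∈)    = extendedWords-disjoint {w} {m = suc m} {r} {m} {suc r} (λ ()) (v∈f , v∈)

fixedPoints cycles : Word → ℕ
fixedPoints []          = 0
fixedPoints (fixed ∷ w) = suc (fixedPoints w)
fixedPoints (_ ∷ w)     = fixedPoints w
cycles []          = 0
cycles (fixed ∷ w) = cycles w
cycles (_ ∷ w)     = suc (cycles w)

extends-fixed : ∀ {w m r v} → Extends w m r v → Extends w m (suc r) (fixed ∷ v)
extends-fixed done                   = grow-fixed done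
extends-fixed (grow-fixed ext)       = grow-fixed (extends-fixed ext)
extends-fixed (grow-cycle child ext) = grow-cycle child (extends-fixed ext)

extends-cycle : ∀ {w m r v v′} → Extends w m r v → Child v v′ → Extends w (suc m) r v′
extends-cycle done                   child′ = grow-cycle child′ done
extends-cycle (grow-fixed ext)       child′ = grow-fixed (extends-cycle ext child′)
extends-cycle (grow-cycle child ext) child′ = grow-cycle child (extends-cycle ext child′)

legal⇒extends : ∀ {v} → Legal v → Extends [] (cycles v) (fixedPoints v) v
legal⇒extends empty          = done
legal⇒extends (fixed L)      = extends-fixed (legal⇒extends L)
legal⇒extends (turn L)       = extends-cycle (legal⇒extends L) turn
legal⇒extends (block c≤s L)  = extends-cycle (legal⇒extends L) (block c≤s)
legal⇒extends (extend j<t L) = extends-cycle (legal⇒extends L) (extend j<t)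

child-legal : ∀ {w w′} → Child w w′ → Legal w →
  Legal w′ × cycles w′ ≡ suc (cycles w) × fixedPoints w′ ≡ fixedPoints w
child-legal turn         L = turn L , refl , refl
child-legal (block c≤s)  L = block c≤s L , refl , refl
child-legal (extend j<t) L = extend j<t L , refl , refl

extends-legal : ∀ {w m r v} → Extends w m r v → Legal w →
  Legal v × cycles v ≡ m + cycles w × fixedPoints v ≡ r + fixedPoints w
extends-legal done L = L , refl , refl
extends-legal (grow-fixed ext) L with extends-legal ext (fixed L)
... | L′ , c , f = L′ , c , trans f (ℕ.+-suc _ _)
extends-legal {m = suc m} (grow-cycle child ext) L with child-legal child L
... | L′ , c′ , f′ with extends-legal ext L′
... | L″ , c , f = L″ , trans c (trans (cong (m +_) c′) (ℕ.+-suc m _)) , trans f (cong (_ +_) f′)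

size-+3 : ∀ w → size w ≡ 3 * cycles w + fixedPoints w → 3 + size w ≡ 3 * suc (cycles w) + fixedPoints w
size-+3 w eq = trans (cong (3 +_) eq)
  (solve 2 (λ c f → con 3 :+ (con 3 :* c :+ f) := con 3 :* (con 1 :+ c) :+ f) refl (cycles w) (fixedPoints w))
  where open +-*-Solver

size≡ : ∀ w → size w ≡ 3 * cycles w + fixedPoints w
size≡ []             = refl
size≡ (fixed ∷ w)    = trans (cong suc (size≡ w)) (sym (ℕ.+-suc (3 * cycles w) _))
size≡ (turn ∷ w)     = size-+3 w (size≡ w)
size≡ (block _ ∷ w)  = size-+3 w (size≡ w)
size≡ (extend _ ∷ w) = size-+3 w (size≡ w)

enc-size : ∀ {w o} {f : Endo n} → Enc w o f → n ≡ size w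
enc-size empty                = refl
enc-size (fixed enc _)        = cong suc (enc-size enc)
enc-size (turn _ enc _)       = cong (3 +_) (enc-size enc)
enc-size (block _ enc _ _)    = cong (3 +_) (enc-size enc)
enc-size (extend _ enc _ _ _) = cong (3 +_) (enc-size enc)

lookup-injective : ∀ {A : Set} {xs : List A} → Unique xs → ∀ {i j} → lookup xs i ≡ lookup xs j → i ≡ j
lookup-injective (x∉ ∷ u) {zero}  {zero}  eq = refl
lookup-injective {xs = _ ∷ xs} (x∉ ∷ u) {zero}  {suc j} eq = contradiction eq (All.lookup x∉ (∈-lookup {xs = xs} j))
lookup-injective {xs = _ ∷ xs} (x∉ ∷ u) {suc i} {zero}  eq = contradiction (sym eq) (All.lookup x∉ (∈-lookup {xs = xs} i))
lookup-injective (x∉ ∷ u) {suc i} {suc j} eq = cong suc (lookup-injective u eq)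

-- Cycle types

data CycleOf {n} (f : Endo n) : List (Fin n) → Set where
  cycle : ∀ {c cs} → map f (c ∷ cs) ≡ cs ∷ʳ c → CycleOf f (c ∷ cs)

record CyclesOf {n} (f : Endo n) (r m : ℕ) : Set where
  constructor cyclesOf
  field
    cs   : List (List (Fin n))
    all  : All (CycleOf f) cs
    perm : concat cs ↭ allFin n
    lens : map length cs ↭ replicate r 1 ++ replicate m 3

cycle-map : ∀ {N n} {f : Endo N} {g : Endo n} (e : Fin N → Fin n) → (∀ x → g (e x) ≡ e (f x)) →
  ∀ {c} → CycleOf f c → CycleOf g (map e c)
cycle-map e comm (cycle {c} {cs} eq) = cycle (trans (sym (map-∘ (c ∷ cs)))
  (trans (map-cong comm (c ∷ cs)) (trans (map-∘ (c ∷ cs)) (trans (cong (map e) eq) (map-++ e cs (c ∷ []))))))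

map-length-map : ∀ {A B : Set} (e : A → B) cs → map length (map (map e) cs) ≡ map length cs
map-length-map e cs = trans (sym (map-∘ cs)) (map-cong (List.length-map e) cs)

unique∧complete⇒↭allFin : ∀ {xs : List (Fin n)} → Unique xs → (∀ x → x ∈ xs) → xs ↭ allFin n
unique∧complete⇒↭allFin u complete =
  ∼bag⇒↭ (unique∧set⇒bag u (Unique.allFin⁺ _) (mk⇔ (λ _ → ∈-allFin _) (λ _ → complete _)))

cycles-fixed : ∀ {N r m} {f : Endo (suc N)} {f′} → FixedInsertion f f′ → CyclesOf f′ r m → CyclesOf f (suc r) m
cycles-fixed {f = f} fix (cyclesOf cs all perm lens) = cyclesOf ((zero ∷ []) ∷ map (map suc) cs)
  (cycle (cong (_∷ []) at-zero) ∷ All.map⁺ (All.map (cycle-map suc at-suc) all))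
  (prep zero (↭-trans (↭-reflexive (concat-map cs)) (↭-trans (↭.map⁺ suc perm) (↭-reflexive (map-tabulate id suc)))))
  (prep 1 (↭-trans (↭-reflexive (map-length-map suc cs)) lens))
  where open FixedInsertion fix

module _ {N} {g : Endo (3 + N)} {g′ : Endo N} (ins : Insertion k q g g′) where
  open Insertion ins

  positions-exhaust : l ∷ t ∷ m ∷ map e (allFin N) ↭ allFin (3 + N)
  positions-exhaust = unique∧complete⇒↭allFin
    ( ((Fin.<⇒≢ t<l ∘ sym) ∷ (Fin.<⇒≢ m<l ∘ sym) ∷ all-old (λ x → Fin.<⇒≢ e<l ∘ sym))
    ∷ (Fin.<⇒≢ t<m ∷ all-old (λ x → e≢t ∘ sym))
    ∷ all-old (λ x → e≢m ∘ sym)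
    ∷ Unique.map⁺ e-injective (Unique.allFin⁺ N))
    (λ b → member (slot b))
    where
    all-old : ∀ {P : Fin (3 + N) → Set} → (∀ x → P (e x)) → All P (map e (allFin N))
    all-old Pe = All.map⁺ (All.tabulate λ {x} _ → Pe x)
    member : ∀ {b} → Slot b → b ∈ l ∷ t ∷ m ∷ map e (allFin N)
    member isL     = here refl
    member isT     = there (here refl)
    member isM     = there (there (here refl))
    member (old x) = there (there (there (∈-map⁺ e (∈-allFin x))))

orient-commute : ∀ {N n} o {g : Endo n} {g′ : Endo N} {e : Fin N → Fin n} → (∀ x → g (e x) ≡ e (g′ x)) →
  ∀ x → orient o g (e x) ≡ e (orient o g′ x)
orient-commute true  comm x = comm x
orient-commute false {g} comm x = trans (cong g (comm x)) (comm _)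

-- The new cycle is listed in the direction of `f` itself, which reads `l , t , m` or `l , m , t`
-- depending on `o`; hence the case distinction in `new`.
cycles-insertion : ∀ {N r m} o {f : Endo (3 + N)} {f′} → Cubic f → Cubic f′ →
  Insertion k q (orient o f) (orient o f′) → CyclesOf f′ r m → CyclesOf f r (suc m)
cycles-insertion {N = N} {r} {m} o {f} {f′} f³ f′³ ins (cyclesOf cs all perm lens) = cyclesOf
  ((l ∷ f l ∷ f (f l) ∷ []) ∷ map (map e) cs)
  (cycle (cong (λ x → f l ∷ f (f l) ∷ x ∷ []) (f³ l)) ∷ All.map⁺ (All.map (cycle-map e f-e) all))
  (↭-trans (new o refl) (positions-exhaust ins))
  (↭-trans (prep 3 (↭-trans (↭-reflexive (map-length-map e cs)) lens)) (↭-sym (↭.shift 3 (replicate r 1) (replicate m 3))))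
  where
  open Insertion ins using (l; e; t; g-l; g-t; g-e) renaming (m to m₀)
  f-e : ∀ x → f (e x) ≡ e (f′ x)
  f-e x = trans (sym (orient-involutive o f³ (e x)))
    (trans (orient-commute o g-e x) (cong e (orient-involutive o f′³ x)))
  olds : concat (map (map e) cs) ↭ map e (allFin N)
  olds = ↭-trans (↭-reflexive (concat-map cs)) (↭.map⁺ e perm)
  new : ∀ o′ → o ≡ o′ → l ∷ f l ∷ f (f l) ∷ concat (map (map e) cs) ↭ l ∷ t ∷ m₀ ∷ map e (allFin N)
  new true refl = ↭-trans (↭-reflexive (cong₂ (λ a b → l ∷ a ∷ b ∷ concat (map (map e) cs)) g-l (trans (cong f g-l) g-t)))
    (prep _ (prep _ (prep _ olds)))
  new false refl = ↭-trans (↭-reflexive (cong₂ (λ a b → l ∷ a ∷ b ∷ concat (map (map e) cs))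
      (trans (sym (f³ (f l))) (trans (cong (f ∘ f) g-l) g-t)) g-l))
    (prep _ (swap _ _ olds))

enc-cycles : ∀ {w o} {f : Endo n} → Enc w o f → CyclesOf f (fixedPoints w) (cycles w)
enc-cycles empty = cyclesOf [] [] ↭-refl ↭-refl
enc-cycles (fixed enc fix) = cycles-fixed fix (enc-cycles enc)
enc-cycles (turn {o = o} f³ enc ins) = cycles-insertion (not o) f³ (enc-cubic enc) ins (enc-cycles enc)
enc-cycles (block {o = o} f³ enc _ ins) = cycles-insertion o f³ (enc-cubic enc) ins (enc-cycles enc)
enc-cycles (extend {o = o} f³ enc _ _ ins) = cycles-insertion o f³ (enc-cubic enc) ins (enc-cycles enc)

lengths-1-3 : ∀ {n} r m {cs : List (List (Fin n))} → map length cs ↭ replicate r 1 ++ replicate m 3 →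
  All (λ c → length c ≡ 1 ⊎ length c ≡ 3) cs
lengths-1-3 r m lens = All.map⁻ (All-resp-↭ {P = λ i → i ≡ 1 ⊎ i ≡ 3} (↭-sym lens)
  (All.++⁺ (All.replicate⁺ r (inj₁ refl)) (All.replicate⁺ m (inj₂ refl))))

cyclesOf-cubic : ∀ {r m} {f : Endo n} → CyclesOf f r m → Cubic f
cyclesOf-cubic {r = r} {m} {f} (cyclesOf cs all perm lens) x with ∈-concat⁻′ cs (∈-resp-↭ (↭-sym perm) (∈-allFin x))
... | c , x∈c , c∈cs = go (All.lookup all c∈cs) (All.lookup (lengths-1-3 r m lens) c∈cs) x∈c
  where
  go : ∀ {c} → CycleOf f c → length c ≡ 1 ⊎ length c ≡ 3 → x ∈ c → f (f (f x)) ≡ x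
  go (cycle {cs = []} eq) _ (here refl) = trans (cong (f ∘ f) fx) (trans (cong f fx) fx)
    where fx = List.∷-injectiveˡ eq
  go (cycle {a} {b ∷ c ∷ []} eq) _ x∈ = orbit x∈
    where
    fa : f a ≡ b
    fa = List.∷-injectiveˡ eq
    fb : f b ≡ c
    fb = List.∷-injectiveˡ (List.∷-injectiveʳ eq)
    fc : f c ≡ a
    fc = List.∷-injectiveˡ (List.∷-injectiveʳ (List.∷-injectiveʳ eq))
    orbit : x ∈ a ∷ b ∷ c ∷ [] → f (f (f x)) ≡ x
    orbit (here refl)                 = trans (cong (f ∘ f) fa) (trans (cong f fb) fc)
    orbit (there (here refl))         = trans (cong (f ∘ f) fb) (trans (cong f fc) fa)
    orbit (there (there (here refl))) = trans (cong (f ∘ f) fc) (trans (cong f fa) fb)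
  go (cycle {cs = _ ∷ []} _) (inj₁ ()) _
  go (cycle {cs = _ ∷ []} _) (inj₂ ()) _
  go (cycle {cs = _ ∷ _ ∷ _ ∷ _} _) (inj₁ ()) _
  go (cycle {cs = _ ∷ _ ∷ _ ∷ _} _) (inj₂ ()) _

-- Recovers the number of 1-cycles from `f` alone, so that any two decompositions of `f` agree on
-- `r`.
fixed-count : ∀ {f : Endo n} (cs : List (List (Fin n))) → All (CycleOf f) cs →
  All (λ c → length c ≡ 1 ⊎ length c ≡ 3) cs → Unique (concat cs) →
  length (filter (λ x → f x Fin.≟ x) (concat cs)) ≡ length (filter (ℕ._≟ 1) (map length cs))
fixed-count [] [] [] [] = refl
fixed-count {f = f} (.(c ∷ []) ∷ cs) (cycle {c} {[]} eq ∷ all) (_ ∷ lens) (_ ∷ u) with f c Fin.≟ c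
... | yes _  = cong suc (fixed-count cs all lens u)
... | no f≢c = contradiction (List.∷-injectiveˡ eq) f≢c
fixed-count {f = f} (.(a ∷ b ∷ c ∷ []) ∷ cs) (cycle {a} {b ∷ c ∷ []} eq ∷ all) (_ ∷ lens)
  ((a≢b ∷ a≢c ∷ _) ∷ (b≢c ∷ _) ∷ _ ∷ u)
  = trans (cong length (trans (filter-reject fixed? a-moves) (trans (filter-reject fixed? b-moves) (filter-reject fixed? c-moves))))
      (fixed-count cs all lens u)
  where
  fixed? = λ x → f x Fin.≟ x
  a-moves : f a ≢ a
  a-moves fa = a≢b (trans (sym fa) (List.∷-injectiveˡ eq))
  b-moves : f b ≢ b
  b-moves fb = b≢c (trans (sym fb) (List.∷-injectiveˡ (List.∷-injectiveʳ eq)))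
  c-moves : f c ≢ c
  c-moves fc = a≢c (trans (sym (List.∷-injectiveˡ (List.∷-injectiveʳ (List.∷-injectiveʳ eq)))) fc)
fixed-count (.(_ ∷ _ ∷ []) ∷ cs) (cycle {_} {_ ∷ []} _ ∷ _) (inj₁ () ∷ _)
fixed-count (.(_ ∷ _ ∷ []) ∷ cs) (cycle {_} {_ ∷ []} _ ∷ _) (inj₂ () ∷ _)
fixed-count (.(_ ∷ _ ∷ _ ∷ _ ∷ _) ∷ cs) (cycle {_} {_ ∷ _ ∷ _ ∷ _} _ ∷ _) (inj₁ () ∷ _)
fixed-count (.(_ ∷ _ ∷ _ ∷ _ ∷ _) ∷ cs) (cycle {_} {_ ∷ _ ∷ _ ∷ _} _ ∷ _) (inj₂ () ∷ _)

cyclesOf-fixed : ∀ {r m} {f : Endo n} → CyclesOf f r m → length (filter (λ x → f x Fin.≟ x) (allFin n)) ≡ r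
cyclesOf-fixed {n} {r} {m} {f} (cyclesOf cs all perm lens) = trans
  (↭-length (filter-↭ (λ x → f x Fin.≟ x) (↭-sym perm)))
  (trans (fixed-count cs all (lengths-1-3 r m lens)
      (↭ₛ.Unique-resp-↭ (setoid (Fin n)) (↭⇒↭ₛ (↭-sym perm)) (Unique.allFin⁺ n)))
    (trans (↭-length (filter-↭ (ℕ._≟ 1) lens)) (ones r)))
  where
  threes : ∀ m → length (filter (ℕ._≟ 1) (replicate m 3)) ≡ 0
  threes zero    = refl
  threes (suc m) = threes m
  ones : ∀ r → length (filter (ℕ._≟ 1) (replicate r 1 ++ replicate m 3)) ≡ r
  ones zero    = threes m
  ones (suc r) = cong suc (ones r)

-- Reversing positions and values: from 132 to 213

conjugate : Endo n → Endo n
conjugate f x = opposite (f (opposite x))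

conjugate-involutive : ∀ (f : Endo n) → conjugate (conjugate f) ≗ f
conjugate-involutive f x = trans (Fin.opposite-involutive _) (cong f (Fin.opposite-involutive x))

conjugate-cong : f ≗ g → conjugate f ≗ conjugate g
conjugate-cong eq x = cong opposite (eq (opposite x))

conjugate-cubic : ∀ (f : Endo n) → Cubic f → Cubic (conjugate f)
conjugate-cubic f f³ x = trans (cong (opposite ∘ f) (Fin.opposite-involutive _))
  (trans (cong (opposite ∘ f ∘ f) (Fin.opposite-involutive _)) (trans (cong opposite (f³ _)) (Fin.opposite-involutive x)))

conjugate-commute : ∀ (f : Endo n) x → conjugate f (opposite x) ≡ opposite (f x)
conjugate-commute f x = cong (opposite ∘ f) (Fin.opposite-involutive x)

opposite-< : ∀ {x y : Fin n} → x Fin.< y → opposite y Fin.< opposite x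
opposite-< {n} {x} {y} x<y = subst₂ _<_ (sym (Fin.opposite-prop y)) (sym (Fin.opposite-prop x))
  (ℕ.∸-monoʳ-< (s<s x<y) (Fin.toℕ<n y))

opposite-↭ : map opposite (allFin n) ↭ allFin n
opposite-↭ {n} = unique∧complete⇒↭allFin
  (Unique.map⁺ (λ {x} {y} eq → trans (sym (Fin.opposite-involutive x)) (trans (cong opposite eq) (Fin.opposite-involutive y)))
    (Unique.allFin⁺ n))
  (λ x → subst (_∈ map opposite (allFin n)) (Fin.opposite-involutive x) (∈-map⁺ opposite (∈-allFin (opposite x))))

conjugate-cycles : ∀ {r m} {f : Endo n} → CyclesOf f r m → CyclesOf (conjugate f) r m
conjugate-cycles {f = f} (cyclesOf cs all perm lens) = cyclesOf (map (map opposite) cs)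
  (All.map⁺ (All.map (cycle-map opposite (conjugate-commute f)) all))
  (↭-trans (↭-reflexive (concat-map cs)) (↭-trans (↭.map⁺ opposite perm) opposite-↭))
  (↭-trans (↭-reflexive (map-length-map opposite cs)) lens)

HasType : ∀ {n} → ℕ → ℕ → Permutation′ n → Set
HasType m r π = Avoids ⟨132⟩ π × HasCycleType (replicate r 1 ++ replicate m 3) π

hasCycleType⇒cyclesOf : ∀ {r m} {π : Permutation′ n} →
  HasCycleType (replicate r 1 ++ replicate m 3) π → CyclesOf (π ⟨$⟩ʳ_) r m
hasCycleType⇒cyclesOf (cs , (all , perm) , lens) = cyclesOf cs (All.map (λ { (cycle eq) → cycle eq }) all) perm lens

cyclesOf⇒hasCycleType : ∀ {r m} {π : Permutation′ n} →
  CyclesOf (π ⟨$⟩ʳ_) r m → HasCycleType (replicate r 1 ++ replicate m 3) π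
cyclesOf⇒hasCycleType (cyclesOf cs all perm lens) = cs , (All.map (λ { (cycle eq) → cycle eq }) all , perm) , lens

avoids⇒avoiding : ∀ {π : Permutation′ n} → Avoids ⟨132⟩ π → Avoiding (conjugate (π ⟨$⟩ʳ_))
avoids⇒avoiding {n} {π} avoids {x} {y} {z} x<y y<z fy<fx fx<fz = avoids (ι , mono , order)
  where
  ι : Fin 3 → Fin n
  ι 0F = opposite z
  ι 1F = opposite y
  ι 2F = opposite x
  z<y = opposite-< y<z
  y<x = opposite-< x<y
  mono : ∀ {a b} → a Fin.< b → ι a Fin.< ι b
  mono {0F} {1F} _ = z<y
  mono {0F} {2F} _ = <-trans z<y y<x
  mono {1F} {2F} _ = y<x
  mono {1F} {1F} (s<s ())
  mono {2F} {1F} (s<s ())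
  mono {2F} {2F} (s<s (s<s ()))
  flip : ∀ {u v} → conjugate (π ⟨$⟩ʳ_) u Fin.< conjugate (π ⟨$⟩ʳ_) v →
    (π ⟨$⟩ʳ opposite v) Fin.< (π ⟨$⟩ʳ opposite u)
  flip lt = subst₂ Fin._<_ (Fin.opposite-involutive _) (Fin.opposite-involutive _) (opposite-< lt)
  02< = flip fx<fz
  21< = flip fy<fx
  01< = <-trans 02< 21<
  both : ∀ {P Q : Set} → P → Q → P ⇔ Q
  both p q = mk⇔ (λ _ → q) (λ _ → p)
  neither : ∀ {P Q : Set} → ¬ P → ¬ Q → P ⇔ Q
  neither ¬p ¬q = mk⇔ (λ p → contradiction p ¬p) (λ q → contradiction q ¬q)
  order : ∀ a b → ((⟨132⟩ ⟨$⟩ʳ a) Fin.< (⟨132⟩ ⟨$⟩ʳ b)) ⇔ ((π ⟨$⟩ʳ ι a) Fin.< (π ⟨$⟩ʳ ι b))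
  order 0F 0F = neither (<-irrefl refl) (<-irrefl refl)
  order 0F 1F = both z<s 01<
  order 0F 2F = both z<s 02<
  order 1F 0F = neither (λ ()) (ℕ.<-asym 01<)
  order 1F 1F = neither (<-irrefl refl) (<-irrefl refl)
  order 1F 2F = neither (λ { (s<s ()) }) (ℕ.<-asym 21<)
  order 2F 0F = neither (λ ()) (ℕ.<-asym 02<)
  order 2F 1F = both (s<s z<s) 21<
  order 2F 2F = neither (<-irrefl refl) (<-irrefl refl)

avoiding⇒avoids : ∀ {π : Permutation′ n} → Avoiding (conjugate (π ⟨$⟩ʳ_)) → Avoids ⟨132⟩ π
avoiding⇒avoids {π = π} av (ι , mono , order) = av (opposite-< (mono {1F} {2F} (s<s z<s))) (opposite-< (mono {0F} {1F} z<s))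
  (flip (Equivalence.to (order 2F 1F) (s<s z<s))) (flip (Equivalence.to (order 0F 2F) z<s))
  where
  flip : ∀ {i j} → (π ⟨$⟩ʳ i) Fin.< (π ⟨$⟩ʳ j) →
    conjugate (π ⟨$⟩ʳ_) (opposite j) Fin.< conjugate (π ⟨$⟩ʳ_) (opposite i)
  flip lt = subst₂ Fin._<_ (sym (conjugate-commute (π ⟨$⟩ʳ_) _)) (sym (conjugate-commute (π ⟨$⟩ʳ_) _)) (opposite-< lt)

cubicPermutation : (f : Endo n) → Cubic f → Permutation′ n
cubicPermutation f f³ = permutation f (f ∘ f) f³ f³

-- The bijection between words and permutations

module _ {m r n : ℕ} (n≡ : n ≡ 3 * m + r) where

  private
    legal : ∀ {w} → w ∈ extendedWords [] m r → Legal w × cycles w ≡ m × fixedPoints w ≡ r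
    legal w∈ with extends-legal (∈-extendedWords⁻ [] m r w∈) empty
    ... | L , c , f = L , trans c (ℕ.+-identityʳ m) , trans f (ℕ.+-identityʳ r)

    decodeAt : ∀ {w} → w ∈ extendedWords [] m r → ∃[ f ] ∃[ o ] Enc {n} w o f
    decodeAt {w} w∈ with legal w∈
    ... | L , refl , refl with trans (size≡ w) (sym n≡)
    ... | refl = decode L

    toPermutation : ∀ {w o} {f : Endo n} → Enc w o f → cycles w ≡ m → fixedPoints w ≡ r →
      ∃[ π ] HasType m r π × (π ⟨$⟩ʳ_) ≗ conjugate f
    toPermutation {f = f} enc refl refl = π ,
        ( avoiding⇒avoids {π = π} (avoiding-cong (≗-sym (conjugate-involutive f)) avoiding)
        , cyclesOf⇒hasCycleType {π = π} (conjugate-cycles (enc-cycles enc)) ) ,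
        λ _ → refl
      where
      open Invariant (enc⇒invariant enc)
      π : Permutation′ n
      π = cubicPermutation (conjugate f) (conjugate-cubic f cubic)

    ws : List Word
    ws = extendedWords [] m r

    record Realisation (v : Word) : Set where
      field
        {fun} : Endo n
        {o}   : Bool
        enc  : Enc v o fun
        π    : Permutation′ n
        type : HasType m r π
        π≗   : (π ⟨$⟩ʳ_) ≗ conjugate fun

    decoded : ∀ i → Realisation (lookup ws i)
    decoded i =
      let _ , c≡m , f≡r   = legal (∈-lookup {xs = ws} i)
          _ , _ , enc     = decodeAt (∈-lookup {xs = ws} i)
          π , type , π≗   = toPermutation enc c≡m f≡r
      in record { enc = enc ; π = π ; type = type ; π≗ = π≗ }

    to : Fin (length ws) → ∃ (HasType {n} m r)
    to i = π , type
      where open Realisation (decoded i)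

    to-injective : ∀ i j → (proj₁ (to i) ⟨$⟩ʳ_) ≗ (proj₁ (to j) ⟨$⟩ʳ_) → i ≡ j
    to-injective i j eq =
      lookup-injective (extendedWords-unique [] m r) (proj₁ (enc-injective f≗f′ I.enc J.enc))
      where
      module I = Realisation (decoded i)
      module J = Realisation (decoded j)
      f≗f′ : I.fun ≗ J.fun
      f≗f′ x = trans (sym (conjugate-involutive I.fun x)) (trans
        (conjugate-cong (λ y → trans (sym (I.π≗ y)) (trans (eq y) (J.π≗ y))) x) (conjugate-involutive J.fun x))

    -- Counting the fixed points of `f` through both decompositions gives `r`, and the size
    -- `n = 3 * m + r` then gives `m`.
    member : ∀ {w o} {f : Endo n} → Enc w o f → CyclesOf f r m → w ∈ ws
    member {w} enc cyc = ∈-extendedWords⁺ (subst₂ (λ m r → Extends [] m r w) c≡m f≡r (legal⇒extends (enc⇒legal enc)))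
      where
      f≡r : fixedPoints w ≡ r
      f≡r = trans (sym (cyclesOf-fixed (enc-cycles enc))) (cyclesOf-fixed cyc)
      c≡m : cycles w ≡ m
      c≡m = ℕ.*-cancelˡ-≡ (cycles w) m 3 (ℕ.+-cancelʳ-≡ r _ _
        (trans (cong (3 * cycles w +_) (sym f≡r)) (trans (sym (size≡ w)) (trans (sym (enc-size enc)) n≡))))

    to-surjective : ∀ (y : ∃ (HasType {n} m r)) → ∃[ i ] (proj₁ (to i) ⟨$⟩ʳ_) ≗ (proj₁ y ⟨$⟩ʳ_)
    to-surjective (π , avoids , type) with conjugate-cycles (hasCycleType⇒cyclesOf {π = π} type)
    ... | cyc with encode n n ≤-refl (cyclesOf-cubic cyc) (avoids⇒avoiding {π = π} avoids)
    ... | w , o , enc = i , λ x → trans (R.π≗ x)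
            (trans (conjugate-cong (proj₁ (enc-unique R.enc encᵢ)) x) (conjugate-involutive (π ⟨$⟩ʳ_) x))
      where
      w∈ : w ∈ ws
      w∈ = member enc cyc
      i : Fin (length ws)
      i = Any.index w∈
      encᵢ : Enc (lookup ws i) o (conjugate (π ⟨$⟩ʳ_))
      encᵢ = subst (λ v → Enc v o (conjugate (π ⟨$⟩ʳ_))) (Any.lookup-index w∈) enc
      module R = Realisation (decoded i)

  enumeration : HasCardinality (permutationsWith {n} (HasType m r)) (length ws)
  enumeration = record
    { to = to
    ; cong = λ { refl _ → refl }
    ; bijective = (λ {i} {j} → to-injective i j) ,
        λ y → let i , eq = to-surjective y in i , λ { refl → eq }
    }

theorem4p8 : ∀ (m r n : ℕ) → 3 ≤ m → n ≡ 3 * m + r →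
    HasCardinality
    (permutationsWith {n} (λ π → Avoids ⟨132⟩ π × HasCycleType (replicate r 1 ++ replicate m 3) π))
    (∑[ 1 ⋯ m ] (λ k → ∑[ 2 ⋯ k + 1 ] (λ ℓ →
    2 ^ (ℓ ∸ 1) * ((r + ℓ ∸ 1) C r) * Motzkin (k ∸ 1) (ℓ ∸ 2)
    * sum (map (λ xs → product (map Catalan xs)) (compositions m k)))))
theorem4p8 (suc m) r n _ n≡ = subst (HasCardinality _)
  (trans (length-extendedWords [] (suc m) r) (sym (formula m r))) (enumeration {suc m} {r} n≡)
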